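{- Let $S,T$ be as in the context. There exists a $\Sigma_1$ provability predicate of $T$ satisfying $\mathbf{E}$, $\mathbf{C}$ and $\mathbf{D3}$, but not $\mathbf{M}$.
   Context: $\mathcal{L}_A=\{0,\mathsf{s},+,\times,\leq\}$ is the language of first-order arithmetic, and "formula" means $\mathcal{L}_A$-formula; $\ulcorner\varphi\urcorner$ is the numeral of the Gödel number of $\varphi$. $S$ and $T$ are consistent c.e. extensions of Peano Arithmetic $\mathsf{PA}$ in the language $\mathcal{L}_A$ such that $T$ is stronger than $S$ (every theorem of $S$ is a theorem of $T$; $S=T$ is allowed). A formula $\mathrm{Pr}_T(x)$ is a provability predicate of $T$ if for every formula $\varphi$: $T\vdash\varphi$ if and only if $S\vdash\mathrm{Pr}_T(\ulcorner\varphi\urcorner)$. A $\Sigma_1$ provability predicate is one that is a $\Sigma_1$ formula. Conditions on a provability predicate $\mathrm{Pr}_T(x)$: - $\mathbf{E}$: for all formulas $\varphi,\psi$, if $T\vdash\varphi\leftrightarrow\psi$, then $S\vdash\mathrm{Pr}_T(\ulcorner\varphi\urcorner)\leftrightarrow\mathrm{Pr}_T(\ulcorner\psi\urcorner)$. - $\mathbf{C}$: $S\vdash\mathrm{Pr}_T(\ulcorner\varphi\urcorner)\land\mathrm{Pr}_T(\ulcorner\psi\urcorner)\to\mathrm{Pr}_T(\ulcorner\varphi\land\psi\urcorner)$ for all formulas $\varphi,\psi$. - $\mathbf{D3}$: $S\vdash\mathrm{Pr}_T(\ulcorner\varphi\urcorner)\to\mathrm{Pr}_T(\ulcorner\mathrm{Pr}_T(\ulcorner\varphi\urcorner)\urcorner)$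 for every formula $\varphi$. - $\mathbf{M}$: for all formulas $\varphi,\psi$, if $T\vdash\varphi\to\psi$, then $S\vdash\mathrm{Pr}_T(\ulcorner\varphi\urcorner)\to\mathrm{Pr}_T(\ulcorner\psi\urcorner)$. -}

module Defs where

open import Data.Nat using (ℕ; zero; suc; _+_; _<_)
open import Data.Unit using (⊤)
open import Data.Fin using (Fin)
open import Data.Vec using (Vec; []; _∷_; lookup)
open import Data.Vec.Relation.Binary.Pointwise.Inductive using (Pointwise)
open import Data.List using (List; []; _∷_; map)
open import Data.List.Membership.Propositional using (_∈_)
open import Data.Product using (∃; _×_; _,_)
open import Function using (_∘_)
open import Function.Bundles using (_⇔_)
open import Level using (0ℓ)
open import Relation.Binary.PropositionalEquality using (_≡_)
open import Relation.Nullary using (¬_)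
open import Relation.Unary using (Pred)

-- Variables are de Bruijn indices and are not scoped by the type, so that
-- open formulas are formulas and every formula has exactly one code.

infixl 8 _×'_
infixl 7 _+'_
infix  6 _≐_ _≤'_
infixr 5 _∧'_
infixr 4 _∨'_
infixr 3 _⇒_
infix  2 _⇔'_

data Term : Set where
  var  : ℕ → Term
  zero : Term
  s    : Term → Term
  _+'_ : Term → Term → Term
  _×'_ : Term → Term → Term

data Formula : Set where
  _≐_  : Term → Term → Formula
  _≤'_ : Term → Term → Formula
  ⊥'   : Formula
  _⇒_  : Formula → Formula → Formula
  _∧'_ : Formula → Formula → Formula
  _∨'_ : Formula → Formula → Formula
  ∀'   : Formula → Formula
  ∃'   : Formula → Formula

¬' : Formula → Formula
¬' φ = φ ⇒ ⊥'

_⇔'_ : Formula → Formula → Formula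
φ ⇔' ψ = (φ ⇒ ψ) ∧' (ψ ⇒ φ)

Subst : Set
Subst = ℕ → Term

substₜ : Subst → Term → Term
substₜ σ (var i)  = σ i
substₜ σ zero     = zero
substₜ σ (s t)    = s (substₜ σ t)
substₜ σ (t +' u) = substₜ σ t +' substₜ σ u
substₜ σ (t ×' u) = substₜ σ t ×' substₜ σ u

shiftₜ : Term → Term
shiftₜ = substₜ (var ∘ suc)

lift : Subst → Subst
lift σ zero    = var zero
lift σ (suc i) = shiftₜ (σ i)

subst : Subst → Formula → Formula
subst σ (t ≐ u)  = substₜ σ t ≐ substₜ σ u
subst σ (t ≤' u) = substₜ σ t ≤' substₜ σ u
subst σ ⊥'       = ⊥'
subst σ (φ ⇒ ψ)  = subst σ φ ⇒ subst σ ψ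
subst σ (φ ∧' ψ) = subst σ φ ∧' subst σ ψ
subst σ (φ ∨' ψ) = subst σ φ ∨' subst σ ψ
subst σ (∀' φ)   = ∀' (subst (lift σ) φ)
subst σ (∃' φ)   = ∃' (subst (lift σ) φ)

shift : Formula → Formula
shift = subst (var ∘ suc)

-- t • σ sends variable 0 to t and variable i + 1 to σ i.
_•_ : Term → Subst → Subst
(t • σ) zero    = t
(t • σ) (suc i) = σ i

-- The variable being instantiated is 0; the others move down by one.
infix 9 _[_]
_[_] : Formula → Term → Formula
φ [ t ] = subst (t • var) φ

Belowₜ : ℕ → Term → Set
Belowₜ k (var i)  = i < k
Belowₜ k zero     = ⊤
Belowₜ k (s t)    = Belowₜ k t
Belowₜ k (t +' u) = Belowₜ k t × Belowₜ k u
Belowₜ k (t ×' u) = Belowₜ k t × Belowₜ k u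

Below : ℕ → Formula → Set
Below k (t ≐ u)  = Belowₜ k t × Belowₜ k u
Below k (t ≤' u) = Belowₜ k t × Belowₜ k u
Below k ⊥'       = ⊤
Below k (φ ⇒ ψ)  = Below k φ × Below k ψ
Below k (φ ∧' ψ) = Below k φ × Below k ψ
Below k (φ ∨' ψ) = Below k φ × Below k ψ
Below k (∀' φ)   = Below (suc k) φ
Below k (∃' φ)   = Below (suc k) φ

-- In the bounded quantifiers the bound t lives outside the scope of the
-- quantifier, hence the shift.
data Δ₀ : Formula → Set where
  eq  : ∀ t u → Δ₀ (t ≐ u)
  le  : ∀ t u → Δ₀ (t ≤' u)
  bot : Δ₀ ⊥'
  imp : ∀ {φ ψ} → Δ₀ φ → Δ₀ ψ → Δ₀ (φ ⇒ ψ)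
  and : ∀ {φ ψ} → Δ₀ φ → Δ₀ ψ → Δ₀ (φ ∧' ψ)
  or  : ∀ {φ ψ} → Δ₀ φ → Δ₀ ψ → Δ₀ (φ ∨' ψ)
  all : ∀ {φ} t → Δ₀ φ → Δ₀ (∀' (var 0 ≤' shiftₜ t ⇒ φ))
  ex  : ∀ {φ} t → Δ₀ φ → Δ₀ (∃' (var 0 ≤' shiftₜ t ∧' φ))

data Σ₁ : Formula → Set where
  matrix : ∀ {φ} → Δ₀ φ → Σ₁ φ
  exists : ∀ {φ} → Σ₁ φ → Σ₁ (∃' φ)

triangle : ℕ → ℕ
triangle zero    = zero
triangle (suc n) = suc n + triangle n

-- Cantor pairing.
pair : ℕ → ℕ → ℕ
pair a b = triangle (a + b) + b

codeₜ : Term → ℕ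
codeₜ (var i)  = pair 0 i
codeₜ zero     = pair 1 0
codeₜ (s t)    = pair 2 (codeₜ t)
codeₜ (t +' u) = pair 3 (pair (codeₜ t) (codeₜ u))
codeₜ (t ×' u) = pair 4 (pair (codeₜ t) (codeₜ u))

code : Formula → ℕ
code (t ≐ u)  = pair 0 (pair (codeₜ t) (codeₜ u))
code (t ≤' u) = pair 1 (pair (codeₜ t) (codeₜ u))
code ⊥'       = pair 2 0
code (φ ⇒ ψ)  = pair 3 (pair (code φ) (code ψ))
code (φ ∧' ψ) = pair 4 (pair (code φ) (code ψ))
code (φ ∨' ψ) = pair 5 (pair (code φ) (code ψ))
code (∀' φ)   = pair 6 (code φ)
code (∃' φ)   = pair 7 (code φ)

numeral : ℕ → Term
numeral zero    = zero
numeral (suc n) = s (numeral n)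

⌜_⌝ : Formula → Term
⌜ φ ⌝ = numeral (code φ)

-- A theory is given by a set of axioms. An open axiom stands for its
-- universal closure: the rule ax is available under any hypotheses Γ, so
-- the variables of an axiom may always be generalised.
Theory : Set₁
Theory = Pred Formula 0ℓ

infix 1 _∣_⊢_ _⊢_

-- Natural deduction. In ∀I and ∃E the shift of the hypotheses (and of the
-- conclusion) makes variable 0 an eigenvariable.
data _∣_⊢_ (T : Theory) : List Formula → Formula → Set where
  ax   : ∀ {Γ φ} → T φ → T ∣ Γ ⊢ φ
  hyp  : ∀ {Γ φ} → φ ∈ Γ → T ∣ Γ ⊢ φ
  raa  : ∀ {Γ φ} → T ∣ ¬' φ ∷ Γ ⊢ ⊥' → T ∣ Γ ⊢ φ
  ⇒I   : ∀ {Γ φ ψ} → T ∣ φ ∷ Γ ⊢ ψ → T ∣ Γ ⊢ φ ⇒ ψ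
  ⇒E   : ∀ {Γ φ ψ} → T ∣ Γ ⊢ φ ⇒ ψ → T ∣ Γ ⊢ φ → T ∣ Γ ⊢ ψ
  ∧I   : ∀ {Γ φ ψ} → T ∣ Γ ⊢ φ → T ∣ Γ ⊢ ψ → T ∣ Γ ⊢ φ ∧' ψ
  ∧E₁  : ∀ {Γ φ ψ} → T ∣ Γ ⊢ φ ∧' ψ → T ∣ Γ ⊢ φ
  ∧E₂  : ∀ {Γ φ ψ} → T ∣ Γ ⊢ φ ∧' ψ → T ∣ Γ ⊢ ψ
  ∨I₁  : ∀ {Γ φ ψ} → T ∣ Γ ⊢ φ → T ∣ Γ ⊢ φ ∨' ψ
  ∨I₂  : ∀ {Γ φ ψ} → T ∣ Γ ⊢ ψ → T ∣ Γ ⊢ φ ∨' ψ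
  ∨E   : ∀ {Γ φ ψ χ} → T ∣ Γ ⊢ φ ∨' ψ →
         T ∣ φ ∷ Γ ⊢ χ → T ∣ ψ ∷ Γ ⊢ χ → T ∣ Γ ⊢ χ
  ∀I   : ∀ {Γ φ} → T ∣ map shift Γ ⊢ φ → T ∣ Γ ⊢ ∀' φ
  ∀E   : ∀ {Γ φ} t → T ∣ Γ ⊢ ∀' φ → T ∣ Γ ⊢ φ [ t ]
  ∃I   : ∀ {Γ φ} t → T ∣ Γ ⊢ φ [ t ] → T ∣ Γ ⊢ ∃' φ
  ∃E   : ∀ {Γ φ ψ} → T ∣ Γ ⊢ ∃' φ →
         T ∣ φ ∷ map shift Γ ⊢ shift ψ → T ∣ Γ ⊢ ψ
  refl : ∀ {Γ} t → T ∣ Γ ⊢ t ≐ t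
  repl : ∀ {Γ} φ {t u} → T ∣ Γ ⊢ t ≐ u → T ∣ Γ ⊢ φ [ t ] → T ∣ Γ ⊢ φ [ u ]

_⊢_ : Theory → Formula → Set
T ⊢ φ = T ∣ [] ⊢ φ

-- In the induction axiom for φ the induction variable is 0 and the other
-- free variables of φ are parameters.
data PA : Theory where
  s≢0   : PA (∀' (¬' (s (var 0) ≐ zero)))
  s-inj : PA (∀' (∀' (s (var 1) ≐ s (var 0) ⇒ var 1 ≐ var 0)))
  +-0   : PA (∀' (var 0 +' zero ≐ var 0))
  +-s   : PA (∀' (∀' (var 1 +' s (var 0) ≐ s (var 1 +' var 0))))
  ×-0   : PA (∀' (var 0 ×' zero ≐ zero))
  ×-s   : PA (∀' (∀' (var 1 ×' s (var 0) ≐ var 1 ×' var 0 +' var 1)))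
  ≤-def : PA (∀' (∀' (var 1 ≤' var 0 ⇔' ∃' (var 0 +' var 2 ≐ var 1))))
  ind   : ∀ φ → PA (φ [ zero ] ⇒
                    ∀' (φ ⇒ subst (s (var 0) • (var ∘ suc)) φ) ⇒
                    ∀' φ)

Consistent : Theory → Set
Consistent T = ¬ (T ⊢ ⊥')

infix 1 _⊑_
_⊑_ : Theory → Theory → Set
S ⊑ T = ∀ φ → S ⊢ φ → T ⊢ φ

data Rec : ℕ → Set where
  zero : ∀ {n} → Rec n
  succ : Rec 1
  proj : ∀ {n} → Fin n → Rec n
  comp : ∀ {m n} → Rec m → Vec (Rec n) m → Rec n
  prec : ∀ {n} → Rec n → Rec (suc (suc n)) → Rec (suc n)
  μ    : ∀ {n} → Rec (suc n) → Rec n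

-- f ⟨ xs ⟩⇓ y: the partial recursive function f is defined at xs with
-- value y. The recursion argument of prec and the argument searched for
-- by μ come first.
infix 1 _⟨_⟩⇓_
data _⟨_⟩⇓_ : ∀ {n} → Rec n → Vec ℕ n → ℕ → Set where
  zero  : ∀ {n} {xs : Vec ℕ n} → zero ⟨ xs ⟩⇓ 0
  succ  : ∀ {x} → succ ⟨ x ∷ [] ⟩⇓ suc x
  proj  : ∀ {n} {xs : Vec ℕ n} i → proj i ⟨ xs ⟩⇓ lookup xs i
  comp  : ∀ {m n} {f : Rec m} {gs : Vec (Rec n) m} {xs ys z} →
          Pointwise (λ g y → g ⟨ xs ⟩⇓ y) gs ys →
          f ⟨ ys ⟩⇓ z → comp f gs ⟨ xs ⟩⇓ z
  prec0 : ∀ {n} {f : Rec n} {g xs y} →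
          f ⟨ xs ⟩⇓ y → prec f g ⟨ 0 ∷ xs ⟩⇓ y
  precs : ∀ {n} {f : Rec n} {g k xs y z} →
          prec f g ⟨ k ∷ xs ⟩⇓ y → g ⟨ k ∷ y ∷ xs ⟩⇓ z →
          prec f g ⟨ suc k ∷ xs ⟩⇓ z
  μ     : ∀ {n} {f : Rec (suc n)} {xs k} →
          (∀ j → j < k → ∃ λ y → f ⟨ j ∷ xs ⟩⇓ suc y) →
          f ⟨ k ∷ xs ⟩⇓ 0 → μ f ⟨ xs ⟩⇓ k

CE : Pred ℕ 0ℓ → Set
CE X = ∃ λ (f : Rec 1) → ∀ n → X n ⇔ (∃ λ y → f ⟨ n ∷ [] ⟩⇓ y)

-- Computable enumerability of the set of theorems, which every theory with
-- a c.e. set of axioms has.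
CETheory : Theory → Set
CETheory T = CE (λ n → ∃ λ φ → code φ ≡ n × (T ⊢ φ))

record ProvabilityPredicate (S T : Theory) (Pr : Formula) : Set where
  field
    unary : Below 1 Pr
    prov  : ∀ φ → (T ⊢ φ) ⇔ (S ⊢ Pr [ ⌜ φ ⌝ ])

module _ (S T : Theory) (Pr : Formula) where

  E : Set
  E = ∀ φ ψ → T ⊢ φ ⇔' ψ → S ⊢ Pr [ ⌜ φ ⌝ ] ⇔' Pr [ ⌜ ψ ⌝ ]

  M : Set
  M = ∀ φ ψ → T ⊢ φ ⇒ ψ → S ⊢ Pr [ ⌜ φ ⌝ ] ⇒ Pr [ ⌜ ψ ⌝ ]

module _ (S : Theory) (Pr : Formula) where

  C : Set
  C = ∀ φ ψ → S ⊢ Pr [ ⌜ φ ⌝ ] ∧' Pr [ ⌜ ψ ⌝ ] ⇒ Pr [ ⌜ φ ∧' ψ ⌝ ]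

  D3 : Set
  D3 = ∀ φ → S ⊢ Pr [ ⌜ φ ⌝ ] ⇒ Pr [ ⌜ Pr [ ⌜ φ ⌝ ] ⌝ ]

{-# OPTIONS --safe #-}

-- Let Y be the closure of the theorems of T under conjunction, under
-- T-provable equivalence and under φ ↦ Pr(⌜φ⌝), with ⊥ as a further generator
-- in case S proves Pr(⌜⊥⌝) → Pr(⌜ψ₀⌝), where ψ₀ is the open formula x = 0.
-- The self-reference is harmless: Y is c.e. uniformly in the code of Pr.
--
-- Pr represents Y in S, although S may be Σ₁-unsound, and PA proves each
-- instance of the closure rules for Pr. A stage (p , r) is good if the part of
-- Y enumerated by p is closed under the rules for numbers up to r; only the
-- first good stage for r counts. An event at a stage is an S-proof of some
-- Pr(u) while u is not enumerated. Pr(x) says that x is enumerated at a stage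
-- before which there was no event. If an event occurred then S would refute
-- Pr(u), so S ⊢ Pr(x) implies x ∈ Y. As stages with standard r are decided in
-- PA, any other witness of Pr(x) has a nonstandard r, hence is closed under all
-- standard instances of the rules. This gives E, C and D3 without formalising
-- Σ₁-completeness.
--
-- Theorems, ⊥ and sentences φ satisfy T ⊢ ∃xφ → ∀xφ, hence so do all φ ∈ Y,
-- but not ψ₀. If S proved Pr(⌜⊥⌝) → Pr(⌜ψ₀⌝), then ⊥ ∈ Y, S ⊢ Pr(⌜ψ₀⌝) and
-- ψ₀ ∈ Y. So it does not, which refutes M, and Y is the set of theorems of T.
module Submission where

-- With E at hand, M amounts to passing from φ ∧ ψ to ψ: if T proves φ → ψ, then φ is T-equivalent
-- to φ ∧ ψ. The closure Y has no rule that splits a conjunction, and this is the opening. It has to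
-- survive D3, which puts new sentences into Y; hence the separating property is one that every
-- sentence has and an open formula can lack.
--
-- A stage needs two coordinates: `p` measures how much is enumerated, `r` how much closure is
-- demanded. Keeping only first stages makes `p` grow with `r`. Two witnesses of Pr are then
-- comparable, so the one with the larger `r` can serve both premises of a rule; and a standard `r`
-- forces a standard `p`, so the small witnesses form a finite set that PA can check.
--
-- Events are a Rosser device. An unsound S could prove Pr(u) although no standard witness exists.
-- Since Pr looks back at the S-proofs themselves, such a proof spoils every later witness.

open import Defs
open import Data.Empty using (⊥; ⊥-elim)
open import Data.Fin using (Fin; toℕ) renaming (zero to fzero; suc to fsuc)
open import Data.List using (List; []; _∷_; map; _++_; length; filter; upTo)
open import Data.List.Membership.Propositional using (_∈_; lose)
open import Data.List.Membership.Propositional.Properties using (∈-map⁺; ∈-map⁻; ∈-++⁺ˡ; ∈-++⁺ʳ; ∈-filter⁺; ∈-upTo⁺)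
open import Data.List.Properties using (filter-notAll)
open import Data.List.Relation.Unary.All using (All; []; _∷_)
open import Data.List.Relation.Unary.Any using (here; there)
open import Data.Nat
open import Data.Nat.Coprimality using (Coprime; coprime-divisor; coprime-factors) renaming (sym to coprime-sym)
open import Data.Nat.Divisibility renaming (_∣_ to infix 4 _∣ℕ_)
open import Data.Nat.ListAction using (product)
open import Data.Nat.ListAction.Properties using (∈⇒∣product)
open import Data.Nat.Properties
open import Data.Nat.Solver using (module +-*-Solver)
open import Data.Product using (∃; _×_; _,_; proj₁; proj₂)
open import Data.Sum using (_⊎_; inj₁; inj₂; [_,_]′; swap)
open import Data.Vec using (Vec; []; _∷_; lookup)
open import Data.Vec.Relation.Binary.Pointwise.Inductive using (Pointwise; []; _∷_)
open import Function using (_∘_; id)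
open import Function.Bundles using (Equivalence; mk⇔)
open import Relation.Binary.Definitions using (tri<; tri≈; tri>)
open import Relation.Binary.PropositionalEquality using (_≡_; _≢_; refl; sym; trans; cong; cong₂)
open import Relation.Nullary using (¬_; Dec; yes; no; ¬?)
open import Relation.Nullary.Decidable using (map′; _×-dec_; decidable-stable)
open import Data.List.Membership.DecPropositional _≟_ using (_∈?_)
import Data.List.Relation.Unary.All as All
import Data.List.Relation.Unary.All.Properties as All
import Data.Sum as Sum
import Relation.Binary.PropositionalEquality as ≡
import Relation.Nullary.Decidable as Dec
open +-*-Solver using (solve; _:+_; _:*_; con; _:=_)

-- Substitution

substₜ-cong : ∀ {σ τ} → (∀ i → σ i ≡ τ i) → ∀ t → substₜ σ t ≡ substₜ τ t
substₜ-cong e (var i)  = e i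
substₜ-cong e zero     = refl
substₜ-cong e (s t)    = cong s (substₜ-cong e t)
substₜ-cong e (t +' u) = cong₂ _+'_ (substₜ-cong e t) (substₜ-cong e u)
substₜ-cong e (t ×' u) = cong₂ _×'_ (substₜ-cong e t) (substₜ-cong e u)

lift-cong : ∀ {σ τ} → (∀ i → σ i ≡ τ i) → ∀ i → lift σ i ≡ lift τ i
lift-cong e zero    = refl
lift-cong e (suc i) = cong shiftₜ (e i)

subst-cong : ∀ {σ τ} → (∀ i → σ i ≡ τ i) → ∀ φ → subst σ φ ≡ subst τ φ
subst-cong e (t ≐ u)  = cong₂ _≐_ (substₜ-cong e t) (substₜ-cong e u)
subst-cong e (t ≤' u) = cong₂ _≤'_ (substₜ-cong e t) (substₜ-cong e u)
subst-cong e ⊥'       = refl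
subst-cong e (φ ⇒ ψ)  = cong₂ _⇒_ (subst-cong e φ) (subst-cong e ψ)
subst-cong e (φ ∧' ψ) = cong₂ _∧'_ (subst-cong e φ) (subst-cong e ψ)
subst-cong e (φ ∨' ψ) = cong₂ _∨'_ (subst-cong e φ) (subst-cong e ψ)
subst-cong e (∀' φ)   = cong ∀' (subst-cong (lift-cong e) φ)
subst-cong e (∃' φ)   = cong ∃' (subst-cong (lift-cong e) φ)

substₜ-∘ : ∀ τ σ t → substₜ τ (substₜ σ t) ≡ substₜ (substₜ τ ∘ σ) t
substₜ-∘ τ σ (var i)  = refl
substₜ-∘ τ σ zero     = refl
substₜ-∘ τ σ (s t)    = cong s (substₜ-∘ τ σ t)
substₜ-∘ τ σ (t +' u) = cong₂ _+'_ (substₜ-∘ τ σ t) (substₜ-∘ τ σ u)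
substₜ-∘ τ σ (t ×' u) = cong₂ _×'_ (substₜ-∘ τ σ t) (substₜ-∘ τ σ u)

lift-∘ : ∀ τ σ i → substₜ (lift τ) (lift σ i) ≡ lift (substₜ τ ∘ σ) i
lift-∘ τ σ zero    = refl
lift-∘ τ σ (suc i) = trans (substₜ-∘ (lift τ) (var ∘ suc) (σ i)) (sym (substₜ-∘ (var ∘ suc) τ (σ i)))

subst-∘ : ∀ τ σ φ → subst τ (subst σ φ) ≡ subst (substₜ τ ∘ σ) φ
subst-∘ τ σ (t ≐ u)  = cong₂ _≐_ (substₜ-∘ τ σ t) (substₜ-∘ τ σ u)
subst-∘ τ σ (t ≤' u) = cong₂ _≤'_ (substₜ-∘ τ σ t) (substₜ-∘ τ σ u)
subst-∘ τ σ ⊥'       = refl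
subst-∘ τ σ (φ ⇒ ψ)  = cong₂ _⇒_ (subst-∘ τ σ φ) (subst-∘ τ σ ψ)
subst-∘ τ σ (φ ∧' ψ) = cong₂ _∧'_ (subst-∘ τ σ φ) (subst-∘ τ σ ψ)
subst-∘ τ σ (φ ∨' ψ) = cong₂ _∨'_ (subst-∘ τ σ φ) (subst-∘ τ σ ψ)
subst-∘ τ σ (∀' φ)   = cong ∀' (trans (subst-∘ (lift τ) (lift σ) φ) (subst-cong (lift-∘ τ σ) φ))
subst-∘ τ σ (∃' φ)   = cong ∃' (trans (subst-∘ (lift τ) (lift σ) φ) (subst-cong (lift-∘ τ σ) φ))

substₜ-var : ∀ t → substₜ var t ≡ t
substₜ-var (var i)  = refl
substₜ-var zero     = refl
substₜ-var (s t)    = cong s (substₜ-var t)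
substₜ-var (t +' u) = cong₂ _+'_ (substₜ-var t) (substₜ-var u)
substₜ-var (t ×' u) = cong₂ _×'_ (substₜ-var t) (substₜ-var u)

lift-var : ∀ i → lift var i ≡ var i
lift-var zero    = refl
lift-var (suc i) = refl

subst-var : ∀ φ → subst var φ ≡ φ
subst-var (t ≐ u)  = cong₂ _≐_ (substₜ-var t) (substₜ-var u)
subst-var (t ≤' u) = cong₂ _≤'_ (substₜ-var t) (substₜ-var u)
subst-var ⊥'       = refl
subst-var (φ ⇒ ψ)  = cong₂ _⇒_ (subst-var φ) (subst-var ψ)
subst-var (φ ∧' ψ) = cong₂ _∧'_ (subst-var φ) (subst-var ψ)
subst-var (φ ∨' ψ) = cong₂ _∨'_ (subst-var φ) (subst-var ψ)
subst-var (∀' φ)   = cong ∀' (trans (subst-cong lift-var φ) (subst-var φ))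
subst-var (∃' φ)   = cong ∃' (trans (subst-cong lift-var φ) (subst-var φ))

subst-∘≗ : ∀ {τ σ θ} → (∀ i → substₜ τ (σ i) ≡ θ i) → ∀ φ → subst τ (subst σ φ) ≡ subst θ φ
subst-∘≗ {τ} {σ} e φ = trans (subst-∘ τ σ φ) (subst-cong e φ)

shiftₜ-lift : ∀ σ t → substₜ (lift σ) (shiftₜ t) ≡ shiftₜ (substₜ σ t)
shiftₜ-lift σ t = trans (substₜ-∘ (lift σ) (var ∘ suc) t) (sym (substₜ-∘ (var ∘ suc) σ t))

•-shiftₜ : ∀ u σ t → substₜ (u • σ) (shiftₜ t) ≡ substₜ σ t
•-shiftₜ u σ t = substₜ-∘ (u • σ) (var ∘ suc) t

•-lift : ∀ t σ i → substₜ (t • var) (lift σ i) ≡ (t • σ) i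
•-lift t σ zero    = refl
•-lift t σ (suc i) = trans (•-shiftₜ t var (σ i)) (substₜ-var (σ i))

numeral-closed : ∀ σ n → substₜ σ (numeral n) ≡ numeral n
numeral-closed σ zero    = refl
numeral-closed σ (suc n) = cong s (numeral-closed σ n)

AgreeBelow : ℕ → Subst → Subst → Set
AgreeBelow k σ τ = ∀ i → i < k → σ i ≡ τ i

lift-agree : ∀ {k σ τ} → AgreeBelow k σ τ → AgreeBelow (suc k) (lift σ) (lift τ)
lift-agree e zero    _       = refl
lift-agree e (suc i) (s≤s p) = cong shiftₜ (e i p)

Belowₜ-cong : ∀ {k σ τ} t → Belowₜ k t → AgreeBelow k σ τ → substₜ σ t ≡ substₜ τ t
Belowₜ-cong (var i)  b e = e i b
Belowₜ-cong zero     b e = refl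
Belowₜ-cong (s t)    b e = cong s (Belowₜ-cong t b e)
Belowₜ-cong (t +' u) (b , c) e = cong₂ _+'_ (Belowₜ-cong t b e) (Belowₜ-cong u c e)
Belowₜ-cong (t ×' u) (b , c) e = cong₂ _×'_ (Belowₜ-cong t b e) (Belowₜ-cong u c e)

Below-cong : ∀ {k σ τ} φ → Below k φ → AgreeBelow k σ τ → subst σ φ ≡ subst τ φ
Below-cong (t ≐ u)  (b , c) e = cong₂ _≐_ (Belowₜ-cong t b e) (Belowₜ-cong u c e)
Below-cong (t ≤' u) (b , c) e = cong₂ _≤'_ (Belowₜ-cong t b e) (Belowₜ-cong u c e)
Below-cong ⊥'       b e = refl
Below-cong (φ ⇒ ψ)  (b , c) e = cong₂ _⇒_ (Below-cong φ b e) (Below-cong ψ c e)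
Below-cong (φ ∧' ψ) (b , c) e = cong₂ _∧'_ (Below-cong φ b e) (Below-cong ψ c e)
Below-cong (φ ∨' ψ) (b , c) e = cong₂ _∨'_ (Below-cong φ b e) (Below-cong ψ c e)
Below-cong (∀' φ)   b e = cong ∀' (Below-cong φ b (lift-agree e))
Below-cong (∃' φ)   b e = cong ∃' (Below-cong φ b (lift-agree e))

Below-closed : ∀ φ → Below 0 φ → ∀ σ → subst σ φ ≡ φ
Below-closed φ b σ = trans (Below-cong φ b (λ i ())) (subst-var φ)

substₜ-Below : ∀ {m n σ} → (∀ i → i < m → Belowₜ n (σ i)) → ∀ t → Belowₜ m t → Belowₜ n (substₜ σ t)
substₜ-Below h (var i)  b = h i b
substₜ-Below h zero     b = b
substₜ-Below h (s t)    b = substₜ-Below h t b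
substₜ-Below h (t +' u) (b , c) = substₜ-Below h t b , substₜ-Below h u c
substₜ-Below h (t ×' u) (b , c) = substₜ-Below h t b , substₜ-Below h u c

lift-Below : ∀ {m n σ} → (∀ i → i < m → Belowₜ n (σ i)) → ∀ i → i < suc m → Belowₜ (suc n) (lift σ i)
lift-Below h zero    _       = s≤s z≤n
lift-Below {n = n} {σ} h (suc i) (s≤s p) = substₜ-Below {n} {suc n} {var ∘ suc} (λ _ → s≤s) (σ i) (h i p)

subst-Below : ∀ {m n σ} → (∀ i → i < m → Belowₜ n (σ i)) → ∀ φ → Below m φ → Below n (subst σ φ)
subst-Below h (t ≐ u)  (b , c) = substₜ-Below h t b , substₜ-Below h u c
subst-Below h (t ≤' u) (b , c) = substₜ-Below h t b , substₜ-Below h u c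
subst-Below h ⊥'       b = b
subst-Below h (φ ⇒ ψ)  (b , c) = subst-Below h φ b , subst-Below h ψ c
subst-Below h (φ ∧' ψ) (b , c) = subst-Below h φ b , subst-Below h ψ c
subst-Below h (φ ∨' ψ) (b , c) = subst-Below h φ b , subst-Below h ψ c
subst-Below h (∀' φ)   b = subst-Below (lift-Below h) φ b
subst-Below h (∃' φ)   b = subst-Below (lift-Below h) φ b

Belowₜ-mono : ∀ {m n} → m ≤ n → ∀ t → Belowₜ m t → Belowₜ n t
Belowₜ-mono m≤n (var i)  b = ≤-trans b m≤n
Belowₜ-mono m≤n zero     b = b
Belowₜ-mono m≤n (s t)    b = Belowₜ-mono m≤n t b
Belowₜ-mono m≤n (t +' u) (b , c) = Belowₜ-mono m≤n t b , Belowₜ-mono m≤n u c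
Belowₜ-mono m≤n (t ×' u) (b , c) = Belowₜ-mono m≤n t b , Belowₜ-mono m≤n u c

Below-mono : ∀ {m n} → m ≤ n → ∀ φ → Below m φ → Below n φ
Below-mono m≤n (t ≐ u)  (b , c) = Belowₜ-mono m≤n t b , Belowₜ-mono m≤n u c
Below-mono m≤n (t ≤' u) (b , c) = Belowₜ-mono m≤n t b , Belowₜ-mono m≤n u c
Below-mono m≤n ⊥'       b = b
Below-mono m≤n (φ ⇒ ψ)  (b , c) = Below-mono m≤n φ b , Below-mono m≤n ψ c
Below-mono m≤n (φ ∧' ψ) (b , c) = Below-mono m≤n φ b , Below-mono m≤n ψ c
Below-mono m≤n (φ ∨' ψ) (b , c) = Below-mono m≤n φ b , Below-mono m≤n ψ c
Below-mono m≤n (∀' φ)   b = Below-mono (s≤s m≤n) φ b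
Below-mono m≤n (∃' φ)   b = Below-mono (s≤s m≤n) φ b

Belowₜ-⊔ : ∀ t u → ∃ (λ k → Belowₜ k t) → ∃ (λ k → Belowₜ k u) → ∃ λ k → Belowₜ k t × Belowₜ k u
Belowₜ-⊔ t u (k , b) (l , c) = k ⊔ l , Belowₜ-mono (m≤m⊔n k l) t b , Belowₜ-mono (m≤n⊔m k l) u c

Belowₜ-bound : ∀ t → ∃ λ k → Belowₜ k t
Belowₜ-bound (var i)  = suc i , ≤-refl
Belowₜ-bound zero     = 0 , _
Belowₜ-bound (s t)    = Belowₜ-bound t
Belowₜ-bound (t +' u) = Belowₜ-⊔ t u (Belowₜ-bound t) (Belowₜ-bound u)
Belowₜ-bound (t ×' u) = Belowₜ-⊔ t u (Belowₜ-bound t) (Belowₜ-bound u)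

Below-⊔ : ∀ φ ψ → ∃ (λ k → Below k φ) → ∃ (λ k → Below k ψ) → ∃ λ k → Below k φ × Below k ψ
Below-⊔ φ ψ (k , b) (l , c) = k ⊔ l , Below-mono (m≤m⊔n k l) φ b , Below-mono (m≤n⊔m k l) ψ c

Below-bound : ∀ φ → ∃ λ k → Below k φ
Below-bound (t ≐ u)  = Belowₜ-⊔ t u (Belowₜ-bound t) (Belowₜ-bound u)
Below-bound (t ≤' u) = Belowₜ-⊔ t u (Belowₜ-bound t) (Belowₜ-bound u)
Below-bound ⊥'       = 0 , _
Below-bound (φ ⇒ ψ)  = Below-⊔ φ ψ (Below-bound φ) (Below-bound ψ)
Below-bound (φ ∧' ψ) = Below-⊔ φ ψ (Below-bound φ) (Below-bound ψ)
Below-bound (φ ∨' ψ) = Below-⊔ φ ψ (Below-bound φ) (Below-bound ψ)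
Below-bound (∀' φ)   with Below-bound φ
... | k , b = k , Below-mono (n≤1+n k) φ b
Below-bound (∃' φ)   with Below-bound φ
... | k , b = k , Below-mono (n≤1+n k) φ b

-- Natural deduction

coe : ∀ {T Γ φ ψ} → φ ≡ ψ → T ∣ Γ ⊢ φ → T ∣ Γ ⊢ ψ
coe e = ≡.subst (_ ∣ _ ⊢_) e

infix 1 _⊆ᶜ_
_⊆ᶜ_ : List Formula → List Formula → Set
Γ ⊆ᶜ Δ = ∀ {φ} → φ ∈ Γ → φ ∈ Δ

∷⁺ : ∀ {Γ Δ φ} → Γ ⊆ᶜ Δ → φ ∷ Γ ⊆ᶜ φ ∷ Δ
∷⁺ w (here e)  = here e
∷⁺ w (there i) = there (w i)

map⁺ : ∀ {Γ Δ} → Γ ⊆ᶜ Δ → map shift Γ ⊆ᶜ map shift Δ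
map⁺ w i with ∈-map⁻ shift i
... | _ , j , refl = ∈-map⁺ shift (w j)

weaken : ∀ {T Γ Δ φ} → Γ ⊆ᶜ Δ → T ∣ Γ ⊢ φ → T ∣ Δ ⊢ φ
weaken w (ax a)       = ax a
weaken w (hyp i)      = hyp (w i)
weaken w (raa d)      = raa (weaken (∷⁺ w) d)
weaken w (⇒I d)       = ⇒I (weaken (∷⁺ w) d)
weaken w (⇒E d e)     = ⇒E (weaken w d) (weaken w e)
weaken w (∧I d e)     = ∧I (weaken w d) (weaken w e)
weaken w (∧E₁ d)      = ∧E₁ (weaken w d)
weaken w (∧E₂ d)      = ∧E₂ (weaken w d)
weaken w (∨I₁ d)      = ∨I₁ (weaken w d)
weaken w (∨I₂ d)      = ∨I₂ (weaken w d)
weaken w (∨E d e f)   = ∨E (weaken w d) (weaken (∷⁺ w) e) (weaken (∷⁺ w) f)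
weaken w (∀I d)       = ∀I (weaken (map⁺ w) d)
weaken w (∀E t d)     = ∀E t (weaken w d)
weaken w (∃I t d)     = ∃I t (weaken w d)
weaken w (∃E d e)     = ∃E (weaken w d) (weaken (∷⁺ (map⁺ w)) e)
weaken w (refl t)     = refl t
weaken w (repl φ d e) = repl φ (weaken w d) (weaken w e)

wk : ∀ {T Γ φ ψ} → T ∣ Γ ⊢ φ → T ∣ ψ ∷ Γ ⊢ φ
wk = weaken there

closed : ∀ {T Γ φ} → T ⊢ φ → T ∣ Γ ⊢ φ
closed = weaken λ ()

∀E' : ∀ {T Γ σ φ} t → T ∣ Γ ⊢ subst σ (∀' φ) → T ∣ Γ ⊢ subst (t • σ) φ
∀E' {φ = φ} t d = coe (subst-∘≗ (•-lift t _) φ) (∀E t d)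

∃I' : ∀ {T Γ σ φ} t → T ∣ Γ ⊢ subst (t • σ) φ → T ∣ Γ ⊢ subst σ (∃' φ)
∃I' {φ = φ} t d = ∃I t (coe (sym (subst-∘≗ (•-lift t _) φ)) d)

-- Only the first k values of a substitution matter to a theorem whose free
-- variables are below k; these k variables are generalised one by one.
prefix : ℕ → Subst → Subst
prefix zero    σ = var
prefix (suc k) σ = σ 0 • prefix k (σ ∘ suc)

prefix-agree : ∀ k σ → AgreeBelow k (prefix k σ) σ
prefix-agree (suc k) σ zero    _       = refl
prefix-agree (suc k) σ (suc i) (s≤s p) = prefix-agree k (σ ∘ suc) i p

prefix-inst : ∀ {T Γ} k σ {φ} → T ⊢ φ → T ∣ Γ ⊢ subst (prefix k σ) φ
prefix-inst zero    σ {φ} d = coe (sym (subst-var φ)) (closed d)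
prefix-inst (suc k) σ d = ∀E' (σ 0) (prefix-inst k (σ ∘ suc) (∀I d))

inst : ∀ {T Γ φ} σ → T ⊢ φ → T ∣ Γ ⊢ subst σ φ
inst {φ = φ} σ d with Below-bound φ
... | k , b = coe (Below-cong φ b (prefix-agree k σ)) (prefix-inst k σ d)

-- `σ` is pushed into the formula first, shifted so that variable 0 stays free as the hole that
-- `repl` fills. Occurrences that must stay fixed are parked in `σ`, as in the congruence lemmas
-- that follow.
repl' : ∀ {T Γ σ t u} φ → T ∣ Γ ⊢ t ≐ u → T ∣ Γ ⊢ subst (t • σ) φ → T ∣ Γ ⊢ subst (u • σ) φ
repl' {T} {Γ} {σ} φ d e =
  coe (slot _) (repl (subst (var 0 • (shiftₜ ∘ σ)) φ) d (coe (sym (slot _)) e))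
  where
  slot : ∀ v → subst (v • var) (subst (var 0 • (shiftₜ ∘ σ)) φ) ≡ subst (v • σ) φ
  slot v = subst-∘≗ (λ { zero → refl ; (suc i) → •-lift v σ (suc i) }) φ

≐-sym : ∀ {T Γ t u} → T ∣ Γ ⊢ t ≐ u → T ∣ Γ ⊢ u ≐ t
≐-sym {t = t} d = repl' {σ = t • var} (var 0 ≐ var 1) d (refl t)

≐-trans : ∀ {T Γ t u v} → T ∣ Γ ⊢ t ≐ u → T ∣ Γ ⊢ u ≐ v → T ∣ Γ ⊢ t ≐ v
≐-trans {t = t} d e = repl' {σ = t • var} (var 1 ≐ var 0) e d

s-cong : ∀ {T Γ t u} → T ∣ Γ ⊢ t ≐ u → T ∣ Γ ⊢ s t ≐ s u
s-cong {t = t} d = repl' {σ = t • var} (s (var 1) ≐ s (var 0)) d (refl (s t))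

+-cong : ∀ {T Γ t u t' u'} → T ∣ Γ ⊢ t ≐ t' → T ∣ Γ ⊢ u ≐ u' → T ∣ Γ ⊢ t +' u ≐ t' +' u'
+-cong {t = t} {u} {t'} d e =
  ≐-trans (repl' {σ = t • (u • var)} (var 1 +' var 2 ≐ var 0 +' var 2) d (refl (t +' u)))
          (repl' {σ = t' • (u • var)} (var 1 +' var 2 ≐ var 1 +' var 0) e (refl (t' +' u)))

×-cong : ∀ {T Γ t u t' u'} → T ∣ Γ ⊢ t ≐ t' → T ∣ Γ ⊢ u ≐ u' → T ∣ Γ ⊢ t ×' u ≐ t' ×' u'
×-cong {t = t} {u} {t'} d e =
  ≐-trans (repl' {σ = t • (u • var)} (var 1 ×' var 2 ≐ var 0 ×' var 2) d (refl (t ×' u)))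
          (repl' {σ = t' • (u • var)} (var 1 ×' var 2 ≐ var 1 ×' var 0) e (refl (t' ×' u)))

≤-cong : ∀ {T Γ t u t' u'} → T ∣ Γ ⊢ t ≐ t' → T ∣ Γ ⊢ u ≐ u' → T ∣ Γ ⊢ t ≤' u → T ∣ Γ ⊢ t' ≤' u'
≤-cong {t = t} {u} {t'} d e f =
  repl' {σ = t' • var} (var 1 ≤' var 0) e (repl' {σ = u • var} (var 0 ≤' var 1) d f)

≐-cong : ∀ {T Γ t u t' u'} → T ∣ Γ ⊢ t ≐ t' → T ∣ Γ ⊢ u ≐ u' → T ∣ Γ ⊢ t ≐ u → T ∣ Γ ⊢ t' ≐ u'
≐-cong d e f = ≐-trans (≐-sym d) (≐-trans f e)

efq : ∀ {T Γ φ} → T ∣ Γ ⊢ ⊥' → T ∣ Γ ⊢ φ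
efq d = raa (wk d)

h0 : ∀ {T Γ φ} → T ∣ φ ∷ Γ ⊢ φ
h0 = hyp (here refl)

h1 : ∀ {T Γ φ ψ} → T ∣ ψ ∷ φ ∷ Γ ⊢ φ
h1 = hyp (there (here refl))

h2 : ∀ {T Γ φ ψ χ} → T ∣ χ ∷ ψ ∷ φ ∷ Γ ⊢ φ
h2 = hyp (there (there (here refl)))

-- Arithmetic in PA

∀E₂ : ∀ {T Γ φ} t u → T ∣ Γ ⊢ ∀' (∀' φ) → T ∣ Γ ⊢ subst (u • (t • var)) φ
∀E₂ {φ = φ} t u d = ∀E' u (∀E t d)

∀E₃ : ∀ {T Γ φ} t u v → T ∣ Γ ⊢ ∀' (∀' (∀' φ)) → T ∣ Γ ⊢ subst (v • (u • (t • var))) φ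
∀E₃ t u v d = ∀E' v (∀E₂ t u d)

induction : ∀ φ → PA ⊢ φ [ zero ] → PA ⊢ φ ⇒ subst (s (var 0) • (var ∘ suc)) φ → PA ⊢ ∀' φ
induction φ b i = ⇒E (⇒E (ax (ind φ)) b) (∀I i)

module _ {Γ : List Formula} where

  +-zero : ∀ t → PA ∣ Γ ⊢ t +' zero ≐ t
  +-zero t = ∀E t (ax +-0)

  +-succ : ∀ t u → PA ∣ Γ ⊢ t +' s u ≐ s (t +' u)
  +-succ t u = ∀E₂ t u (ax +-s)

  ×-zero : ∀ t → PA ∣ Γ ⊢ t ×' zero ≐ zero
  ×-zero t = ∀E t (ax ×-0)

  ×-succ : ∀ t u → PA ∣ Γ ⊢ t ×' s u ≐ t ×' u +' t
  ×-succ t u = ∀E₂ t u (ax ×-s)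

  s-injective : ∀ {t u} → PA ∣ Γ ⊢ s t ≐ s u → PA ∣ Γ ⊢ t ≐ u
  s-injective {t} {u} d = ⇒E (∀E₂ t u (ax s-inj)) d

  s-nonzero : ∀ {t} → PA ∣ Γ ⊢ s t ≐ zero → PA ∣ Γ ⊢ ⊥'
  s-nonzero {t} d = ⇒E (∀E t (ax s≢0)) d

  ≤-intro : ∀ {t u} z → PA ∣ Γ ⊢ z +' t ≐ u → PA ∣ Γ ⊢ t ≤' u
  ≤-intro {t} {u} z d =
    ⇒E (∧E₂ (∀E₂ t u (ax ≤-def))) (∃I' {σ = u • (t • var)} {φ = var 0 +' var 2 ≐ var 1} z d)

  ≤-elim : ∀ {t u} → PA ∣ Γ ⊢ t ≤' u → PA ∣ Γ ⊢ ∃' (var 0 +' shiftₜ t ≐ shiftₜ u)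
  ≤-elim {t} {u} d = ⇒E (∧E₁ (∀E₂ t u (ax ≤-def))) d

zero-+ : ∀ {Γ} t → PA ∣ Γ ⊢ zero +' t ≐ t
zero-+ t = ∀E t (closed (induction (zero +' var 0 ≐ var 0) (+-zero zero)
  (⇒I (≐-trans (+-succ _ _) (s-cong h0)))))

succ-+ : ∀ {Γ} t u → PA ∣ Γ ⊢ s t +' u ≐ s (t +' u)
succ-+ t u = ∀E₂ t u (closed (∀I (induction (s (var 1) +' var 0 ≐ s (var 1 +' var 0))
  (≐-trans (+-zero _) (≐-sym (s-cong (+-zero _))))
  (⇒I (≐-trans (+-succ _ _) (≐-trans (s-cong h0) (s-cong (≐-sym (+-succ _ _)))))))))

+-assoc' : ∀ {Γ} t u v → PA ∣ Γ ⊢ (t +' u) +' v ≐ t +' (u +' v)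
+-assoc' t u v = ∀E₃ t u v (closed (∀I (∀I (induction ((var 2 +' var 1) +' var 0 ≐ var 2 +' (var 1 +' var 0))
  (≐-trans (+-zero _) (+-cong (refl _) (≐-sym (+-zero _))))
  (⇒I (≐-trans (+-succ _ _) (≐-trans (s-cong h0) (≐-trans (≐-sym (+-succ _ _))
    (+-cong (refl _) (≐-sym (+-succ _ _)))))))))))

zero-or-succ : ∀ {Γ} t → PA ∣ Γ ⊢ t ≐ zero ∨' ∃' (shiftₜ t ≐ s (var 0))
zero-or-succ t = ∀E t (closed (induction (var 0 ≐ zero ∨' ∃' (var 1 ≐ s (var 0)))
  (∨I₁ (refl _))
  (⇒I (∨I₂ (∃I' {σ = s (var 0) • (var ∘ suc)} {φ = var 1 ≐ s (var 0)} (var 0) (refl _))))))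

0≤' : ∀ {Γ} t → PA ∣ Γ ⊢ zero ≤' t
0≤' t = ≤-intro t (+-zero t)

≤'-trans-open : PA ⊢ var 0 ≤' var 1 ⇒ var 1 ≤' var 2 ⇒ var 0 ≤' var 2
≤'-trans-open = ⇒I (⇒I (∃E (≤-elim h1) (∃E (≤-elim h1)
  (≤-intro (var 0 +' var 1) (≐-trans (+-assoc' _ _ _) (≐-trans (+-cong (refl _) h1) h0))))))

≤'-trans : ∀ {Γ t u v} → PA ∣ Γ ⊢ t ≤' u → PA ∣ Γ ⊢ u ≤' v → PA ∣ Γ ⊢ t ≤' v
≤'-trans {t = t} {u} {v} d e = ⇒E (⇒E (inst (t • (u • (v • var))) ≤'-trans-open) d) e

≤'-total : ∀ {Γ} t u → PA ∣ Γ ⊢ t ≤' u ∨' u ≤' t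
≤'-total t u = ∀E₂ t u (closed (∀I (induction (var 1 ≤' var 0 ∨' var 0 ≤' var 1)
  (∨I₂ (0≤' _))
  (⇒I (∨E h0
    (∃E (≤-elim h0) (∨I₁ (≤-intro (s (var 0)) (≐-trans (succ-+ _ _) (s-cong h0)))))
    -- Here z + u = t. If z is zero, then t = u lies below the successor of u; otherwise the
    -- predecessor of z witnesses that the successor of u is still below t.
    (∃E (≤-elim h0) (∨E (zero-or-succ (var 0))
      (∨I₁ (≤-intro (s zero) (≐-trans (succ-+ _ _) (s-cong (≐-trans (zero-+ _)
        (≐-sym (≐-trans (≐-sym (zero-+ _)) (≐-trans (+-cong (≐-sym h0) (refl _)) h1))))))))
      (∃E h0 (∨I₂ (≤-intro (var 0) (≐-trans (+-succ _ _) (≐-trans (≐-sym (succ-+ _ _))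
        (≐-trans (+-cong (≐-sym h0) (refl _)) h2)))))))))))))

≤'-succ-open : PA ⊢ var 0 ≤' s (var 1) ⇒ var 0 ≐ s (var 1) ∨' var 0 ≤' var 1
≤'-succ-open = ⇒I (∃E (≤-elim h0) (∨E (zero-or-succ (var 0))
  (∨I₁ (≐-trans (≐-sym (zero-+ _)) (≐-trans (+-cong (≐-sym h0) (refl _)) h1)))
  (∃E h0 (∨I₂ (≤-intro (var 0) (s-injective (≐-trans (≐-sym (succ-+ _ _))
    (≐-trans (+-cong (≐-sym h0) (refl _)) h2))))))))

≤'-succ : ∀ {Γ t u} → PA ∣ Γ ⊢ t ≤' s u → PA ∣ Γ ⊢ t ≐ s u ∨' t ≤' u
≤'-succ {t = t} {u} d = ⇒E (inst (t • (u • var)) ≤'-succ-open) d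

≤'-zero-open : PA ⊢ var 0 ≤' zero ⇒ var 0 ≐ zero
≤'-zero-open = ⇒I (∃E (≤-elim h0) (∨E (zero-or-succ (var 1)) h0
  (∃E h0 (efq (s-nonzero (≐-trans (≐-sym (+-succ _ _)) (≐-trans (+-cong (refl _) (≐-sym h0)) h2)))))))

≤'-zero : ∀ {Γ t} → PA ∣ Γ ⊢ t ≤' zero → PA ∣ Γ ⊢ t ≐ zero
≤'-zero {t = t} d = ⇒E (inst (t • var) ≤'-zero-open) d

-- A standard bound turns a bounded variable into a finite case split carried out outside the
-- calculus. Every later claim that PA can check a finite set of candidates goes through this.
≤'-numeral-cases : ∀ {Γ t χ} n → PA ∣ Γ ⊢ t ≤' numeral n →
  (∀ i → i ≤ n → PA ∣ t ≐ numeral i ∷ Γ ⊢ χ) → PA ∣ Γ ⊢ χ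
≤'-numeral-cases zero    d f = ⇒E (⇒I (f 0 z≤n)) (≤'-zero d)
≤'-numeral-cases (suc n) d f = ∨E (≤'-succ d) (f (suc n) ≤-refl)
  (≤'-numeral-cases n h0 (λ i i≤n → weaken (∷⁺ (there)) (f i (m≤n⇒m≤1+n i≤n))))

numeral-≢ : ∀ {Γ} m n → m ≢ n → PA ∣ Γ ⊢ numeral m ≐ numeral n → PA ∣ Γ ⊢ ⊥'
numeral-≢ zero    zero    ne d = ⊥-elim (ne refl)
numeral-≢ zero    (suc n) ne d = s-nonzero (≐-sym d)
numeral-≢ (suc m) zero    ne d = s-nonzero d
numeral-≢ (suc m) (suc n) ne d = numeral-≢ m n (ne ∘ cong suc) (s-injective d)

numeral-+ : ∀ {Γ} m n → PA ∣ Γ ⊢ numeral m +' numeral n ≐ numeral (m + n)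
numeral-+ m zero    = coe (cong (λ k → numeral m +' zero ≐ numeral k) (sym (+-identityʳ m))) (+-zero _)
numeral-+ m (suc n) = coe (cong (λ k → numeral m +' numeral (suc n) ≐ numeral k) (sym (+-suc m n)))
  (≐-trans (+-succ _ _) (s-cong (numeral-+ m n)))

numeral-× : ∀ {Γ} m n → PA ∣ Γ ⊢ numeral m ×' numeral n ≐ numeral (m * n)
numeral-× m zero    = coe (cong (λ k → numeral m ×' zero ≐ numeral k) (sym (*-zeroʳ m))) (×-zero _)
numeral-× m (suc n) = coe (cong (λ k → numeral m ×' numeral (suc n) ≐ numeral k)
    (trans (+-comm (m * n) m) (sym (*-suc m n))))
  (≐-trans (×-succ _ _) (≐-trans (+-cong (numeral-× m n) (refl _)) (numeral-+ (m * n) m)))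

numeral-≤ : ∀ {Γ m n} → m ≤ n → PA ∣ Γ ⊢ numeral m ≤' numeral n
numeral-≤ {m = m} {n} m≤n = ≤-intro (numeral (n ∸ m))
  (coe (cong (λ k → numeral (n ∸ m) +' numeral m ≐ numeral k) (m∸n+n≡m m≤n)) (numeral-+ (n ∸ m) m))

numeral-≰ : ∀ {Γ m n} → ¬ m ≤ n → PA ∣ Γ ⊢ numeral m ≤' numeral n → PA ∣ Γ ⊢ ⊥'
numeral-≰ {m = m} {n} m≰n d = ≤'-numeral-cases n d
  (λ i i≤n → numeral-≢ m i (λ { refl → m≰n i≤n }) h0)

≤'-or-≥ : ∀ {Γ t χ} n → (∀ i → i ≤ n → PA ∣ t ≐ numeral i ∷ Γ ⊢ χ) → PA ∣ numeral n ≤' t ∷ Γ ⊢ χ → PA ∣ Γ ⊢ χ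
≤'-or-≥ {t = t} n f e = ∨E (≤'-total t (numeral n))
  (≤'-numeral-cases n h0 (λ i i≤n → weaken (∷⁺ (there)) (f i i≤n))) e

-- Truth, and decidability of Δ₀ formulas in PA

Env : Set
Env = ℕ → ℕ

infixr 5 _◂_
_◂_ : ℕ → Env → Env
(x ◂ ρ) zero    = x
(x ◂ ρ) (suc i) = ρ i

⟦_⟧ₜ : Term → Env → ℕ
⟦ var i ⟧ₜ  ρ = ρ i
⟦ zero ⟧ₜ   ρ = 0
⟦ s t ⟧ₜ    ρ = suc (⟦ t ⟧ₜ ρ)
⟦ t +' u ⟧ₜ ρ = ⟦ t ⟧ₜ ρ + ⟦ u ⟧ₜ ρ
⟦ t ×' u ⟧ₜ ρ = ⟦ t ⟧ₜ ρ * ⟦ u ⟧ₜ ρ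

⟦_⟧ : Formula → Env → Set
⟦ t ≐ u ⟧  ρ = ⟦ t ⟧ₜ ρ ≡ ⟦ u ⟧ₜ ρ
⟦ t ≤' u ⟧ ρ = ⟦ t ⟧ₜ ρ ≤ ⟦ u ⟧ₜ ρ
⟦ ⊥' ⟧     ρ = ⊥
⟦ φ ⇒ ψ ⟧  ρ = ⟦ φ ⟧ ρ → ⟦ ψ ⟧ ρ
⟦ φ ∧' ψ ⟧ ρ = ⟦ φ ⟧ ρ × ⟦ ψ ⟧ ρ
⟦ φ ∨' ψ ⟧ ρ = ⟦ φ ⟧ ρ ⊎ ⟦ ψ ⟧ ρ
⟦ ∀' φ ⟧   ρ = ∀ x → ⟦ φ ⟧ (x ◂ ρ)
⟦ ∃' φ ⟧   ρ = ∃ λ x → ⟦ φ ⟧ (x ◂ ρ)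

⟦⟧ₜ-subst : ∀ {σ ρ ρ'} → (∀ i → ⟦ σ i ⟧ₜ ρ ≡ ρ' i) → ∀ t → ⟦ substₜ σ t ⟧ₜ ρ ≡ ⟦ t ⟧ₜ ρ'
⟦⟧ₜ-subst e (var i)  = e i
⟦⟧ₜ-subst e zero     = refl
⟦⟧ₜ-subst e (s t)    = cong suc (⟦⟧ₜ-subst e t)
⟦⟧ₜ-subst e (t +' u) = cong₂ _+_ (⟦⟧ₜ-subst e t) (⟦⟧ₜ-subst e u)
⟦⟧ₜ-subst e (t ×' u) = cong₂ _*_ (⟦⟧ₜ-subst e t) (⟦⟧ₜ-subst e u)

⟦shiftₜ⟧ : ∀ x ρ t → ⟦ shiftₜ t ⟧ₜ (x ◂ ρ) ≡ ⟦ t ⟧ₜ ρ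
⟦shiftₜ⟧ x ρ t = ⟦⟧ₜ-subst (λ _ → refl) t

⟦⟧-lift : ∀ {σ ρ ρ'} x → (∀ i → ⟦ σ i ⟧ₜ ρ ≡ ρ' i) → ∀ i → ⟦ lift σ i ⟧ₜ (x ◂ ρ) ≡ (x ◂ ρ') i
⟦⟧-lift x e zero    = refl
⟦⟧-lift {σ} {ρ} x e (suc i) = trans (⟦shiftₜ⟧ x ρ (σ i)) (e i)

⟦⟧-subst⁻ : ∀ {σ ρ ρ'} → (∀ i → ⟦ σ i ⟧ₜ ρ ≡ ρ' i) → ∀ φ → ⟦ subst σ φ ⟧ ρ → ⟦ φ ⟧ ρ'
⟦⟧-subst⁺ : ∀ {σ ρ ρ'} → (∀ i → ⟦ σ i ⟧ₜ ρ ≡ ρ' i) → ∀ φ → ⟦ φ ⟧ ρ' → ⟦ subst σ φ ⟧ ρ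
⟦⟧-subst⁻ e (t ≐ u)  d = trans (sym (⟦⟧ₜ-subst e t)) (trans d (⟦⟧ₜ-subst e u))
⟦⟧-subst⁻ e (t ≤' u) d = ≡.subst₂ _≤_ (⟦⟧ₜ-subst e t) (⟦⟧ₜ-subst e u) d
⟦⟧-subst⁻ e (φ ⇒ ψ)  d x = ⟦⟧-subst⁻ e ψ (d (⟦⟧-subst⁺ e φ x))
⟦⟧-subst⁻ e (φ ∧' ψ) (d , d') = ⟦⟧-subst⁻ e φ d , ⟦⟧-subst⁻ e ψ d'
⟦⟧-subst⁻ e (φ ∨' ψ) (inj₁ d) = inj₁ (⟦⟧-subst⁻ e φ d)
⟦⟧-subst⁻ e (φ ∨' ψ) (inj₂ d) = inj₂ (⟦⟧-subst⁻ e ψ d)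
⟦⟧-subst⁻ e (∀' φ)   d x = ⟦⟧-subst⁻ (⟦⟧-lift x e) φ (d x)
⟦⟧-subst⁻ e (∃' φ)   (x , d) = x , ⟦⟧-subst⁻ (⟦⟧-lift x e) φ d
⟦⟧-subst⁺ e (t ≐ u)  d = trans (⟦⟧ₜ-subst e t) (trans d (sym (⟦⟧ₜ-subst e u)))
⟦⟧-subst⁺ e (t ≤' u) d = ≡.subst₂ _≤_ (sym (⟦⟧ₜ-subst e t)) (sym (⟦⟧ₜ-subst e u)) d
⟦⟧-subst⁺ e (φ ⇒ ψ)  d x = ⟦⟧-subst⁺ e ψ (d (⟦⟧-subst⁻ e φ x))
⟦⟧-subst⁺ e (φ ∧' ψ) (d , d') = ⟦⟧-subst⁺ e φ d , ⟦⟧-subst⁺ e ψ d'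
⟦⟧-subst⁺ e (φ ∨' ψ) (inj₁ d) = inj₁ (⟦⟧-subst⁺ e φ d)
⟦⟧-subst⁺ e (φ ∨' ψ) (inj₂ d) = inj₂ (⟦⟧-subst⁺ e ψ d)
⟦⟧-subst⁺ e (∀' φ)   d x = ⟦⟧-subst⁺ (⟦⟧-lift x e) φ (d x)
⟦⟧-subst⁺ e (∃' φ)   (x , d) = x , ⟦⟧-subst⁺ (⟦⟧-lift x e) φ d

⟦⟧-ext : ∀ {ρ ρ'} → (∀ i → ρ i ≡ ρ' i) → ∀ φ → ⟦ φ ⟧ ρ → ⟦ φ ⟧ ρ'
⟦⟧-ext {ρ} e φ d = ⟦⟧-subst⁻ {σ = var} e φ (⟦⟧-subst⁺ {σ = var} (λ _ → refl) φ d)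

Δ₀-subst : ∀ {φ} σ → Δ₀ φ → Δ₀ (subst σ φ)
Δ₀-subst σ (eq t u)  = eq _ _
Δ₀-subst σ (le t u)  = le _ _
Δ₀-subst σ bot       = bot
Δ₀-subst σ (imp d e) = imp (Δ₀-subst σ d) (Δ₀-subst σ e)
Δ₀-subst σ (and d e) = and (Δ₀-subst σ d) (Δ₀-subst σ e)
Δ₀-subst σ (or d e)  = or (Δ₀-subst σ d) (Δ₀-subst σ e)
Δ₀-subst σ (all t d) rewrite shiftₜ-lift σ t = all (substₜ σ t) (Δ₀-subst (lift σ) d)
Δ₀-subst σ (ex t d)  rewrite shiftₜ-lift σ t = ex (substₜ σ t) (Δ₀-subst (lift σ) d)

numerals : Env → Subst
numerals ρ = numeral ∘ ρ

term-value : ∀ {Γ} ρ t → PA ∣ Γ ⊢ substₜ (numerals ρ) t ≐ numeral (⟦ t ⟧ₜ ρ)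
term-value ρ (var i)  = refl _
term-value ρ zero     = refl _
term-value ρ (s t)    = s-cong (term-value ρ t)
term-value ρ (t +' u) = ≐-trans (+-cong (term-value ρ t) (term-value ρ u)) (numeral-+ (⟦ t ⟧ₜ ρ) (⟦ u ⟧ₜ ρ))
term-value ρ (t ×' u) = ≐-trans (×-cong (term-value ρ t) (term-value ρ u)) (numeral-× (⟦ t ⟧ₜ ρ) (⟦ u ⟧ₜ ρ))

-- Truth and provability are decided together: the metatheory is constructive, so the same recursion
-- that yields Δ₀-completeness of PA must also supply the case splits on the truth of Δ₀ formulas.
Decided : Set → Formula → Set
Decided A φ = (A × (PA ⊢ φ)) ⊎ ((¬ A) × (PA ⊢ ¬' φ))

search : ∀ {P Q : ℕ → Set} n → (∀ i → i ≤ n → P i ⊎ Q i) →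
  (∀ i → i ≤ n → P i) ⊎ (∃ λ i → i ≤ n × Q i)
search zero    f with f 0 z≤n
... | inj₁ p = inj₁ λ { zero z≤n → p }
... | inj₂ q = inj₂ (0 , z≤n , q)
search (suc n) f with f (suc n) ≤-refl | search n (λ i i≤n → f i (m≤n⇒m≤1+n i≤n))
... | inj₂ q | _ = inj₂ (suc n , ≤-refl , q)
... | inj₁ p | inj₂ (i , i≤n , q) = inj₂ (i , m≤n⇒m≤1+n i≤n , q)
... | inj₁ p | inj₁ g = inj₁ h
  where
  h : ∀ i → i ≤ suc n → _
  h i i≤ with m≤n⇒m<n∨m≡n i≤
  ... | inj₁ (s≤s i≤n) = g i i≤n
  ... | inj₂ refl = p

lift-numerals : ∀ ρ i → lift (numerals ρ) i ≡ (var 0 • numerals ρ) i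
lift-numerals ρ zero    = refl
lift-numerals ρ (suc i) = numeral-closed (var ∘ suc) (ρ i)

numerals-◂ : ∀ x ρ i → numerals (x ◂ ρ) i ≡ (numeral x • numerals ρ) i
numerals-◂ x ρ zero    = refl
numerals-◂ x ρ (suc i) = refl

module _ (ρ : Env) (t : Term) (φ : Formula) where

  private
    n : ℕ
    n = ⟦ t ⟧ₜ ρ

    instance-at : ∀ {Γ} x → PA ⊢ subst (numerals (x ◂ ρ)) φ → PA ∣ Γ ⊢ subst (numeral x • numerals ρ) φ
    instance-at x d = coe (subst-cong (numerals-◂ x ρ) φ) (closed d)

    ≤-bound : ∀ {Γ} i → i ≤ n → PA ∣ Γ ⊢ numeral i ≤' substₜ (numeral i • numerals ρ) (shiftₜ t)
    ≤-bound i i≤n = coe (cong (numeral i ≤'_) (sym (•-shiftₜ (numeral i) (numerals ρ) t)))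
      (≤-cong (refl _) (≐-sym (term-value ρ t)) (numeral-≤ i≤n))

    bound-cases : ∀ {Γ χ} → PA ∣ Γ ⊢ var 0 ≤' substₜ (lift (numerals ρ)) (shiftₜ t) →
      (∀ i → i ≤ n → PA ∣ var 0 ≐ numeral i ∷ Γ ⊢ χ) → PA ∣ Γ ⊢ χ
    bound-cases d f = ≤'-numeral-cases n (≤-cong (refl _) bound d) f
      where
      bound : ∀ {Γ} → PA ∣ Γ ⊢ substₜ (lift (numerals ρ)) (shiftₜ t) ≐ numeral n
      bound = coe (cong₂ _≐_ (sym (shiftₜ-lift (numerals ρ) t)) (numeral-closed (var ∘ suc) n))
        (inst (var ∘ suc) (term-value ρ t))

  ∀≤-holds : (∀ i → i ≤ n → PA ⊢ subst (numerals (i ◂ ρ)) φ) →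
    PA ⊢ subst (numerals ρ) (∀' (var 0 ≤' shiftₜ t ⇒ φ))
  ∀≤-holds f = ∀I (⇒I (bound-cases h0 λ i i≤n →
    coe (sym (subst-cong (lift-numerals ρ) φ)) (repl' φ (≐-sym h0) (instance-at i (f i i≤n)))))

  ∀≤-fails : ∀ i → i ≤ n → PA ⊢ ¬' (subst (numerals (i ◂ ρ)) φ) →
    PA ⊢ ¬' (subst (numerals ρ) (∀' (var 0 ≤' shiftₜ t ⇒ φ)))
  ∀≤-fails i i≤n d = ⇒I (⇒E (closed d) (coe (sym (subst-cong (numerals-◂ i ρ) φ))
    (⇒E (∀E' {σ = numerals ρ} {φ = var 0 ≤' shiftₜ t ⇒ φ} (numeral i) h0) (≤-bound i i≤n))))

  ∃≤-holds : ∀ i → i ≤ n → PA ⊢ subst (numerals (i ◂ ρ)) φ →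
    PA ⊢ subst (numerals ρ) (∃' (var 0 ≤' shiftₜ t ∧' φ))
  ∃≤-holds i i≤n d = ∃I' {σ = numerals ρ} {φ = var 0 ≤' shiftₜ t ∧' φ} (numeral i)
    (∧I (≤-bound i i≤n) (instance-at i d))

  ∃≤-fails : (∀ i → i ≤ n → PA ⊢ ¬' (subst (numerals (i ◂ ρ)) φ)) →
    PA ⊢ ¬' (subst (numerals ρ) (∃' (var 0 ≤' shiftₜ t ∧' φ)))
  ∃≤-fails f = ⇒I (∃E h0 (bound-cases (∧E₁ h0) λ i i≤n →
    ⇒E (closed (f i i≤n)) (coe (sym (subst-cong (numerals-◂ i ρ) φ))
      (repl' φ h0 (coe (subst-cong (lift-numerals ρ) φ) (∧E₂ h1))))))

≤-unshift : ∀ x ρ t → x ≤ ⟦ shiftₜ t ⟧ₜ (x ◂ ρ) → x ≤ ⟦ t ⟧ₜ ρ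
≤-unshift x ρ t = ≡.subst (x ≤_) (⟦shiftₜ⟧ x ρ t)

≤-shift : ∀ x ρ t → x ≤ ⟦ t ⟧ₜ ρ → x ≤ ⟦ shiftₜ t ⟧ₜ (x ◂ ρ)
≤-shift x ρ t = ≡.subst (x ≤_) (sym (⟦shiftₜ⟧ x ρ t))

decide : ∀ {φ} → Δ₀ φ → ∀ ρ → Decided (⟦ φ ⟧ ρ) (subst (numerals ρ) φ)
decide (eq t u) ρ with ⟦ t ⟧ₜ ρ ≟ ⟦ u ⟧ₜ ρ
... | yes e = inj₁ (e , ≐-trans (term-value ρ t)
        (≐-sym (coe (cong (λ k → _ ≐ numeral k) (sym e)) (term-value ρ u))))
... | no ne = inj₂ (ne , ⇒I (numeral-≢ _ _ ne (≐-cong (term-value ρ t) (term-value ρ u) h0)))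
decide (le t u) ρ with ⟦ t ⟧ₜ ρ ≤? ⟦ u ⟧ₜ ρ
... | yes e = inj₁ (e , ≤-cong (≐-sym (term-value ρ t)) (≐-sym (term-value ρ u)) (numeral-≤ e))
... | no ne = inj₂ (ne , ⇒I (numeral-≰ ne (≤-cong (term-value ρ t) (term-value ρ u) h0)))
decide bot ρ = inj₂ ((λ ()) , ⇒I h0)
decide (imp d e) ρ with decide d ρ | decide e ρ
... | inj₁ (a , p) | inj₁ (b , q) = inj₁ ((λ _ → b) , ⇒I (closed q))
... | inj₁ (a , p) | inj₂ (b , q) = inj₂ ((λ f → b (f a)) , ⇒I (⇒E (closed q) (⇒E h0 (closed p))))
... | inj₂ (a , p) | _ = inj₁ ((λ x → ⊥-elim (a x)) , ⇒I (efq (⇒E (closed p) h0)))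
decide (and d e) ρ with decide d ρ | decide e ρ
... | inj₁ (a , p) | inj₁ (b , q) = inj₁ ((a , b) , ∧I p q)
... | inj₁ (a , p) | inj₂ (b , q) = inj₂ (b ∘ proj₂ , ⇒I (⇒E (closed q) (∧E₂ h0)))
... | inj₂ (a , p) | _ = inj₂ (a ∘ proj₁ , ⇒I (⇒E (closed p) (∧E₁ h0)))
decide (or d e) ρ with decide d ρ | decide e ρ
... | inj₁ (a , p) | _ = inj₁ (inj₁ a , ∨I₁ p)
... | inj₂ (a , p) | inj₁ (b , q) = inj₁ (inj₂ b , ∨I₂ q)
... | inj₂ (a , p) | inj₂ (b , q) = inj₂ ((λ { (inj₁ x) → a x ; (inj₂ y) → b y }) ,
        ⇒I (∨E h0 (⇒E (closed p) h0) (⇒E (closed q) h0)))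
decide (all {φ} t d) ρ with search (⟦ t ⟧ₜ ρ) (λ i _ → decide d (i ◂ ρ))
... | inj₁ f = inj₁ ((λ x x≤ → proj₁ (f x (≤-unshift x ρ t x≤))) , ∀≤-holds ρ t φ (λ i i≤n → proj₂ (f i i≤n)))
... | inj₂ (i , i≤n , a , p) = inj₂ ((λ f → a (f i (≤-shift i ρ t i≤n))) , ∀≤-fails ρ t φ i i≤n p)
decide (ex {φ} t d) ρ with search (⟦ t ⟧ₜ ρ) (λ i _ → swap (decide d (i ◂ ρ)))
... | inj₁ f = inj₂ ((λ { (x , x≤ , a) → proj₁ (f x (≤-unshift x ρ t x≤)) a }) , ∃≤-fails ρ t φ (λ i i≤n → proj₂ (f i i≤n)))
... | inj₂ (i , i≤n , a , p) = inj₁ ((i , ≤-shift i ρ t i≤n , a) , ∃≤-holds ρ t φ i i≤n p)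

-- Coding finite sets of pairs

triangle-mono : ∀ {m n} → m ≤ n → triangle m ≤ triangle n
triangle-mono z≤n       = z≤n
triangle-mono (s≤s m≤n) = +-mono-≤ (s≤s m≤n) (triangle-mono m≤n)

pair-< : ∀ a b a' b' → a + b < a' + b' → pair a b < pair a' b'
pair-< a b a' b' lt = begin-strict
  triangle (a + b) + b            ≤⟨ +-monoʳ-≤ (triangle (a + b)) (m≤n+m b a) ⟩
  triangle (a + b) + (a + b)      <⟨ n<1+n _ ⟩
  suc (triangle (a + b) + (a + b)) ≡⟨ cong suc (+-comm (triangle (a + b)) (a + b)) ⟩
  triangle (suc (a + b))          ≤⟨ triangle-mono lt ⟩
  triangle (a' + b')              ≤⟨ m≤m+n _ b' ⟩
  triangle (a' + b') + b'         ∎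
  where open ≤-Reasoning

-- All pairs with a smaller sum come before those with a larger one, so equal codes lie on one
-- diagonal, where the second coordinate is the offset.
pair-injective : ∀ a b a' b' → pair a b ≡ pair a' b' → a ≡ a' × b ≡ b'
pair-injective a b a' b' e with <-cmp (a + b) (a' + b')
... | tri< lt _ _ = ⊥-elim (<⇒≢ (pair-< a b a' b' lt) e)
... | tri> _ _ gt = ⊥-elim (<⇒≢ (pair-< a' b' a b gt) (sym e))
... | tri≈ _ eq' _ = +-cancelʳ-≡ b a a' (trans eq' (cong (a' +_) (sym b≡))) , b≡
  where
  b≡ : b ≡ b'
  b≡ = +-cancelˡ-≡ (triangle (a + b)) b b' (trans e (cong (λ k → triangle k + b') (sym eq')))

triangle-double : ∀ n → triangle n + triangle n ≡ n * suc n
triangle-double zero    = refl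
triangle-double (suc n) = begin
  (suc n + triangle n) + (suc n + triangle n)
    ≡⟨ solve 2 (λ m t → (m :+ t) :+ (m :+ t) := (t :+ t) :+ (m :+ m)) refl (suc n) (triangle n) ⟩
  (triangle n + triangle n) + (suc n + suc n)
    ≡⟨ cong (_+ (suc n + suc n)) (triangle-double n) ⟩
  n * suc n + (suc n + suc n)
    ≡⟨ solve 1 (λ m → m :* (con 1 :+ m) :+ ((con 1 :+ m) :+ (con 1 :+ m)) := (con 1 :+ m) :* (con 1 :+ (con 1 :+ m))) refl n ⟩
  suc n * suc (suc n) ∎
  where open ≡.≡-Reasoning

-- Twice the Cantor pairing: doubling removes the division in the triangular numbers and leaves a
-- polynomial, which is a term of the language.
pair₂ : ℕ → ℕ → ℕ
pair₂ a b = (a + b) * suc (a + b) + (b + b)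

pair-double : ∀ a b → pair a b + pair a b ≡ pair₂ a b
pair-double a b = trans
  (solve 2 (λ t m → (t :+ m) :+ (t :+ m) := (t :+ t) :+ (m :+ m)) refl (triangle (a + b)) b)
  (cong (_+ (b + b)) (triangle-double (a + b)))

double-injective : ∀ m n → m + m ≡ n + n → m ≡ n
double-injective m n e = *-cancelˡ-≡ m n 2 (trans (twice m) (trans e (sym (twice n))))
  where
  twice : ∀ k → 2 * k ≡ k + k
  twice k = cong (k +_) (+-identityʳ k)

pair₂-injective : ∀ a b a' b' → pair₂ a b ≡ pair₂ a' b' → a ≡ a' × b ≡ b'
pair₂-injective a b a' b' e = pair-injective a b a' b' (double-injective _ _
  (trans (pair-double a b) (trans e (sym (pair-double a' b')))))

pair₂-bound : ∀ {a b n} → a ≤ n → b ≤ n → pair₂ a b ≤ pair₂ n n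
pair₂-bound a≤n b≤n = +-mono-≤ (*-mono-≤ (+-mono-≤ a≤n b≤n) (s≤s (+-mono-≤ a≤n b≤n))) (+-mono-≤ b≤n b≤n)

-- Gödel's moduli: for c divisible by all positive numbers below N they are
-- pairwise coprime for m < N, so a product of them codes a set.
modulus : ℕ → ℕ → ℕ
modulus c m = suc (suc m * c)

<⇒∣! : ∀ {k n} → 0 < k → k ≤ n → k ∣ℕ n !
<⇒∣! {suc k} _ k≤n = ∣-trans (m∣m*n (k !)) (m≤n⇒m!∣n! k≤n)

∣modulus⇒coprime : ∀ {c m d} → d ∣ℕ modulus c m → Coprime d c
∣modulus⇒coprime {c} {m} d∣ {e} (e∣d , e∣c) = ∣1⇒≡1 (∣m+n∣m⇒∣n
  (≡.subst (e ∣ℕ_) (+-comm 1 (suc m * c)) (∣-trans e∣d d∣)) (∣n⇒∣m*n (suc m) e∣c))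

-- The two moduli differ by `N !` times `n ∸ m`. A common divisor is coprime to `N !`, so it divides
-- `n ∸ m`, which in turn divides `N !`; hence it is 1.
moduli-coprime-< : ∀ {N m n} → m < n → n < N → Coprime (modulus (N !) m) (modulus (N !) n)
moduli-coprime-< {N} {m} {n} m<n n<N {d} (d∣m , d∣n) =
  ∣modulus⇒coprime {N !} {m} d∣m (∣-refl , ∣-trans d∣k (<⇒∣! (m<n⇒0<n∸m m<n) (≤-trans (m∸n≤m n m) (<⇒≤ n<N))))
  where
  k : ℕ
  k = n ∸ m
  split : modulus (N !) n ≡ modulus (N !) m + N ! * k
  split = begin
    suc (suc n * N !)                 ≡⟨ cong (λ x → suc (suc x * N !)) (sym (m+[n∸m]≡n (<⇒≤ m<n))) ⟩
    suc (suc (m + k) * N !)           ≡⟨ solve 3 (λ a b f → con 1 :+ (con 1 :+ (a :+ b)) :* f := (con 1 :+ (con 1 :+ a) :* f) :+ f :* b) refl m k (N !) ⟩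
    suc (suc m * N !) + N ! * k       ∎
    where open ≡.≡-Reasoning
  d∣k : d ∣ℕ k
  d∣k = coprime-divisor (∣modulus⇒coprime {N !} {m} d∣m) (∣m+n∣m⇒∣n (≡.subst (d ∣ℕ_) split d∣n) d∣m)

moduli-coprime : ∀ {N m n} → m ≢ n → m < N → n < N → Coprime (modulus (N !) m) (modulus (N !) n)
moduli-coprime {N} {m} {n} m≢n m<N n<N with <-cmp m n
... | tri< lt _ _ = moduli-coprime-< lt n<N
... | tri≈ _ e _  = ⊥-elim (m≢n e)
... | tri> _ _ gt = coprime-sym (moduli-coprime-< gt m<N)

coprime-product : ∀ {k ns} → All (Coprime k) ns → Coprime k (product ns)
coprime-product []       (_ , d∣1) = ∣1⇒≡1 d∣1
coprime-product {k} {n ∷ ns} (c ∷ cs) (d∣k , d∣p) =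
  coprime-product cs (d∣k , coprime-factors c (∣m⇒∣m*n (product ns) d∣k , d∣p))

-- A modulus left out of the product is coprime to it, so it could divide the product only by being
-- 1, which is impossible because `N !` is positive.
set-code : ∀ N (L : List ℕ) → All (_< N) L → ∃ λ a → ∀ m → m < N →
  (m ∈ L → modulus (N !) m ∣ℕ a) × (modulus (N !) m ∣ℕ a → m ∈ L)
set-code N L L<N = a , λ m m<N → (λ m∈L → ∈⇒∣product (∈-map⁺ (modulus (N !)) m∈L)) , from m m<N
  where
  a : ℕ
  a = product (map (modulus (N !)) L)
  all-coprime : ∀ {m} → m < N → ∀ L' → All (_< N) L' → ¬ m ∈ L' → All (Coprime (modulus (N !) m)) (map (modulus (N !)) L')
  all-coprime m<N []       []       ∉ = []
  all-coprime m<N (n ∷ L') (p ∷ ps) ∉ = moduli-coprime (∉ ∘ here) m<N p ∷ all-coprime m<N L' ps (∉ ∘ there)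
  from : ∀ m → m < N → modulus (N !) m ∣ℕ a → m ∈ L
  from m m<N d with m ∈? L
  ... | yes m∈L = m∈L
  ... | no  m∉L = ⊥-elim (<⇒≢ (*-mono-≤ {1} {suc m} (s≤s z≤n) (1≤n! N))
          (sym (suc-injective (coprime-product (all-coprime m<N L L<N m∉L) (∣-refl , d)))))

-- Σ₁-definable relations

-- R is Σ₁-definable: the variable 0 of body bounds all the witnesses.
record Sig (R : Env → Set) : Set where
  field
    body : Formula
    Δ    : Δ₀ body
    to   : ∀ {ρ} → R ρ → ∃ λ b → ⟦ body ⟧ (b ◂ ρ)
    from : ∀ {ρ} b → ⟦ body ⟧ (b ◂ ρ) → R ρ

open Sig

private variable R Q : Env → Set

◂-≗ : ∀ {ρ ρ'} x → (∀ i → ρ i ≡ ρ' i) → ∀ i → (x ◂ ρ) i ≡ (x ◂ ρ') i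
◂-≗ x e zero    = refl
◂-≗ x e (suc i) = e i

-- Environments are functions, so pointwise agreement is not equality; a relation given by a formula
-- respects it all the same.
sig-resp : Sig R → ∀ {ρ ρ'} → (∀ i → ρ i ≡ ρ' i) → R ρ → R ρ'
sig-resp S e r with to S r
... | b , d = from S b (⟦⟧-ext (◂-≗ b e) (body S) d)

sig-iff : (∀ {ρ} → R ρ → Q ρ) → (∀ {ρ} → Q ρ → R ρ) → Sig R → Sig Q
sig-iff f g S = record { body = body S ; Δ = Δ S ; to = to S ∘ g ; from = λ b → f ∘ from S b }

sig-Δ₀ : ∀ {φ} → Δ₀ φ → (∀ {ρ} → R ρ → ⟦ φ ⟧ ρ) → (∀ {ρ} → ⟦ φ ⟧ ρ → R ρ) → Sig R
sig-Δ₀ {φ = φ} d f g = record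
  { body = subst (var ∘ suc) φ
  ; Δ    = Δ₀-subst _ d
  ; to   = λ r → 0 , ⟦⟧-subst⁺ (λ _ → refl) φ (f r)
  ; from = λ b x → g (⟦⟧-subst⁻ (λ _ → refl) φ x)
  }

sig-rename : ∀ α → Sig R → Sig (λ ρ → R (ρ ∘ α))
sig-rename α S = record
  { body = subst (var ∘ α') (body S)
  ; Δ    = Δ₀-subst _ (Δ S)
  ; to   = λ r → let b , d = to S r in b , ⟦⟧-subst⁺ (agree b) (body S) d
  ; from = λ b d → from S b (⟦⟧-subst⁻ (agree b) (body S) d)
  }
  where
  α' : ℕ → ℕ
  α' = 0 ◂ (suc ∘ α)
  agree : ∀ {ρ} b i → (b ◂ ρ) (α' i) ≡ (b ◂ (ρ ∘ α)) i
  agree b zero    = refl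
  agree b (suc i) = refl

sig-⊎ : Sig R → Sig Q → Sig (λ ρ → R ρ ⊎ Q ρ)
sig-⊎ S S' = record
  { body = body S ∨' body S'
  ; Δ    = or (Δ S) (Δ S')
  ; to   = λ { (inj₁ r) → let b , d = to S r in b , inj₁ d ; (inj₂ r) → let b , d = to S' r in b , inj₂ d }
  ; from = λ { b (inj₁ d) → inj₁ (from S b d) ; b (inj₂ d) → inj₂ (from S' b d) }
  }

∃≤ : ℕ → (ℕ → ℕ) → Formula → Formula
∃≤ k α φ = ∃' (var 0 ≤' var (suc k) ∧' subst (var ∘ α) φ)

module _ (k : ℕ) {α : ℕ → ℕ} {φ : Formula} {ρ : Env} {ρ' : ℕ → Env}
         (agree : ∀ b i → (b ◂ ρ) (α i) ≡ (b ◂ ρ' b) i) where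

  ∃≤-to : ∀ b → b ≤ ρ k → ⟦ φ ⟧ (b ◂ ρ' b) → ⟦ ∃≤ k α φ ⟧ ρ
  ∃≤-to b b≤ d = b , b≤ , ⟦⟧-subst⁺ (agree b) φ d

  ∃≤-from : ⟦ ∃≤ k α φ ⟧ ρ → ∃ λ b → b ≤ ρ k × ⟦ φ ⟧ (b ◂ ρ' b)
  ∃≤-from (b , b≤ , d) = b , b≤ , ⟦⟧-subst⁻ (agree b) φ d

skip₁ : ℕ → ℕ
skip₁ = 0 ◂ (λ i → 2 + i)

skip₁-agree : ∀ {ρ a} b i → (b ◂ (a ◂ ρ)) (skip₁ i) ≡ (b ◂ ρ) i
skip₁-agree b zero    = refl
skip₁-agree b (suc i) = refl

skip₂ : ℕ → ℕ
skip₂ = 0 ◂ 1 ◂ (λ i → 3 + i)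

skip₂-agree : ∀ {ρ x a} b i → (b ◂ (x ◂ a ◂ ρ)) (skip₂ i) ≡ (b ◂ x ◂ ρ) i
skip₂-agree b zero          = refl
skip₂-agree b (suc zero)    = refl
skip₂-agree b (suc (suc i)) = refl

-- A body is not assumed monotone in its bound. The common bound is therefore imposed from outside,
-- by a bounded quantifier over each of the original bounds.
sig-× : Sig R → Sig Q → Sig (λ ρ → R ρ × Q ρ)
sig-× S S' = record
  { body = ∃≤ 0 skip₁ (body S) ∧' ∃≤ 0 skip₁ (body S')
  ; Δ    = and (ex (var 0) (Δ₀-subst _ (Δ S))) (ex (var 0) (Δ₀-subst _ (Δ S')))
  ; to   = λ (r , q) → let b , d = to S r ; c , e = to S' q in
             b ⊔ c , ∃≤-to 0 skip₁-agree b (m≤m⊔n b c) d , ∃≤-to 0 skip₁-agree c (m≤n⊔m b c) e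
  ; from = λ a (x , y) → let b , _ , d = ∃≤-from 0 skip₁-agree x ; c , _ , e = ∃≤-from 0 skip₁-agree y in
             from S b d , from S' c e
  }

sig-∃ : Sig R → Sig (λ ρ → ∃ λ x → R (x ◂ ρ))
sig-∃ S = record
  { body = ∃' (var 0 ≤' var 1 ∧' ∃≤ 1 skip₂ (body S))
  ; Δ    = ex (var 0) (ex (var 1) (Δ₀-subst _ (Δ S)))
  ; to   = λ (x , r) → let b , d = to S r in
             x ⊔ b , x , m≤m⊔n x b , ∃≤-to 1 skip₂-agree b (m≤n⊔m x b) d
  ; from = λ a (x , _ , y) → let b , _ , d = ∃≤-from 1 skip₂-agree y in x , from S b d
  }

-- Collection in the standard model: finitely many witnesses have a common bound, which is why a
-- bounded universal quantifier does not leave Σ₁.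
collect-bound : ∀ {P : ℕ → ℕ → Set} n → (∀ x → x ≤ n → ∃ (P x)) → ∃ λ a → ∀ x → x ≤ n → ∃ λ b → b ≤ a × P x b
collect-bound zero    f with f 0 z≤n
... | b , p = b , λ { zero z≤n → b , ≤-refl , p }
collect-bound {P} (suc n) f with f (suc n) ≤-refl | collect-bound {P} n (λ x x≤ → f x (m≤n⇒m≤1+n x≤))
... | b , p | a , g = b ⊔ a , h
  where
  h : ∀ x → x ≤ suc n → ∃ λ c → c ≤ b ⊔ a × P x c
  h x x≤ with m≤n⇒m<n∨m≡n x≤
  ... | inj₂ refl = b , m≤m⊔n b a , p
  ... | inj₁ (s≤s x≤n) = let c , c≤ , q = g x x≤n in c , ≤-trans c≤ (m≤n⊔m b a) , q

sig-∀≤ : ∀ k → Sig R → Sig (λ ρ → ∀ x → x ≤ ρ k → R (x ◂ ρ))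
sig-∀≤ k S = record
  { body = ∀' (var 0 ≤' var (2 + k) ⇒ ∃≤ 1 skip₂ (body S))
  ; Δ    = all (var (suc k)) (ex (var 1) (Δ₀-subst _ (Δ S)))
  ; to   = λ {ρ} r → let a , f = collect-bound (ρ k) (λ x x≤ → to S (r x x≤)) in
             a , λ x x≤ → let b , b≤ , d = f x x≤ in ∃≤-to 1 skip₂-agree b b≤ d
  ; from = λ a f x x≤ → let b , _ , d = ∃≤-from 1 skip₂-agree (f x x≤) in from S b d
  }

-- (i , z) belongs to the finite set coded by a and c.
Mem : ℕ → ℕ → ℕ → ℕ → Set
Mem i z a c = modulus c (pair₂ i z) ∣ℕ a

mem-formula : Formula
mem-formula = ∃' (var 0 ≤' var 3 ∧' var 0 ×' s (s ((var 1 +' var 2) ×' s (var 1 +' var 2) +' (var 2 +' var 2)) ×' var 4) ≐ var 3)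

mem-Δ₀ : Δ₀ mem-formula
mem-Δ₀ = ex (var 2) (eq _ _)

mem-to : ∀ ρ → Mem (ρ 0) (ρ 1) (ρ 2) (ρ 3) → ⟦ mem-formula ⟧ ρ
mem-to ρ (divides q e) = q , ≤-trans (m≤m*n q _) (≤-reflexive (sym e)) , sym e

mem-from : ∀ ρ → ⟦ mem-formula ⟧ ρ → Mem (ρ 0) (ρ 1) (ρ 2) (ρ 3)
mem-from ρ (q , _ , e) = divides q (sym e)

sig-Mem : Sig (λ ρ → Mem (ρ 0) (ρ 1) (ρ 2) (ρ 3))
sig-Mem = sig-Δ₀ mem-Δ₀ (λ {ρ} → mem-to ρ) (λ {ρ} → mem-from ρ)

sig-¬Mem : Sig (λ ρ → ¬ Mem (ρ 0) (ρ 1) (ρ 2) (ρ 3))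
sig-¬Mem = sig-Δ₀ (imp mem-Δ₀ bot) (λ {ρ} n → n ∘ mem-from ρ) (λ {ρ} n → n ∘ mem-to ρ)

sig-≡ : ∀ t u → Sig (λ ρ → ⟦ t ⟧ₜ ρ ≡ ⟦ u ⟧ₜ ρ)
sig-≡ t u = sig-Δ₀ (eq t u) id id

sig-≤ : ∀ t u → Sig (λ ρ → ⟦ t ⟧ₜ ρ ≤ ⟦ u ⟧ₜ ρ)
sig-≤ t u = sig-Δ₀ (le t u) id id

-- An inductive definition whose premises have smaller rank is Σ₁: a derivation
-- is a finite set of pairs (rank , element), each justified by other members.
module Closure {Base Step : Env → Set} (sig-Base : Sig Base) (sig-Step : Sig Step) where

  data D (ρ : Env) : ℕ → ℕ → Set where
    base : ∀ {i z} → Base (i ◂ z ◂ ρ) → D ρ i z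
    step : ∀ {i z j u k v} → j < i → k < i → D ρ j u → D ρ k v →
           Step (i ◂ z ◂ j ◂ u ◂ k ◂ v ◂ ρ) → D ρ i z

  private
    -- The environment is v ◂ k ◂ u ◂ j ◂ z ◂ i ◂ b ◂ c ◂ a ◂ ….
    Premises : Env → Set
    Premises ρ = ρ 3 < ρ 5 × ρ 1 < ρ 5 × ρ 2 ≤ ρ 6 × ρ 0 ≤ ρ 6 ×
      Mem (ρ 3) (ρ 2) (ρ 8) (ρ 7) × Mem (ρ 1) (ρ 0) (ρ 8) (ρ 7) ×
      Step (ρ ∘ (5 ◂ 4 ◂ 3 ◂ 2 ◂ 1 ◂ 0 ◂ (11 +_)))

    -- The environment is z ◂ i ◂ b ◂ c ◂ a ◂ ….
    Justified : Env → Set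
    Justified ρ = ¬ Mem (ρ 1) (ρ 0) (ρ 4) (ρ 3) ⊎ (Base (ρ ∘ (1 ◂ 0 ◂ (7 +_))) ⊎
      ∃ λ j → ∃ λ u → ∃ λ k → ∃ λ v → Premises (v ◂ k ◂ u ◂ j ◂ ρ))

    Derivation : Env → Set
    Derivation ρ = ρ 3 ≤ ρ 0 × ρ 4 ≤ ρ 0 × Mem (ρ 3) (ρ 4) (ρ 2) (ρ 1) ×
      (∀ i → i ≤ ρ 0 → ∀ z → z ≤ (i ◂ ρ) 1 → Justified (z ◂ i ◂ ρ))

    sig-Derivation : Sig (λ ρ → ∃ λ a → ∃ λ c → ∃ λ b → Derivation (b ◂ c ◂ a ◂ ρ))
    sig-Derivation = sig-∃ (sig-∃ (sig-∃
      (sig-× (sig-≤ (var 3) (var 0)) (sig-× (sig-≤ (var 4) (var 0))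
      (sig-× (sig-rename (3 ◂ 4 ◂ 2 ◂ 1 ◂ id) sig-Mem)
      (sig-∀≤ 0 (sig-∀≤ 1
        (sig-⊎ (sig-rename (1 ◂ 0 ◂ 4 ◂ 3 ◂ id) sig-¬Mem)
        (sig-⊎ (sig-rename (1 ◂ 0 ◂ (7 +_)) sig-Base)
        (sig-∃ (sig-∃ (sig-∃ (sig-∃
          (sig-× (sig-≤ (s (var 3)) (var 5)) (sig-× (sig-≤ (s (var 1)) (var 5))
          (sig-× (sig-≤ (var 2) (var 6)) (sig-× (sig-≤ (var 0) (var 6))
          (sig-× (sig-rename (3 ◂ 2 ◂ 8 ◂ 7 ◂ id) sig-Mem)
          (sig-× (sig-rename (1 ◂ 0 ◂ 8 ◂ 7 ◂ id) sig-Mem)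
          (sig-rename (5 ◂ 4 ◂ 3 ◂ 2 ◂ 1 ◂ 0 ◂ (11 +_)) sig-Step))))))))))))))))))))

    module _ (ρ : Env) where

      tail : Env
      tail i = ρ (2 + i)

      base-agree : ∀ {i z b c a} n → ((z ◂ i ◂ b ◂ c ◂ a ◂ ρ) ∘ (1 ◂ 0 ◂ (7 +_))) n ≡ (i ◂ z ◂ tail) n
      base-agree 0             = refl
      base-agree 1             = refl
      base-agree (suc (suc n)) = refl

      step-agree : ∀ {i z j u k v b c a} n →
        ((v ◂ k ◂ u ◂ j ◂ z ◂ i ◂ b ◂ c ◂ a ◂ ρ) ∘ (5 ◂ 4 ◂ 3 ◂ 2 ◂ 1 ◂ 0 ◂ (11 +_))) n ≡
        (i ◂ z ◂ j ◂ u ◂ k ◂ v ◂ tail) n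
      step-agree 0 = refl
      step-agree 1 = refl
      step-agree 2 = refl
      step-agree 3 = refl
      step-agree 4 = refl
      step-agree 5 = refl
      step-agree (suc (suc (suc (suc (suc (suc n)))))) = refl

      -- `n` is fuel above the rank, which drops at every premise. The clauses `u ≤ b` and `v ≤ b`
      -- in `Premises` matter: a pair beyond `b` may belong to the coded set by accident and carries
      -- no justification.
      sound : ∀ {a c b} → (∀ i → i ≤ b → ∀ z → z ≤ b → Justified (z ◂ i ◂ b ◂ c ◂ a ◂ ρ)) →
        ∀ n i z → i < n → i ≤ b → z ≤ b → Mem i z a c → D tail i z
      sound J (suc n) i z (s≤s i≤n) i≤b z≤b m with J i i≤b z z≤b
      ... | inj₁ ¬m       = ⊥-elim (¬m m)
      ... | inj₂ (inj₁ x) = base (sig-resp sig-Base base-agree x)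
      ... | inj₂ (inj₂ (j , u , k , v , j<i , k<i , u≤b , v≤b , mj , mk , st)) =
        step j<i k<i
          (sound J n j u (<-≤-trans j<i i≤n) (≤-trans (<⇒≤ j<i) i≤b) u≤b mj)
          (sound J n k v (<-≤-trans k<i i≤n) (≤-trans (<⇒≤ k<i) i≤b) v≤b mk)
          (sig-resp sig-Step step-agree st)

    JustifiedIn : Env → List (ℕ × ℕ) → ℕ × ℕ → Set
    JustifiedIn ρ L (i , z) = Base (i ◂ z ◂ ρ) ⊎ ∃ λ j → ∃ λ u → ∃ λ k → ∃ λ v →
      j < i × k < i × (j , u) ∈ L × (k , v) ∈ L × Step (i ◂ z ◂ j ◂ u ◂ k ◂ v ◂ ρ)

    JustifiedIn-mono : ∀ {ρ L L'} → (∀ {p} → p ∈ L → p ∈ L') → ∀ {p} → JustifiedIn ρ L p → JustifiedIn ρ L' p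
    JustifiedIn-mono w (inj₁ x) = inj₁ x
    JustifiedIn-mono w (inj₂ (j , u , k , v , j<i , k<i , mj , mk , st)) =
      inj₂ (j , u , k , v , j<i , k<i , w mj , w mk , st)

    derivation-list : ∀ {ρ i z} → D ρ i z → ∃ λ L → (i , z) ∈ L × All (JustifiedIn ρ L) L
    derivation-list {i = i} {z} (base x) = (i , z) ∷ [] , here refl , inj₁ x ∷ []
    derivation-list {ρ} {i} {z} (step {j = j} {u} {k} {v} j<i k<i d e st)
      with derivation-list d | derivation-list e
    ... | L₁ , m₁ , J₁ | L₂ , m₂ , J₂ = L , here refl ,
      inj₂ (j , u , k , v , j<i , k<i , in₁ m₁ , in₂ m₂ , st) ∷
      All.++⁺ (All.map (λ {p} → JustifiedIn-mono {ρ} in₁ {p}) J₁) (All.map (λ {p} → JustifiedIn-mono {ρ} in₂ {p}) J₂)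
      where
      L : List (ℕ × ℕ)
      L = (i , z) ∷ L₁ ++ L₂
      in₁ : ∀ {p} → p ∈ L₁ → p ∈ L
      in₁ m = there (∈-++⁺ˡ m)
      in₂ : ∀ {p} → p ∈ L₂ → p ∈ L
      in₂ m = there (∈-++⁺ʳ L₁ m)

    list-bound : ∀ L → ∃ λ b → ∀ {i z} → (i , z) ∈ L → i ≤ b × z ≤ b
    list-bound [] = 0 , λ ()
    list-bound ((i , z) ∷ L) with list-bound L
    ... | b , f = i ⊔ z ⊔ b , λ
      { (here refl) → ≤-trans (m≤m⊔n i z) (m≤m⊔n _ b) , ≤-trans (m≤n⊔m i z) (m≤m⊔n _ b)
      ; (there m)   → ≤-trans (proj₁ (f m)) (m≤n⊔m (i ⊔ z) b) , ≤-trans (proj₂ (f m)) (m≤n⊔m (i ⊔ z) b) }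

    key : ℕ × ℕ → ℕ
    key (i , z) = pair₂ i z

    complete : ∀ ρ → D (tail ρ) (ρ 0) (ρ 1) → ∃ λ a → ∃ λ c → ∃ λ b → Derivation (b ◂ c ◂ a ◂ ρ)
    complete ρ d with derivation-list d
    ... | L , m , J with list-bound L
    -- This number exceeds the key of every pair with coordinates up to `b`, so the code settles
    -- membership for all those pairs and not just for the ones in `L`.
    ... | b , L≤b with set-code (suc (pair₂ b b)) (map key L)
                       (All.map⁺ (All.tabulate λ m → s≤s (pair₂-bound (proj₁ (L≤b m)) (proj₂ (L≤b m)))))
    ... | a , code-a = a , c , b , proj₁ (L≤b m) , proj₂ (L≤b m) , mem m , justify
      where
      c : ℕ
      c = suc (pair₂ b b) !
      mem : ∀ {i z} → (i , z) ∈ L → Mem i z a c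
      mem {i} {z} m = proj₁ (code-a (pair₂ i z) (s≤s (pair₂-bound (proj₁ (L≤b m)) (proj₂ (L≤b m))))) (∈-map⁺ key m)
      unmem : ∀ {i z} → i ≤ b → z ≤ b → Mem i z a c → (i , z) ∈ L
      unmem {i} {z} i≤b z≤b m with ∈-map⁻ key (proj₂ (code-a (pair₂ i z) (s≤s (pair₂-bound i≤b z≤b))) m)
      ... | (i' , z') , m' , e with pair₂-injective i z i' z' e
      ... | refl , refl = m'
      justify : ∀ i → i ≤ b → ∀ z → z ≤ b → Justified (z ◂ i ◂ b ◂ c ◂ a ◂ ρ)
      justify i i≤b z z≤b with modulus c (pair₂ i z) ∣? a
      ... | no  ¬m = inj₁ ¬m
      ... | yes m with All.lookup J (unmem i≤b z≤b m)
      ... | inj₁ x = inj₂ (inj₁ (sig-resp sig-Base (λ n → sym (base-agree ρ n)) x))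
      ... | inj₂ (j , u , k , v , j<i , k<i , mj , mk , st) = inj₂ (inj₂ (j , u , k , v ,
        j<i , k<i , proj₂ (L≤b mj) , proj₂ (L≤b mk) , mem mj , mem mk ,
        sig-resp sig-Step (λ n → sym (step-agree ρ n)) st))

  sig-D : Sig (λ ρ → D (λ i → ρ (2 + i)) (ρ 0) (ρ 1))
  sig-D = sig-iff
    (λ { {ρ} (a , c , b , i≤b , z≤b , m , J) → sound ρ J (suc (ρ 0)) (ρ 0) (ρ 1) ≤-refl i≤b z≤b m })
    (λ {ρ} → complete ρ) sig-Derivation

-- Graphs of partial recursive functions

takeᵉ : ∀ n → Env → Vec ℕ n
takeᵉ zero    ρ = []
takeᵉ (suc n) ρ = ρ 0 ∷ takeᵉ n (ρ ∘ suc)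

lookup-takeᵉ : ∀ {n} (i : Fin n) ρ → lookup (takeᵉ n ρ) i ≡ ρ (toℕ i)
lookup-takeᵉ fzero    ρ = refl
lookup-takeᵉ (fsuc i) ρ = lookup-takeᵉ i (ρ ∘ suc)

sig-∃Vec : ∀ m {P : Vec ℕ m → Env → Set} → Sig (λ ρ → P (takeᵉ m ρ) (λ i → ρ (m + i))) → Sig (λ ρ → ∃ λ ys → P ys ρ)
sig-∃Vec zero    S = sig-iff (λ p → [] , p) (λ { ([] , p) → p }) S
sig-∃Vec (suc m) {P} S = sig-iff (λ { (ys , y , p) → y ∷ ys , p }) (λ { (y ∷ ys , p) → ys , y , p })
  (sig-∃Vec m {λ ys ρ → ∃ λ y → P (y ∷ ys) ρ} (sig-∃ S))

zero-value : ∀ {n} {xs : Vec ℕ n} {y} → zero ⟨ xs ⟩⇓ y → y ≡ 0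
zero-value zero = refl

succ-value : ∀ {x y} → succ ⟨ x ∷ [] ⟩⇓ y → y ≡ suc x
succ-value succ = refl

proj-value : ∀ {n} {xs : Vec ℕ n} {i y} → proj i ⟨ xs ⟩⇓ y → y ≡ lookup xs i
proj-value (proj i) = refl

zero-graph : ∀ {n} {xs : Vec ℕ n} {y} → y ≡ 0 → zero ⟨ xs ⟩⇓ y
zero-graph refl = zero

succ-graph : ∀ {x y} → y ≡ suc x → succ ⟨ x ∷ [] ⟩⇓ y
succ-graph refl = succ

proj-graph : ∀ {n} {xs : Vec ℕ n} {i y} → y ≡ lookup xs i → proj i ⟨ xs ⟩⇓ y
proj-graph refl = proj _

Graph : ∀ {n} → Rec n → Env → Set
Graph f ρ = f ⟨ takeᵉ _ (ρ ∘ suc) ⟩⇓ ρ 0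

prec-base : ∀ {n} → Rec n → Env → Set
prec-base f ρ = ρ 0 ≡ 0 × (f ⟨ takeᵉ _ (λ i → ρ (2 + i)) ⟩⇓ ρ 1)

-- The environment is i ◂ z ◂ j ◂ u ◂ k ◂ v ◂ …; primitive recursion ignores the premise (k , v).
prec-step : ∀ {n} → Rec (2 + n) → Env → Set
prec-step g ρ = ρ 0 ≡ suc (ρ 2) × (g ⟨ takeᵉ _ (ρ ∘ (2 ◂ 3 ◂ (6 +_))) ⟩⇓ ρ 1)

sig-Graph  : ∀ {n} (f : Rec n) → Sig (Graph f)
sig-Graphs : ∀ {n k} (gs : Vec (Rec n) k) α β →
  Sig (λ ρ → Pointwise (λ g y → g ⟨ takeᵉ n (ρ ∘ β) ⟩⇓ y) gs (takeᵉ k (ρ ∘ α)))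

sig-Graph zero = sig-iff zero-graph zero-value (sig-≡ (var 0) zero)
sig-Graph succ = sig-iff succ-graph succ-value (sig-≡ (var 0) (s (var 1)))
sig-Graph (proj i) = sig-iff
  (λ {ρ} e → proj-graph (trans e (sym (lookup-takeᵉ i (ρ ∘ suc)))))
  (λ {ρ} d → trans (proj-value d) (lookup-takeᵉ i (ρ ∘ suc)))
  (sig-≡ (var 0) (var (suc (toℕ i))))
sig-Graph {n} (comp {m} f gs) = sig-iff
  (λ { (ys , ds , d) → comp ds d }) (λ { (comp ds d) → _ , ds , d })
  (sig-∃Vec m {λ ys ρ → Pointwise (λ g y → g ⟨ takeᵉ n (ρ ∘ suc) ⟩⇓ y) gs ys × (f ⟨ ys ⟩⇓ ρ 0)}
    (sig-× (sig-Graphs gs id (λ i → m + suc i)) (sig-rename ((m + 0) ◂ id) (sig-Graph f))))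
-- The rank is the recursion argument and the element is the value: a derivation is a course of
-- values.
sig-Graph (prec {n} f g) = sig-iff to-prec from-prec (sig-rename (1 ◂ 0 ◂ (2 +_)) sig-D)
  where
  sig-base : Sig (prec-base f)
  sig-base = sig-× (sig-≡ (var 0) zero) (sig-rename (1 ◂ (2 +_)) (sig-Graph f))
  sig-step : Sig (prec-step g)
  sig-step = sig-× (sig-≡ (var 0) (s (var 2))) (sig-rename (1 ◂ 2 ◂ 3 ◂ (6 +_)) (sig-Graph g))
  open Closure sig-base sig-step
  to-prec : ∀ {ρ k y} → D ρ k y → prec f g ⟨ k ∷ takeᵉ n ρ ⟩⇓ y
  to-prec (base (refl , d)) = prec0 d
  to-prec (step _ _ d _ (refl , e)) = precs (to-prec d) e
  from-prec : ∀ {ρ k y} → prec f g ⟨ k ∷ takeᵉ n ρ ⟩⇓ y → D ρ k y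
  from-prec (prec0 d) = base (refl , d)
  from-prec (precs d e) = step ≤-refl ≤-refl (from-prec d) (from-prec d) (refl , e)
sig-Graph (μ {n} f) = sig-iff
  (λ { (h , _ , refl , d) → μ (λ j j<k → defined (h j (<⇒≤ j<k)) j<k) d })
  (λ { (μ h d) → (λ j j≤k → case j≤k h) , 0 , refl , d })
  -- The bounded quantifier includes its endpoint, so `j ≡ k` is exempted; the value 0 at `k` is
  -- demanded separately.
  (sig-× (sig-∀≤ 0 (sig-⊎ (sig-≡ (var 0) (var 1))
    (sig-∃ (sig-∃ (sig-× (sig-≡ (var 0) (s (var 1))) (sig-rename (0 ◂ 2 ◂ (4 +_)) (sig-Graph f)))))))
    (sig-∃ (sig-× (sig-≡ (var 0) zero) (sig-rename (0 ◂ 1 ◂ (2 +_)) (sig-Graph f)))))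
  where
  defined : ∀ {j k xs} → j ≡ k ⊎ (∃ λ y → ∃ λ w → w ≡ suc y × (f ⟨ j ∷ xs ⟩⇓ w)) → j < k → ∃ λ y → f ⟨ j ∷ xs ⟩⇓ suc y
  defined (inj₁ refl) j<k = ⊥-elim (<-irrefl refl j<k)
  defined (inj₂ (y , _ , refl , d)) _ = y , d
  case : ∀ {j k xs} → j ≤ k → (∀ j → j < k → ∃ λ y → f ⟨ j ∷ xs ⟩⇓ suc y) →
    j ≡ k ⊎ (∃ λ y → ∃ λ w → w ≡ suc y × (f ⟨ j ∷ xs ⟩⇓ w))
  case j≤k h with m≤n⇒m<n∨m≡n j≤k
  ... | inj₂ e = inj₁ e
  ... | inj₁ j<k = let y , d = h _ j<k in inj₂ (y , _ , refl , d)

sig-Graphs []       α β = sig-iff (λ _ → []) (λ _ → refl) (sig-≡ zero zero)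
sig-Graphs (g ∷ gs) α β = sig-iff (λ { (d , ds) → d ∷ ds }) (λ { (d ∷ ds) → d , ds })
  (sig-× (sig-rename (α 0 ◂ β) (sig-Graph g)) (sig-Graphs gs (α ∘ suc) β))

sig-CE : ∀ {X} → CE X → Sig (λ ρ → X (ρ 0))
sig-CE (f , h) = sig-iff (λ {ρ} → Equivalence.from (h (ρ 0))) (λ {ρ} → Equivalence.to (h (ρ 0)))
  (sig-∃ (sig-rename (0 ◂ 1 ◂ id) (sig-Graph f)))

-- Σ₁-definable functions

record SigFun (F : Env → ℕ) : Set where
  constructor sig-fun
  field graph : Sig (λ ρ → ρ 0 ≡ F (ρ ∘ suc))

open SigFun public

private variable F G : Env → ℕ

sig-apply : SigFun F → Sig R → Sig (λ ρ → R (F ρ ◂ ρ))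
sig-apply {R = R} S S' = sig-iff (λ {ρ} (x , e , r) → ≡.subst (λ y → R (y ◂ ρ)) e r) (λ r → _ , refl , r)
  (sig-∃ (sig-× (graph S) S'))

fun-term : ∀ t → SigFun ⟦ t ⟧ₜ
fun-term t = sig-fun (sig-iff (λ e → trans e (⟦⟧ₜ-subst (λ _ → refl) t)) (λ e → trans e (sym (⟦⟧ₜ-subst (λ _ → refl) t)))
  (sig-≡ (var 0) (shiftₜ t)))

fun-var : ∀ i → SigFun (λ ρ → ρ i)
fun-var i = fun-term (var i)

numeral-value : ∀ n ρ → ⟦ numeral n ⟧ₜ ρ ≡ n
numeral-value zero    ρ = refl
numeral-value (suc n) ρ = cong suc (numeral-value n ρ)

fun-const : ∀ n → SigFun (λ _ → n)
fun-const n = sig-fun (sig-iff (λ e → trans e (numeral-value n _)) (λ e → trans e (sym (numeral-value n _)))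
  (graph (fun-term (numeral n))))

pair-graph⁻ : ∀ {z} a b → z + z ≡ pair₂ a b → z ≡ pair a b
pair-graph⁻ {z} a b e = double-injective z (pair a b) (trans e (sym (pair-double a b)))

pair-graph⁺ : ∀ {z} a b → z ≡ pair a b → z + z ≡ pair₂ a b
pair-graph⁺ a b refl = pair-double a b

-- Opaque, so that the codes of concrete formulas are never computed.
opaque

  ⟪_,_⟫ : ℕ → ℕ → ℕ
  ⟪ a , b ⟫ = pair a b

  ⟪⟫≡pair : ∀ a b → ⟪ a , b ⟫ ≡ pair a b
  ⟪⟫≡pair a b = refl

fun-⟪⟫ : SigFun F → SigFun G → SigFun (λ ρ → ⟪ F ρ , G ρ ⟫)
fun-⟪⟫ {F} {G} S S' = sig-fun (sig-iff
  {R = λ ρ → ∃ λ a → ∃ λ b → a ≡ F (ρ ∘ suc) × b ≡ G (ρ ∘ suc) × ρ 0 + ρ 0 ≡ pair₂ a b}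
  (λ { (a , b , refl , refl , e) → trans (pair-graph⁻ a b e) (sym (⟪⟫≡pair a b)) })
  (λ {ρ} e → F (ρ ∘ suc) , G (ρ ∘ suc) , refl , refl ,
    pair-graph⁺ (F (ρ ∘ suc)) (G (ρ ∘ suc)) (trans e (⟪⟫≡pair (F (ρ ∘ suc)) (G (ρ ∘ suc)))))
  (sig-∃ (sig-∃ (sig-× (sig-rename (1 ◂ (3 +_)) (graph S)) (sig-× (sig-rename (0 ◂ (3 +_)) (graph S'))
    (sig-≡ (var 2 +' var 2) ((var 1 +' var 0) ×' s (var 1 +' var 0) +' (var 0 +' var 0))))))))

iterate : (ℕ → ℕ) → ℕ → ℕ → ℕ
iterate h a zero    = a
iterate h a (suc n) = h (iterate h a n)

module Iterate (h : ℕ → ℕ) (fun-h : SigFun (λ ρ → h (ρ 0))) (a : ℕ) where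

  private
    sig-base : Sig (λ ρ → ρ 0 ≡ 0 × ρ 1 ≡ a)
    sig-base = sig-× (sig-≡ (var 0) zero) (sig-rename (1 ◂ id) (graph (fun-const a)))

    sig-step : Sig (λ ρ → ρ 0 ≡ suc (ρ 2) × ρ 1 ≡ h (ρ 3))
    sig-step = sig-× (sig-≡ (var 0) (s (var 2))) (sig-rename (1 ◂ 3 ◂ id) (graph fun-h))

    open Closure sig-base sig-step

    value : ∀ {ρ n z} → D ρ n z → z ≡ iterate h a n
    value (base (refl , e)) = e
    value (step _ _ d _ (refl , e)) = trans e (cong h (value d))

    defined : ∀ {ρ} n → D ρ n (iterate h a n)
    defined zero    = base (refl , refl)
    defined (suc n) = step ≤-refl ≤-refl (defined n) (defined n) (refl , refl)

    sig-graph : Sig (λ ρ → ρ 1 ≡ iterate h a (ρ 0))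
    sig-graph = sig-iff value (λ {ρ} e → ≡.subst (D (λ i → ρ (2 + i)) (ρ 0)) (sym e) (defined (ρ 0))) sig-D

  fun-iterate : SigFun F → SigFun (λ ρ → iterate h a (F ρ))
  fun-iterate {F} S = sig-fun (sig-iff {R = λ ρ → ∃ λ x → x ≡ F (ρ ∘ suc) × ρ 0 ≡ iterate h a x}
    (λ { (_ , refl , e) → e }) (λ e → _ , refl , e)
    (sig-∃ (sig-× (sig-rename (0 ◂ (2 +_)) (graph S)) (sig-rename (0 ◂ 1 ◂ id) sig-graph))))

-- Formulas as predicates

-- Variables beyond the list become `zero`. Thus `φ ⟨ ts ⟩` is closed as soon as `ts` are, whatever
-- other variables occur in `φ`, and no free variables of the constructed bodies have to be tracked.
insts : List Term → Subst
insts []       = λ _ → zero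
insts (t ∷ ts) = t • insts ts

envs : List ℕ → Env
envs []       = λ _ → 0
envs (x ∷ xs) = x ◂ envs xs

infix 9 _⟨_⟩
_⟨_⟩ : Formula → List Term → Formula
φ ⟨ ts ⟩ = subst (insts ts) φ

substₜ-insts : ∀ σ ts i → substₜ σ (insts ts i) ≡ insts (map (substₜ σ) ts) i
substₜ-insts σ []       i       = refl
substₜ-insts σ (t ∷ ts) zero    = refl
substₜ-insts σ (t ∷ ts) (suc i) = substₜ-insts σ ts i

subst-⟨⟩ : ∀ σ φ ts {ts'} → map (substₜ σ) ts ≡ ts' → subst σ (φ ⟨ ts ⟩) ≡ φ ⟨ ts' ⟩
subst-⟨⟩ σ φ ts refl = subst-∘≗ (substₜ-insts σ ts) φ

⟦insts⟧ : ∀ ρ ts i → ⟦ insts ts i ⟧ₜ ρ ≡ envs (map (λ t → ⟦ t ⟧ₜ ρ) ts) i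
⟦insts⟧ ρ []       i       = refl
⟦insts⟧ ρ (t ∷ ts) zero    = refl
⟦insts⟧ ρ (t ∷ ts) (suc i) = ⟦insts⟧ ρ ts i

⟦⟨⟩⟧⁻ : ∀ φ ts {ρ} → ⟦ φ ⟨ ts ⟩ ⟧ ρ → ⟦ φ ⟧ (envs (map (λ t → ⟦ t ⟧ₜ ρ) ts))
⟦⟨⟩⟧⁻ φ ts {ρ} = ⟦⟧-subst⁻ (⟦insts⟧ ρ ts) φ

⟦⟨⟩⟧⁺ : ∀ φ ts {ρ} → ⟦ φ ⟧ (envs (map (λ t → ⟦ t ⟧ₜ ρ) ts)) → ⟦ φ ⟨ ts ⟩ ⟧ ρ
⟦⟨⟩⟧⁺ φ ts {ρ} = ⟦⟧-subst⁺ (⟦insts⟧ ρ ts) φ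

numerals-envs : ∀ ns i → numerals (envs ns) i ≡ insts (map numeral ns) i
numerals-envs []       i       = refl
numerals-envs (n ∷ ns) zero    = refl
numerals-envs (n ∷ ns) (suc i) = numerals-envs ns i

decide-⟨⟩ : ∀ {φ} → Δ₀ φ → ∀ ns → Decided (⟦ φ ⟧ (envs ns)) (φ ⟨ map numeral ns ⟩)
decide-⟨⟩ {φ} d ns with decide d (envs ns)
... | inj₁ (a , p) = inj₁ (a , coe (subst-cong (numerals-envs ns) φ) p)
... | inj₂ (a , p) = inj₂ (a , coe (cong ¬' (subst-cong (numerals-envs ns) φ)) p)

Decided-true : ∀ {A φ} → Decided A φ → A → PA ⊢ φ
Decided-true (inj₁ (_ , p)) a = p
Decided-true (inj₂ (n , _)) a = ⊥-elim (n a)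

Decided-false : ∀ {A φ} → Decided A φ → ¬ A → PA ⊢ ¬' φ
Decided-false (inj₁ (a , _)) n = ⊥-elim (n a)
Decided-false (inj₂ (_ , p)) n = p

Decided-dec : ∀ {A φ} → Decided A φ → Dec A
Decided-dec (inj₁ (a , _)) = yes a
Decided-dec (inj₂ (n , _)) = no n

insts-Below : ∀ k ts → (∀ {t} → t ∈ ts → Belowₜ k t) → ∀ i → Belowₜ k (insts ts i)
insts-Below k []       f i       = _
insts-Below k (t ∷ ts) f zero    = f (here refl)
insts-Below k (t ∷ ts) f (suc i) = insts-Below k ts (f ∘ there) i

least : ∀ {P : ℕ → Set} → (∀ q → Dec (P q)) → ∀ q → P q → ∃ λ q → P q × (∀ q' → q' < q → ¬ P q')
least {P} P? q p = go q 0 (≡.subst P (sym (+-identityʳ q)) p) (λ _ ())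
  where
  go : ∀ n q → P (n + q) → (∀ q' → q' < q → ¬ P q') → ∃ λ q → P q × (∀ q' → q' < q → ¬ P q')
  go zero    q p f = q , p , f
  go (suc n) q p f with P? q
  ... | yes pq = q , pq , f
  ... | no ¬pq = go n (suc q) (≡.subst P (sym (+-suc n q)) p) g
    where
    g : ∀ q' → q' < suc q → ¬ P q'
    g q' (s≤s q'≤q) with m≤n⇒m<n∨m≡n q'≤q
    ... | inj₁ q'<q = f q' q'<q
    ... | inj₂ refl = ¬pq

numeral-Below : ∀ k n → Belowₜ k (numeral n)
numeral-Below k zero    = _
numeral-Below k (suc n) = numeral-Below k n

-- Stages of an enumeration and the Δ₀ formulas about them

opaque

  -- The bounded quantifier makes the body monotone in variable 0, and PA can prove this; what is
  -- enumerated once stays enumerated.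
  stage : Formula → Formula
  stage φ = ∃≤ 0 skip₁ φ

  stage-Δ : ∀ {φ} → Δ₀ φ → Δ₀ (stage φ)
  stage-Δ d = ex (var 0) (Δ₀-subst _ d)

  stage-to : ∀ φ {ρ p} y → y ≤ p → ⟦ φ ⟧ (y ◂ ρ) → ⟦ stage φ ⟧ (p ◂ ρ)
  stage-to φ y = ∃≤-to 0 {φ = φ} skip₁-agree y

  stage-from : ∀ φ {ρ p} → ⟦ stage φ ⟧ (p ◂ ρ) → ∃ λ y → y ≤ p × ⟦ φ ⟧ (y ◂ ρ)
  stage-from φ = ∃≤-from 0 {φ = φ} skip₁-agree

  stage-mono-open : ∀ φ → PA ⊢ var 0 ≤' var 1 ⇒ subst (var 0 • (λ i → var (2 + i))) (stage φ) ⇒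
    subst (var 1 • (λ i → var (2 + i))) (stage φ)
  stage-mono-open φ = ⇒I (⇒I (∃E h0 (coe (sym goal-shift)
    (∃I' {σ = θ} {φ = var 0 ≤' var 1 ∧' subst (var ∘ skip₁) φ} (var 0)
      (∧I (≤'-trans (∧E₁ h0) h2) (coe part (∧E₂ h0)))))))
    where
    θ : Subst
    θ = var 2 • (λ i → var (3 + i))
    goal-shift : shift (subst (var 1 • (λ i → var (2 + i))) (stage φ)) ≡ subst θ (stage φ)
    goal-shift = subst-∘≗ (λ { zero → refl ; (suc i) → refl }) (stage φ)
    part : subst (lift (var 0 • (λ i → var (2 + i)))) (subst (var ∘ skip₁) φ) ≡ subst (var 0 • θ) (subst (var ∘ skip₁) φ)
    part = trans (subst-∘≗ {θ = var 0 • (λ i → var (3 + i))} (λ { zero → refl ; (suc i) → refl }) φ)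
      (sym (subst-∘≗ (λ { zero → refl ; (suc i) → refl }) φ))

stage-mono : ∀ {Γ t u} φ ts → PA ∣ Γ ⊢ t ≤' u → PA ∣ Γ ⊢ stage φ ⟨ t ∷ ts ⟩ → PA ∣ Γ ⊢ stage φ ⟨ u ∷ ts ⟩
stage-mono {t = t} {u} φ ts d e =
  coe (subst-∘≗ (λ { zero → refl ; (suc i) → refl }) (stage φ))
    (⇒E (⇒E (inst (t • (u • insts ts)) (stage-mono-open φ)) d)
      (coe (sym (subst-∘≗ (λ { zero → refl ; (suc i) → refl }) (stage φ))) e))

-- Argument lists: p x e for Yₛ and Pₛ, r u v w e for Rₛ, p r e for Good, First,
-- Event and NoEvent, p r e x for Core.
module Formulas {Yₛ Rₛ Pₛ : Formula} (Y-Δ : Δ₀ Yₛ) (R-Δ : Δ₀ Rₛ) (P-Δ : Δ₀ Pₛ) where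

  opaque

    -- In `Good₁` the variables 0 to 5 are w, v, u, p, r, e. The number r bounds the witness of the
    -- rule instance as well as u, v, w, so goodness for r is a finite list of demands. The layers
    -- are named because each elimination of a quantifier must name its matrix.
    Good₁ Good₂ Good : Formula
    Good₁ = var 0 ≤' var 4 ⇒
      Yₛ ⟨ var 3 ∷ var 2 ∷ var 5 ∷ [] ⟩ ⇒ Yₛ ⟨ var 3 ∷ var 1 ∷ var 5 ∷ [] ⟩ ⇒
      Rₛ ⟨ var 4 ∷ var 2 ∷ var 1 ∷ var 0 ∷ var 5 ∷ [] ⟩ ⇒ Yₛ ⟨ var 3 ∷ var 0 ∷ var 5 ∷ [] ⟩
    Good₂ = var 0 ≤' var 3 ⇒ ∀' Good₁
    Good  = ∀' (var 0 ≤' var 2 ⇒ ∀' Good₂)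

    Good-Δ : Δ₀ Good
    Good-Δ = all (var 1) (all (var 2) (all (var 3)
      (imp (Δ₀-subst _ Y-Δ) (imp (Δ₀-subst _ Y-Δ) (imp (Δ₀-subst _ R-Δ) (Δ₀-subst _ Y-Δ))))))

    Good-elim : ∀ {Γ p r e} u v w → PA ∣ Γ ⊢ Good ⟨ p ∷ r ∷ e ∷ [] ⟩ →
      PA ∣ Γ ⊢ u ≤' r → PA ∣ Γ ⊢ v ≤' r → PA ∣ Γ ⊢ w ≤' r →
      PA ∣ Γ ⊢ Yₛ ⟨ p ∷ u ∷ e ∷ [] ⟩ → PA ∣ Γ ⊢ Yₛ ⟨ p ∷ v ∷ e ∷ [] ⟩ →
      PA ∣ Γ ⊢ Rₛ ⟨ r ∷ u ∷ v ∷ w ∷ e ∷ [] ⟩ → PA ∣ Γ ⊢ Yₛ ⟨ p ∷ w ∷ e ∷ [] ⟩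
    Good-elim {p = p} {r} {e} u v w d u≤ v≤ w≤ yu yv rw =
      coe (subst-⟨⟩ σ Yₛ (var 3 ∷ var 0 ∷ var 5 ∷ []) refl)
        (⇒E (⇒E (⇒E (⇒E (∀E' {φ = Good₁} w
          (⇒E (∀E' {φ = Good₂} v (⇒E (∀E' {σ = insts (p ∷ r ∷ e ∷ [])} {φ = var 0 ≤' var 2 ⇒ ∀' Good₂} u d) u≤)) v≤)) w≤)
          (coe (sym (subst-⟨⟩ σ Yₛ (var 3 ∷ var 2 ∷ var 5 ∷ []) refl)) yu))
          (coe (sym (subst-⟨⟩ σ Yₛ (var 3 ∷ var 1 ∷ var 5 ∷ []) refl)) yv))
          (coe (sym (subst-⟨⟩ σ Rₛ (var 4 ∷ var 2 ∷ var 1 ∷ var 0 ∷ var 5 ∷ []) refl)) rw))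
      where
      σ : Subst
      σ = insts (w ∷ v ∷ u ∷ p ∷ r ∷ e ∷ [])

  Goodˢ : ℕ → ℕ → ℕ → Set
  Goodˢ e p r = ∀ u → u ≤ r → ∀ v → v ≤ r → ∀ w → w ≤ r →
    ⟦ Yₛ ⟧ (envs (p ∷ u ∷ e ∷ [])) → ⟦ Yₛ ⟧ (envs (p ∷ v ∷ e ∷ [])) →
    ⟦ Rₛ ⟧ (envs (r ∷ u ∷ v ∷ w ∷ e ∷ [])) → ⟦ Yₛ ⟧ (envs (p ∷ w ∷ e ∷ []))

  opaque
    unfolding Good

    Good-to : ∀ {e p r} → Goodˢ e p r → ⟦ Good ⟧ (envs (p ∷ r ∷ e ∷ []))
    Good-to g u u≤ v v≤ w w≤ yu yv rw = ⟦⟨⟩⟧⁺ Yₛ (var 3 ∷ var 0 ∷ var 5 ∷ []) (g u u≤ v v≤ w w≤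
      (⟦⟨⟩⟧⁻ Yₛ (var 3 ∷ var 2 ∷ var 5 ∷ []) yu) (⟦⟨⟩⟧⁻ Yₛ (var 3 ∷ var 1 ∷ var 5 ∷ []) yv)
      (⟦⟨⟩⟧⁻ Rₛ (var 4 ∷ var 2 ∷ var 1 ∷ var 0 ∷ var 5 ∷ []) rw))

    Good-from : ∀ {e p r} → ⟦ Good ⟧ (envs (p ∷ r ∷ e ∷ [])) → Goodˢ e p r
    Good-from g u u≤ v v≤ w w≤ yu yv rw = ⟦⟨⟩⟧⁻ Yₛ (var 3 ∷ var 0 ∷ var 5 ∷ []) (g u u≤ v v≤ w w≤
      (⟦⟨⟩⟧⁺ Yₛ (var 3 ∷ var 2 ∷ var 5 ∷ []) yu) (⟦⟨⟩⟧⁺ Yₛ (var 3 ∷ var 1 ∷ var 5 ∷ []) yv)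
      (⟦⟨⟩⟧⁺ Rₛ (var 4 ∷ var 2 ∷ var 1 ∷ var 0 ∷ var 5 ∷ []) rw))

  opaque

    -- In `First₁` the variables 0 to 4 are k, q, p, r, e. The competitor q may be good for any k
    -- from r on, not only for r: this builds in that first stages grow with r, and spares PA a
    -- proof that goodness for k implies goodness for r.
    First₁ First : Formula
    First₁ = var 0 ≤' var 1 ⇒ var 3 ≤' var 0 ⇒ Good ⟨ var 1 ∷ var 0 ∷ var 4 ∷ [] ⟩ ⇒ var 2 ≤' var 1
    First  = ∀' (var 0 ≤' var 1 ⇒ ∀' First₁)

    First-Δ : Δ₀ First
    First-Δ = all (var 0) (all (var 0) (imp (le _ _) (imp (Δ₀-subst _ Good-Δ) (le _ _))))

    First-elim : ∀ {Γ p r e} q k → PA ∣ Γ ⊢ First ⟨ p ∷ r ∷ e ∷ [] ⟩ →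
      PA ∣ Γ ⊢ q ≤' p → PA ∣ Γ ⊢ k ≤' q → PA ∣ Γ ⊢ r ≤' k →
      PA ∣ Γ ⊢ Good ⟨ q ∷ k ∷ e ∷ [] ⟩ → PA ∣ Γ ⊢ p ≤' q
    First-elim {p = p} {r} {e} q k d q≤ k≤ r≤ g =
      ⇒E (⇒E (⇒E (∀E' {φ = First₁} k (⇒E (∀E' {σ = insts (p ∷ r ∷ e ∷ [])} {φ = var 0 ≤' var 1 ⇒ ∀' First₁} q d) q≤)) k≤) r≤)
        (coe (sym (subst-⟨⟩ (insts (k ∷ q ∷ p ∷ r ∷ e ∷ [])) Good (var 1 ∷ var 0 ∷ var 4 ∷ []) refl)) g)

  Firstˢ : ℕ → ℕ → ℕ → Set
  Firstˢ e p r = ∀ q → q ≤ p → ∀ k → k ≤ q → r ≤ k → Goodˢ e q k → p ≤ q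

  opaque
    unfolding First

    First-to : ∀ {e p r} → Firstˢ e p r → ⟦ First ⟧ (envs (p ∷ r ∷ e ∷ []))
    First-to f q q≤ k k≤ r≤ g = f q q≤ k k≤ r≤ (Good-from (⟦⟨⟩⟧⁻ Good (var 1 ∷ var 0 ∷ var 4 ∷ []) g))

    First-from : ∀ {e p r} → ⟦ First ⟧ (envs (p ∷ r ∷ e ∷ [])) → Firstˢ e p r
    First-from f q q≤ k k≤ r≤ g = f q q≤ k k≤ r≤ (⟦⟨⟩⟧⁺ Good (var 1 ∷ var 0 ∷ var 4 ∷ []) (Good-to g))

  Eventˢ : ℕ → ℕ → ℕ → Set
  Eventˢ e p r = ∃ λ u → u ≤ r × ⟦ Pₛ ⟧ (envs (p ∷ u ∷ e ∷ [])) × ¬ ⟦ Yₛ ⟧ (envs (p ∷ u ∷ e ∷ []))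

  opaque

    Event : Formula
    Event = ∃' (var 0 ≤' var 2 ∧' (Pₛ ⟨ var 1 ∷ var 0 ∷ var 3 ∷ [] ⟩ ∧' ¬' (Yₛ ⟨ var 1 ∷ var 0 ∷ var 3 ∷ [] ⟩)))

    Event-Δ : Δ₀ Event
    Event-Δ = ex (var 1) (and (Δ₀-subst _ P-Δ) (imp (Δ₀-subst _ Y-Δ) bot))

    Event-to : ∀ {e p r} → Eventˢ e p r → ⟦ Event ⟧ (envs (p ∷ r ∷ e ∷ []))
    Event-to (u , u≤ , pu , ¬y) = u , u≤ , ⟦⟨⟩⟧⁺ Pₛ (var 1 ∷ var 0 ∷ var 3 ∷ []) pu ,
      ¬y ∘ ⟦⟨⟩⟧⁻ Yₛ (var 1 ∷ var 0 ∷ var 3 ∷ [])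

    Event-from : ∀ {e p r} → ⟦ Event ⟧ (envs (p ∷ r ∷ e ∷ [])) → Eventˢ e p r
    Event-from (u , u≤ , pu , ¬y) = u , u≤ , ⟦⟨⟩⟧⁻ Pₛ (var 1 ∷ var 0 ∷ var 3 ∷ []) pu ,
      ¬y ∘ ⟦⟨⟩⟧⁺ Yₛ (var 1 ∷ var 0 ∷ var 3 ∷ [])

  NoEventˢ : ℕ → ℕ → ℕ → Set
  NoEventˢ e p r = ∀ a → a ≤ r → ∀ b → b ≤ p → suc a ≤ r → a ≤ b → Goodˢ e b a → Firstˢ e b a → ¬ Eventˢ e b a

  opaque

    -- In `NoEvent₁` the variables 0 to 4 are b, a, p, r, e. At a good stage `(p , r)` the bound b ≤
    -- p loses nothing, since the first stage for a smaller a is at most p; it keeps the formula Δ₀.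
    NoEvent₁ NoEvent : Formula
    NoEvent₁ = var 0 ≤' var 2 ⇒ s (var 1) ≤' var 3 ⇒ var 1 ≤' var 0 ⇒ Good ⟨ var 0 ∷ var 1 ∷ var 4 ∷ [] ⟩ ⇒
      First ⟨ var 0 ∷ var 1 ∷ var 4 ∷ [] ⟩ ⇒ ¬' (Event ⟨ var 0 ∷ var 1 ∷ var 4 ∷ [] ⟩)
    NoEvent  = ∀' (var 0 ≤' var 2 ⇒ ∀' NoEvent₁)

    NoEvent-Δ : Δ₀ NoEvent
    NoEvent-Δ = all (var 1) (all (var 1) (imp (le _ _) (imp (le _ _) (imp (Δ₀-subst _ Good-Δ)
      (imp (Δ₀-subst _ First-Δ) (imp (Δ₀-subst _ Event-Δ) bot))))))

    NoEvent-elim : ∀ {Γ p r e} a b → PA ∣ Γ ⊢ NoEvent ⟨ p ∷ r ∷ e ∷ [] ⟩ →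
      PA ∣ Γ ⊢ a ≤' r → PA ∣ Γ ⊢ b ≤' p → PA ∣ Γ ⊢ s a ≤' r → PA ∣ Γ ⊢ a ≤' b →
      PA ∣ Γ ⊢ Good ⟨ b ∷ a ∷ e ∷ [] ⟩ → PA ∣ Γ ⊢ First ⟨ b ∷ a ∷ e ∷ [] ⟩ →
      PA ∣ Γ ⊢ Event ⟨ b ∷ a ∷ e ∷ [] ⟩ → PA ∣ Γ ⊢ ⊥'
    NoEvent-elim {p = p} {r} {e} a b d a≤ b≤ sa≤ a≤b g f v =
      ⇒E (⇒E (⇒E (⇒E (⇒E (⇒E (∀E' {φ = NoEvent₁} b
        (⇒E (∀E' {σ = insts (p ∷ r ∷ e ∷ [])} {φ = var 0 ≤' var 2 ⇒ ∀' NoEvent₁} a d) a≤)) b≤) sa≤) a≤b)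
        (coe (sym (subst-⟨⟩ σ Good ts refl)) g)) (coe (sym (subst-⟨⟩ σ First ts refl)) f)) (coe (sym (subst-⟨⟩ σ Event ts refl)) v)
      where
      σ : Subst
      σ = insts (b ∷ a ∷ p ∷ r ∷ e ∷ [])
      ts : List Term
      ts = var 0 ∷ var 1 ∷ var 4 ∷ []

    NoEvent-to : ∀ {e p r} → NoEventˢ e p r → ⟦ NoEvent ⟧ (envs (p ∷ r ∷ e ∷ []))
    NoEvent-to h a a≤ b b≤ sa≤ a≤b g f v = h a a≤ b b≤ sa≤ a≤b (Good-from (⟦⟨⟩⟧⁻ Good ts g))
      (First-from (⟦⟨⟩⟧⁻ First ts f)) (Event-from (⟦⟨⟩⟧⁻ Event ts v))
      where
      ts : List Term
      ts = var 0 ∷ var 1 ∷ var 4 ∷ []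

    NoEvent-from : ∀ {e p r} → ⟦ NoEvent ⟧ (envs (p ∷ r ∷ e ∷ [])) → NoEventˢ e p r
    NoEvent-from h a a≤ b b≤ sa≤ a≤b g f v = h a a≤ b b≤ sa≤ a≤b (⟦⟨⟩⟧⁺ Good ts (Good-to g))
      (⟦⟨⟩⟧⁺ First ts (First-to f)) (⟦⟨⟩⟧⁺ Event ts (Event-to v))
      where
      ts : List Term
      ts = var 0 ∷ var 1 ∷ var 4 ∷ []

  record Coreˢ (e p r x : ℕ) : Set where
    constructor core
    field
      r≤p     : r ≤ p
      good    : Goodˢ e p r
      first   : Firstˢ e p r
      noEvent : NoEventˢ e p r
      member  : ⟦ Yₛ ⟧ (envs (p ∷ x ∷ e ∷ []))

  record Coreᵖ (Γ : List Formula) (e p r x : Term) : Set where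
    constructor core
    field
      r≤p     : PA ∣ Γ ⊢ r ≤' p
      good    : PA ∣ Γ ⊢ Good ⟨ p ∷ r ∷ e ∷ [] ⟩
      first   : PA ∣ Γ ⊢ First ⟨ p ∷ r ∷ e ∷ [] ⟩
      noEvent : PA ∣ Γ ⊢ NoEvent ⟨ p ∷ r ∷ e ∷ [] ⟩
      member  : PA ∣ Γ ⊢ Yₛ ⟨ p ∷ x ∷ e ∷ [] ⟩

  opaque

    Core : Formula
    Core = var 1 ≤' var 0 ∧' (Good ⟨ var 0 ∷ var 1 ∷ var 2 ∷ [] ⟩ ∧' (First ⟨ var 0 ∷ var 1 ∷ var 2 ∷ [] ⟩ ∧'
      (NoEvent ⟨ var 0 ∷ var 1 ∷ var 2 ∷ [] ⟩ ∧' Yₛ ⟨ var 0 ∷ var 3 ∷ var 2 ∷ [] ⟩)))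

    Core-Δ : Δ₀ Core
    Core-Δ = and (le _ _) (and (Δ₀-subst _ Good-Δ) (and (Δ₀-subst _ First-Δ)
      (and (Δ₀-subst _ NoEvent-Δ) (Δ₀-subst _ Y-Δ))))

    Core-to : ∀ {e p r x} → Coreˢ e p r x → ⟦ Core ⟧ (envs (p ∷ r ∷ e ∷ x ∷ []))
    Core-to (core r≤p g f v y) = r≤p , ⟦⟨⟩⟧⁺ Good ts (Good-to g) , ⟦⟨⟩⟧⁺ First ts (First-to f) ,
      ⟦⟨⟩⟧⁺ NoEvent ts (NoEvent-to v) , ⟦⟨⟩⟧⁺ Yₛ (var 0 ∷ var 3 ∷ var 2 ∷ []) y
      where
      ts : List Term
      ts = var 0 ∷ var 1 ∷ var 2 ∷ []

    Core-from : ∀ {e p r x} → ⟦ Core ⟧ (envs (p ∷ r ∷ e ∷ x ∷ [])) → Coreˢ e p r x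
    Core-from (r≤p , g , f , v , y) = core r≤p (Good-from (⟦⟨⟩⟧⁻ Good ts g)) (First-from (⟦⟨⟩⟧⁻ First ts f))
      (NoEvent-from (⟦⟨⟩⟧⁻ NoEvent ts v)) (⟦⟨⟩⟧⁻ Yₛ (var 0 ∷ var 3 ∷ var 2 ∷ []) y)
      where
      ts : List Term
      ts = var 0 ∷ var 1 ∷ var 2 ∷ []

    Core-split : ∀ {Γ p r e x} → PA ∣ Γ ⊢ Core ⟨ p ∷ r ∷ e ∷ x ∷ [] ⟩ → Coreᵖ Γ e p r x
    Core-split {p = p} {r} {e} {x} d = core (∧E₁ d)
      (coe (subst-⟨⟩ σ Good ts refl) (∧E₁ (∧E₂ d)))
      (coe (subst-⟨⟩ σ First ts refl) (∧E₁ (∧E₂ (∧E₂ d))))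
      (coe (subst-⟨⟩ σ NoEvent ts refl) (∧E₁ (∧E₂ (∧E₂ (∧E₂ d)))))
      (coe (subst-⟨⟩ σ Yₛ (var 0 ∷ var 3 ∷ var 2 ∷ []) refl) (∧E₂ (∧E₂ (∧E₂ (∧E₂ d)))))
      where
      σ : Subst
      σ = insts (p ∷ r ∷ e ∷ x ∷ [])
      ts : List Term
      ts = var 0 ∷ var 1 ∷ var 2 ∷ []

    Core-join : ∀ {Γ p r e x} → Coreᵖ Γ e p r x → PA ∣ Γ ⊢ Core ⟨ p ∷ r ∷ e ∷ x ∷ [] ⟩
    Core-join {p = p} {r} {e} {x} (core d g f v y) = ∧I d
      (∧I (coe (sym (subst-⟨⟩ σ Good ts refl)) g) (∧I (coe (sym (subst-⟨⟩ σ First ts refl)) f)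
      (∧I (coe (sym (subst-⟨⟩ σ NoEvent ts refl)) v)
          (coe (sym (subst-⟨⟩ σ Yₛ (var 0 ∷ var 3 ∷ var 2 ∷ []) refl)) y))))
      where
      σ : Subst
      σ = insts (p ∷ r ∷ e ∷ x ∷ [])
      ts : List Term
      ts = var 0 ∷ var 1 ∷ var 2 ∷ []

  -- The ingredients of `Core` may contain stray variables; instantiating removes them, so that at
  -- most the four intended ones remain.
  Core₄ : Formula
  Core₄ = Core ⟨ var 0 ∷ var 1 ∷ var 2 ∷ var 3 ∷ [] ⟩

  Core₄-Below : Below 4 Core₄
  Core₄-Below with Below-bound Core
  ... | k , b = subst-Below {k} (λ i _ → insts-Below 4 (var 0 ∷ var 1 ∷ var 2 ∷ var 3 ∷ [])
      (λ { (here refl) → s≤s z≤n ; (there (here refl)) → s≤s (s≤s z≤n)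
         ; (there (there (here refl))) → s≤s (s≤s (s≤s z≤n))
         ; (there (there (there (here refl)))) → s≤s (s≤s (s≤s (s≤s z≤n))) }) i) Core b

  -- The number e is meant to be the code of Core₄.
  PrF : ℕ → Formula
  PrF e = ∃' (∃' (∃' (var 2 ≐ numeral e ∧' Core₄)))

  PrF-Σ₁ : ∀ e → Σ₁ (PrF e)
  PrF-Σ₁ e = exists (exists (exists (matrix (and (eq _ _) (Δ₀-subst _ Core-Δ)))))

  PrF-Below : ∀ e → Below 1 (PrF e)
  PrF-Below e = (s≤s (s≤s (s≤s z≤n)) , numeral-Below 4 e) , Core₄-Below

-- Representing a rule-closed Σ₁ set in a consistent, possibly Σ₁-unsound theory

module Representation
  {Y : ℕ → ℕ → Set} (sig-Y : Sig (λ ρ → Y (ρ 1) (ρ 0)))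
  {R : ℕ → ℕ → ℕ → ℕ → Set} (sig-R : Sig (λ ρ → R (ρ 3) (ρ 0) (ρ 1) (ρ 2)))
  {P : ℕ → ℕ → Set} (sig-P : Sig (λ ρ → P (ρ 1) (ρ 0)))
  where

  open Formulas (stage-Δ (Δ sig-Y)) (stage-Δ (Δ sig-R)) (stage-Δ (Δ sig-P)) public

  module At
    (e : ℕ)
    (Y-closed : ∀ {u v w} → Y e u → Y e v → R e u v w → Y e w)
    {S : Theory} (S-consistent : Consistent S) (PA⊑S : PA ⊑ S)
    (P-sound : ∀ u → P e u → S ⊢ PrF e [ numeral u ])
    (P-complete : ∀ u → S ⊢ PrF e [ numeral u ] → P e u)
    where

    private

      Yₛ Rₛ : Formula
      Yₛ = stage (body sig-Y)
      Rₛ = stage (body sig-R)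

      N : Term
      N = numeral e

      Yˢ : ℕ → ℕ → Set
      Yˢ p x = ⟦ Yₛ ⟧ (envs (p ∷ x ∷ e ∷ []))

      Rˢ : ℕ → ℕ → ℕ → ℕ → Set
      Rˢ r u v w = ⟦ Rₛ ⟧ (envs (r ∷ u ∷ v ∷ w ∷ e ∷ []))

      Pˢ : ℕ → ℕ → Set
      Pˢ p u = ⟦ stage (body sig-P) ⟧ (envs (p ∷ u ∷ e ∷ []))

      Yˢ? : ∀ p x → Dec (Yˢ p x)
      Yˢ? p x = Decided-dec (decide-⟨⟩ (stage-Δ (Δ sig-Y)) (p ∷ x ∷ e ∷ []))

      Rˢ? : ∀ r u v w → Dec (Rˢ r u v w)
      Rˢ? r u v w = Decided-dec (decide-⟨⟩ (stage-Δ (Δ sig-R)) (r ∷ u ∷ v ∷ w ∷ e ∷ []))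

      Yˢ-mono : ∀ {p p' x} → p ≤ p' → Yˢ p x → Yˢ p' x
      Yˢ-mono p≤p' d = let y , y≤ , b = stage-from (body sig-Y) d in stage-to (body sig-Y) y (≤-trans y≤ p≤p') b

      Pˢ-mono : ∀ {p p' x} → p ≤ p' → Pˢ p x → Pˢ p' x
      Pˢ-mono p≤p' d = let y , y≤ , b = stage-from (body sig-P) d in stage-to (body sig-P) y (≤-trans y≤ p≤p') b

      Yˢ-sound : ∀ {p x} → Yˢ p x → Y e x
      Yˢ-sound d = let y , _ , b = stage-from (body sig-Y) d in from sig-Y y b

      Rˢ-sound : ∀ {r u v w} → Rˢ r u v w → R e u v w
      Rˢ-sound d = let y , _ , b = stage-from (body sig-R) d in from sig-R y b

      Pˢ-sound : ∀ {p x} → Pˢ p x → P e x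
      Pˢ-sound d = let y , _ , b = stage-from (body sig-P) d in from sig-P y b

      Yˢ-complete : ∀ {x} → Y e x → ∃ λ p → Yˢ p x
      Yˢ-complete {x} h = let y , b = to sig-Y {envs (x ∷ e ∷ [])} h in y , stage-to (body sig-Y) y ≤-refl b

      Rˢ-complete : ∀ {u v w} → R e u v w → ∃ λ r → Rˢ r u v w
      Rˢ-complete {u} {v} {w} h = let y , b = to sig-R {envs (u ∷ v ∷ w ∷ e ∷ [])} h in y , stage-to (body sig-R) y ≤-refl b

      Pˢ-complete : ∀ {x} → P e x → ∃ λ p → Pˢ p x
      Pˢ-complete {x} h = let y , b = to sig-P {envs (x ∷ e ∷ [])} h in y , stage-to (body sig-P) y ≤-refl b

      Good? : ∀ p r → Dec (Goodˢ e p r)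
      Good? p r = map′ Good-from Good-to (Decided-dec (decide-⟨⟩ Good-Δ (p ∷ r ∷ e ∷ [])))

      Core? : ∀ p r x → Dec (Coreˢ e p r x)
      Core? p r x = map′ Core-from Core-to (Decided-dec (decide-⟨⟩ Core-Δ (p ∷ r ∷ e ∷ x ∷ [])))

      module _ (r : ℕ) where

        Missing : ℕ → ℕ → Set
        Missing p w = w ≤ r × ¬ Yˢ p w × Y e w

        -- A violated instance has premises and a rule that are really present, so the closure of
        -- `Y` puts its conclusion into `Y`. Membership in `Y` never has to be decided.
        good-or-missing-at : ∀ p u v w → w ≤ r → (Yˢ p u → Yˢ p v → Rˢ r u v w → Yˢ p w) ⊎ Missing p w
        good-or-missing-at p u v w w≤r with Yˢ? p w | Yˢ? p u ×-dec Yˢ? p v ×-dec Rˢ? r u v w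
        ... | yes y | _ = inj₁ (λ _ _ _ → y)
        ... | no ¬y | no ¬h = inj₁ (λ a b c → ⊥-elim (¬h (a , b , c)))
        ... | no ¬y | yes (a , b , c) = inj₂ (w≤r , ¬y , Y-closed (Yˢ-sound a) (Yˢ-sound b) (Rˢ-sound c))

        good-or-missing : ∀ p → Goodˢ e p r ⊎ ∃ (Missing p)
        good-or-missing p = Sum.map₂ (λ (_ , _ , _ , _ , w , _ , h) → w , h)
          (search r λ u _ → search r λ v _ → search r λ w w≤r → good-or-missing-at p u v w w≤r)

        -- L lists the numbers that may still be enumerated: it gets shorter
        -- every time that the closure condition fails.
        good-from : ∀ k p L → length L ≤ k → (∀ x → x ≤ r → Yˢ p x ⊎ x ∈ L) → ∃ λ p' → p ≤ p' × Goodˢ e p' r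
        good-from k p L len cover with good-or-missing p
        ... | inj₁ g = p , ≤-refl , g
        ... | inj₂ (w , w≤r , ¬y , yw) with cover w w≤r
        ... | inj₁ y = ⊥-elim (¬y y)
        ... | inj₂ w∈L with k | <-≤-trans (filter-notAll (λ x → ¬? (x ≟ w)) L (lose w∈L (λ f → f refl))) len
        ... | suc k' | s≤s len' = let p₁ , y₁ = Yˢ-complete yw
                                      p' , p≤p' , g = good-from k' (p ⊔ p₁) (filter (λ x → ¬? (x ≟ w)) L) len' (cover' p₁ y₁)
                                  in p' , ≤-trans (m≤m⊔n p p₁) p≤p' , g
          where
          cover' : ∀ p₁ → Yˢ p₁ w → ∀ x → x ≤ r → Yˢ (p ⊔ p₁) x ⊎ x ∈ filter (λ x → ¬? (x ≟ w)) L
          cover' p₁ y₁ x x≤r with x ≟ w | cover x x≤r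
          ... | yes refl | _      = inj₁ (Yˢ-mono (m≤n⊔m p p₁) y₁)
          ... | no  x≢w  | inj₁ y = inj₁ (Yˢ-mono (m≤m⊔n p p₁) y)
          ... | no  x≢w  | inj₂ m = inj₂ (∈-filter⁺ (λ x → ¬? (x ≟ w)) m x≢w)

        good-exists : ∀ p → ∃ λ p' → p ≤ p' × Goodˢ e p' r
        good-exists p = good-from (length (upTo (suc r))) p (upTo (suc r)) ≤-refl (λ x x≤r → inj₂ (∈-upTo⁺ (s≤s x≤r)))

      record Stage (p r : ℕ) : Set where
        constructor mkStage
        field
          r≤p   : r ≤ p
          good  : Goodˢ e p r
          first : Firstˢ e p r

      -- Take the least q that is good for some k ≥ m. Whatever is good for some k' ≥ k also
      -- competes in this minimum, so q is first for k.
      stage-exists : ∀ m → ∃ λ p → ∃ λ r → m ≤ r × Stage p r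
      stage-exists m with good-exists m m
      ... | q₀ , m≤q₀ , g₀ with least Reached? q₀ (m , m≤q₀ , ≤-refl , g₀)
        where
        Reached : ℕ → Set
        Reached q = ∃ λ k → k ≤ q × (m ≤ k × Goodˢ e q k)
        Reached? : ∀ q → Dec (Reached q)
        Reached? q with search q (λ k _ → Sum.swap (Dec.toSum (m ≤? k ×-dec Good? q k)))
        ... | inj₁ f = no (λ (k , k≤q , h) → f k k≤q h)
        ... | inj₂ h = yes h
      ... | q , (k , k≤q , m≤k , g) , minimal = q , k , m≤k , mkStage k≤q g
        (λ q' _ k' k'≤q' k≤k' g' → ≮⇒≥ (λ q'<q → minimal q' q'<q (k' , k'≤q' , ≤-trans m≤k k≤k' , g')))

      -- If r ≤ r₀, the witness lies no later than the event, when u was not yet enumerated. If r₀ <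
      -- r, the event is an earlier one, which the witness forbids.
      event-excludes-core : ∀ {p₀ r₀ p r u} → Stage p₀ r₀ → u ≤ r₀ → Pˢ p₀ u → ¬ Yˢ p₀ u → ¬ Coreˢ e p r u
      event-excludes-core {p₀} {r₀} {p} {r} (mkStage r₀≤p₀ g₀ f₀) u≤r₀ pu ¬yu (core r≤p g f v y) with <-≤-connex r₀ r
      ... | inj₂ r≤r₀ = ¬yu (Yˢ-mono p≤p₀ y)
        where
        p≤p₀ : p ≤ p₀
        p≤p₀ with ≤-total p p₀
        ... | inj₁ le' = le'
        ... | inj₂ p₀≤p = f p₀ p₀≤p r₀ r₀≤p₀ r≤r₀ g₀
      ... | inj₁ r₀<r = v r₀ (<⇒≤ r₀<r) p₀ p₀≤p r₀<r r₀≤p₀ g₀ f₀ (_ , u≤r₀ , pu , ¬yu)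
        where
        p₀≤p : p₀ ≤ p
        p₀≤p with ≤-total p₀ p
        ... | inj₁ le' = le'
        ... | inj₂ p≤p₀ = f₀ p p≤p₀ r r≤p (<⇒≤ r₀<r) g

      Pr[_] : ℕ → Formula
      Pr[ x ] = PrF e [ numeral x ]

      Core[_,_,_] : Term → Term → ℕ → Formula
      Core[ p , r , x ] = Core ⟨ p ∷ r ∷ N ∷ numeral x ∷ [] ⟩

      subst-Core : ∀ σ {p r p' r'} x → substₜ σ p ≡ p' → substₜ σ r ≡ r' → subst σ Core[ p , r , x ] ≡ Core[ p' , r' , x ]
      subst-Core σ {p} {r} x refl refl = subst-⟨⟩ σ Core (p ∷ r ∷ N ∷ numeral x ∷ [])
        (cong₂ (λ t u → substₜ σ p ∷ substₜ σ r ∷ t ∷ u ∷ []) (numeral-closed σ e) (numeral-closed σ x))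

      Pr-closed : ∀ x σ → subst σ Pr[ x ] ≡ Pr[ x ]
      Pr-closed x = Below-closed Pr[ x ] (subst-Below (λ { zero _ → numeral-Below 0 x ; (suc i) (s≤s ()) }) (PrF e) (PrF-Below e))

      Pr-intro : ∀ {Γ p r} x → PA ∣ Γ ⊢ Core[ p , r , x ] → PA ∣ Γ ⊢ Pr[ x ]
      Pr-intro {p = p} {r} x d =
        ∃I' {σ = numeral x • var} {φ = ∃' (∃' (var 2 ≐ N ∧' Core₄))} N
          (∃I' {σ = N • (numeral x • var)} {φ = ∃' (var 2 ≐ N ∧' Core₄)} r
            (∃I' {φ = var 2 ≐ N ∧' Core₄} p
              (∧I (coe (cong (N ≐_) (sym (numeral-closed σ e))) (refl N))
                  (coe (sym (subst-⟨⟩ σ Core (var 0 ∷ var 1 ∷ var 2 ∷ var 3 ∷ []) refl)) d))))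
        where
        σ : Subst
        σ = p • (r • (N • (numeral x • var)))

      -- PA cannot say that r is nonstandard. The substitute is that `Pr[ x ]` implies this formula
      -- for each standard `m` separately.
      Large : ℕ → ℕ → Formula
      Large m x = ∃' (∃' (numeral m ≤' var 1 ∧' Core[ var 0 , var 1 , x ]))

      Large-closed : ∀ m x σ → subst σ (Large m x) ≡ Large m x
      Large-closed m x σ = cong (∃' ∘ ∃') (cong₂ _∧'_ (cong (_≤' var 1) (numeral-closed _ m))
        (subst-Core (lift (lift σ)) x refl refl))

      Large-intro : ∀ {Γ p r} m x → PA ∣ Γ ⊢ numeral m ≤' r → PA ∣ Γ ⊢ Core[ p , r , x ] → PA ∣ Γ ⊢ Large m x
      Large-intro {p = p} {r} m x d c =
        coe (Large-closed m x var) (∃I' {σ = var} {φ = ∃' φ} r (∃I' {σ = r • var} {φ = φ} p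
          (∧I (coe (cong (_≤' r) (sym (numeral-closed _ m))) d) (coe (sym (subst-Core _ x refl refl)) c))))
        where
        φ : Formula
        φ = numeral m ≤' var 1 ∧' Core[ var 0 , var 1 , x ]

      Core-cong : ∀ {Γ p r p' r'} x → PA ∣ Γ ⊢ p ≐ p' → PA ∣ Γ ⊢ r ≐ r' →
        PA ∣ Γ ⊢ Core[ p , r , x ] → PA ∣ Γ ⊢ Core[ p' , r' , x ]
      Core-cong {r = r} {p'} {r'} x dp dr c =
        coe (exchange r') (repl' (Core ⟨ swapped ⟩) dr (coe (sym (exchange r)) (repl' Core dp c)))
        where
        swapped : List Term
        swapped = var 1 ∷ var 0 ∷ var 2 ∷ var 3 ∷ []
        exchange : ∀ t → subst (insts (t ∷ p' ∷ N ∷ numeral x ∷ [])) (Core ⟨ swapped ⟩) ≡ Core[ p' , t , x ]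
        exchange t = subst-⟨⟩ _ Core swapped refl

      Good-provable : ∀ {Γ p r} → Goodˢ e p r → PA ∣ Γ ⊢ Good ⟨ numeral p ∷ numeral r ∷ N ∷ [] ⟩
      Good-provable {p = p} {r} g = closed (Decided-true (decide-⟨⟩ Good-Δ (p ∷ r ∷ e ∷ [])) (Good-to g))

      Core-provable : ∀ {Γ p r} x → Coreˢ e p r x → PA ∣ Γ ⊢ Core[ numeral p , numeral r , x ]
      Core-provable {p = p} {r} x c = closed (Decided-true (decide-⟨⟩ Core-Δ (p ∷ r ∷ e ∷ x ∷ [])) (Core-to c))

      module _ {m x q k : ℕ} (m≤k : m ≤ k) (k≤q : k ≤ q) (g : Goodˢ e q k)
               (none : ∀ i → i ≤ m → ∀ j → j ≤ q → ¬ Coreˢ e j i x) where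

        -- The stage `(q , k)` is good for k ≥ i, so a witness with r = i, being first, has p ≤ q.
        -- Only finitely many pairs are left, and PA refutes each of them.
        small-core : ∀ {Γ p r i} → i ≤ m → PA ∣ Γ ⊢ r ≐ numeral i → PA ∣ Γ ⊢ Core[ p , r , x ] → PA ∣ Γ ⊢ ⊥'
        small-core {Γ} {p} {r} {i} i≤m dr c = ≤'-numeral-cases q p≤q λ j j≤q →
          ⇒E (closed (Decided-false (decide-⟨⟩ Core-Δ (j ∷ i ∷ e ∷ x ∷ [])) (none i i≤m j j≤q ∘ Core-from)))
            (Core-cong x h0 (wk dr) (wk c))
          where
          p≤q : PA ∣ Γ ⊢ p ≤' numeral q
          p≤q = ∨E (≤'-total p (numeral q)) h0
            (First-elim (numeral q) (numeral k) (wk (Coreᵖ.first (Core-split c))) h0 (numeral-≤ k≤q)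
              (≤-cong (≐-sym (wk dr)) (refl _) (numeral-≤ (≤-trans i≤m m≤k))) (Good-provable g))

        core-large : ∀ {Γ p r} → PA ∣ Γ ⊢ Core[ p , r , x ] → PA ∣ Γ ⊢ Large m x
        core-large c = ≤'-or-≥ m (λ i i≤m → efq (small-core i≤m h0 (wk c))) (Large-intro m x h0 (wk c))

        Pr⇒Large : PA ⊢ Pr[ x ] ⇒ Large m x
        Pr⇒Large = ⇒I (∃E h0 (∃E h0 (∃E h0 (coe (sym shifts) (core-large
          (coe (subst-⟨⟩ _ Core (var 1 ∷ var 2 ∷ var 0 ∷ var 3 ∷ []) refl)
            -- The arguments are permuted so that the coordinate to be replaced by `N` is variable
            -- 0, the place where `repl'` acts.
            (repl' (Core ⟨ var 1 ∷ var 2 ∷ var 0 ∷ var 3 ∷ [] ⟩)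
              (coe (cong (var 2 ≐_) (numeral-closed _ e)) (∧E₁ h0))
              (coe (sym (subst-⟨⟩ (insts (var 2 ∷ var 0 ∷ var 1 ∷ numeral x ∷ [])) Core (var 1 ∷ var 2 ∷ var 0 ∷ var 3 ∷ []) refl))
                (coe (subst-⟨⟩ _ Core (var 0 ∷ var 1 ∷ var 2 ∷ var 3 ∷ [])
                  (cong (λ t → var 0 ∷ var 1 ∷ var 2 ∷ t ∷ []) shifted)) (∧E₂ h0))))))))))
          where
          shifts : shift (shift (shift (Large m x))) ≡ Large m x
          shifts = trans (cong (shift ∘ shift) (Large-closed m x _))
            (trans (cong shift (Large-closed m x _)) (Large-closed m x _))
          shifted : shiftₜ (shiftₜ (shiftₜ (numeral x))) ≡ numeral x
          shifted = trans (cong (shiftₜ ∘ shiftₜ) (numeral-closed _ x))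
            (trans (cong shiftₜ (numeral-closed _ x)) (numeral-closed _ x))

      found-or-none : ∀ m q x → (∀ i → i ≤ m → ∀ j → j ≤ q → ¬ Coreˢ e j i x) ⊎ (∃ λ p → ∃ λ r → Coreˢ e p r x)
      found-or-none m q x = Sum.map₂ (λ (i , _ , j , _ , c) → j , i , c)
        (search m λ i _ → search q λ j _ → Sum.swap (Dec.toSum (Core? j i x)))

      found-or-large : ∀ m x → (∃ λ p → ∃ λ r → Coreˢ e p r x) ⊎ (PA ⊢ Pr[ x ] ⇒ Large m x)
      found-or-large m x =
        let q , k , m≤k , st = stage-exists m
        in Sum.swap (Sum.map₁ (Pr⇒Large m≤k (Stage.r≤p st) (Stage.good st)) (found-or-none m q x))

      -- The threshold `suc p` also exceeds `r`, because r ≤ p. A witness beyond it has its second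
      -- coordinate, and therefore its first, above `p`, so the stage `(p , r)` is among those that
      -- its `noEvent` inspects.
      large-refutable : ∀ {p r} → Stage p r → Eventˢ e p r → ∀ u → PA ⊢ Large (suc p) u ⇒ ⊥'
      large-refutable {p} {r} (mkStage r≤p g f) ev u =
        ⇒I (∃E h0 (∃E h0 (NoEvent-elim (numeral r) (numeral p)
          (Coreᵖ.noEvent (Core-split (∧E₂ h0)))
          (≤'-trans (numeral-≤ (m≤n⇒m≤1+n r≤p)) (∧E₁ h0))
          (≤'-trans (numeral-≤ (n≤1+n p)) (≤'-trans (∧E₁ h0) (Coreᵖ.r≤p (Core-split (∧E₂ h0)))))
          (≤'-trans (numeral-≤ (s≤s r≤p)) (∧E₁ h0))
          (numeral-≤ r≤p)
          (Good-provable g)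
          (closed (Decided-true (decide-⟨⟩ First-Δ (p ∷ r ∷ e ∷ [])) (First-to f)))
          (closed (Decided-true (decide-⟨⟩ Event-Δ (p ∷ r ∷ e ∷ [])) (Event-to ev))))))

      -- The event provides u with `S ⊢ Pr[ u ]`. A standard witness for u is excluded outright;
      -- failing that, PA pushes every witness beyond the event, where it is refuted, against the
      -- consistency of `S`.
      no-event : ∀ {p r} → Stage p r → ¬ Eventˢ e p r
      no-event {p} {r} st ev@(u , u≤r , pu , ¬yu) = [ (λ (_ , _ , c) → event-excludes-core st u≤r pu ¬yu c)
        , (λ d → S-consistent (⇒E (PA⊑S _ (large-refutable st ev u)) (⇒E (PA⊑S _ d) (P-sound u (Pˢ-sound pu))))) ]′
        (found-or-large (suc p) u)

      core-exists : ∀ m {x} → Y e x → ∃ λ p → ∃ λ r → m ≤ r × Coreˢ e p r x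
      core-exists m yx =
        let p₁ , y₁ = Yˢ-complete yx
            p , r , m≤r , mkStage r≤p g f = stage-exists (m ⊔ p₁)
        in p , r , ≤-trans (m≤m⊔n m p₁) m≤r ,
           core r≤p g f (λ a _ b _ _ a≤b g' f' → no-event (mkStage a≤b g' f'))
             (Yˢ-mono (≤-trans (m≤n⊔m m p₁) (≤-trans m≤r r≤p)) y₁)

      -- If the search finds a witness, x belongs to `Y` and has standard witnesses beyond any `m`,
      -- so the conclusion is provable outright; otherwise the search itself gives the implication.
      large : ∀ m x → PA ⊢ Pr[ x ] ⇒ Large m x
      large m x = [ (λ (_ , _ , c) → let _ , _ , m≤r , c' = core-exists m (Yˢ-sound (Coreˢ.member c)) in
                          ⇒I (Large-intro m x (numeral-≤ m≤r) (Core-provable x c')))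
                      , (λ d → d) ]′ (found-or-large m x)

      -- The stage is taken beyond x and beyond the witness that `S` proves `Pr[ x ]`. Were x not
      -- enumerated there, this would be an event.
      enumerated : ∀ {x} → P e x → Y e x
      enumerated {x} h =
        let p₁ , px = Pˢ-complete h
            p , r , m≤r , st = stage-exists (x ⊔ p₁)
        in Yˢ-sound (decidable-stable (Yˢ? p x) λ ¬y → no-event st (x , ≤-trans (m≤m⊔n x p₁) m≤r ,
             Pˢ-mono (≤-trans (m≤n⊔m x p₁) (≤-trans m≤r (Stage.r≤p st))) px , ¬y))

    represents⁺ : ∀ {x} → Y e x → PA ⊢ PrF e [ numeral x ]
    represents⁺ {x} yx = let _ , _ , _ , c = core-exists 0 yx in Pr-intro x (Core-provable x c)

    represents⁻ : ∀ {x} → S ⊢ PrF e [ numeral x ] → Y e x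
    represents⁻ {x} d = enumerated (P-complete x d)

    private module _ {a b c : ℕ} (Rabc : R e a b c) where

      y₀ : ℕ
      y₀ = proj₁ (Rˢ-complete Rabc)

      -- From `m` on, `Good` covers this instance: the three numbers and the witness `y₀` of the
      -- rule all fall under its bound.
      m : ℕ
      m = a ⊔ b ⊔ c ⊔ y₀

      bound : ∀ {Γ r x} → x ≤ m → PA ∣ Γ ⊢ numeral m ≤' r → PA ∣ Γ ⊢ numeral x ≤' r
      bound x≤m d = ≤'-trans (numeral-≤ x≤m) d

      a≤m : a ≤ m
      a≤m = ≤-trans (m≤m⊔n a b) (≤-trans (m≤m⊔n (a ⊔ b) c) (m≤m⊔n (a ⊔ b ⊔ c) y₀))

      b≤m : b ≤ m
      b≤m = ≤-trans (m≤n⊔m a b) (≤-trans (m≤m⊔n (a ⊔ b) c) (m≤m⊔n (a ⊔ b ⊔ c) y₀))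

      c≤m : c ≤ m
      c≤m = ≤-trans (m≤n⊔m (a ⊔ b) c) (m≤m⊔n (a ⊔ b ⊔ c) y₀)

      rule : ∀ {Γ r} → PA ∣ Γ ⊢ numeral m ≤' r →
        PA ∣ Γ ⊢ Rₛ ⟨ r ∷ numeral a ∷ numeral b ∷ numeral c ∷ N ∷ [] ⟩
      rule d = stage-mono (body sig-R) (numeral a ∷ numeral b ∷ numeral c ∷ N ∷ []) (bound (m≤n⊔m (a ⊔ b ⊔ c) y₀) d)
        (closed (Decided-true (decide-⟨⟩ (stage-Δ (Δ sig-R)) (y₀ ∷ a ∷ b ∷ c ∷ e ∷ [])) (proj₂ (Rˢ-complete Rabc))))

      -- The first stage for `r` is at most every good stage for a larger `r'`, so its members are
      -- still enumerated at the latter.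
      carry : ∀ {Γ p r p' r'} x {y} → PA ∣ Γ ⊢ r ≤' r' → PA ∣ Γ ⊢ Core[ p , r , x ] →
        PA ∣ Γ ⊢ Core[ p' , r' , y ] → PA ∣ Γ ⊢ Yₛ ⟨ p' ∷ numeral x ∷ N ∷ [] ⟩
      carry {Γ} {p} {r} {p'} {r'} x r≤r' d d' = stage-mono (body sig-Y) (numeral x ∷ N ∷ []) p≤p' (Coreᵖ.member (Core-split d))
        where
        p≤p' : PA ∣ Γ ⊢ p ≤' p'
        p≤p' = ∨E (≤'-total p p') h0 (First-elim p' r' (wk (Coreᵖ.first (Core-split d))) h0
          (wk (Coreᵖ.r≤p (Core-split d'))) (wk r≤r') (wk (Coreᵖ.good (Core-split d'))))

      conclude : ∀ {Γ p r} {x} → PA ∣ Γ ⊢ numeral m ≤' r → PA ∣ Γ ⊢ Core[ p , r , x ] →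
        PA ∣ Γ ⊢ Yₛ ⟨ p ∷ numeral a ∷ N ∷ [] ⟩ → PA ∣ Γ ⊢ Yₛ ⟨ p ∷ numeral b ∷ N ∷ [] ⟩ → PA ∣ Γ ⊢ Pr[ c ]
      conclude m≤r d ya yb = let core r≤p g f v _ = Core-split d in Pr-intro c (Core-join (core r≤p g f v
        (Good-elim (numeral a) (numeral b) (numeral c) g (bound a≤m m≤r) (bound b≤m m≤r) (bound c≤m m≤r) ya yb (rule m≤r))))

      -- The premises come with unrelated witnesses. The one with the larger second coordinate
      -- enumerates both `a` and `b`, and becomes the witness for `c`.
      combine : ∀ {Γ p r p' r'} → PA ∣ Γ ⊢ numeral m ≤' r → PA ∣ Γ ⊢ Core[ p , r , a ] →
        PA ∣ Γ ⊢ numeral m ≤' r' → PA ∣ Γ ⊢ Core[ p' , r' , b ] → PA ∣ Γ ⊢ Pr[ c ]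
      combine {r = r} {r' = r'} m≤r d m≤r' d' = ∨E (≤'-total r r')
        (conclude (wk m≤r') (wk d') (carry a h0 (wk d) (wk d')) (Coreᵖ.member (Core-split (wk d'))))
        (conclude (wk m≤r) (wk d) (Coreᵖ.member (Core-split (wk d))) (carry b h0 (wk d') (wk d)))

      Pr-shift² : ∀ x → shift (shift Pr[ x ]) ≡ Pr[ x ]
      Pr-shift² x = trans (cong shift (Pr-closed x _)) (Pr-closed x _)

      rule-provable : PA ⊢ Pr[ a ] ⇒ Pr[ b ] ⇒ Pr[ c ]
      rule-provable = ⇒I (⇒I (∃E (⇒E (closed (large m a)) h1) (∃E h0
        (coe (sym (Pr-shift² c)) (∃E (⇒E (closed (large m b)) (coe (Pr-shift² b) h2)) (∃E h0
          (coe (sym (Pr-shift² c)) (combine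
            (coe (cong (_≤' var 3) (trans (cong shiftₜ (numeral-closed _ m)) (numeral-closed _ m))) (∧E₁ h2))
            (coe (trans (cong shift (subst-Core _ a refl refl)) (subst-Core _ a refl refl)) (∧E₂ h2))
            (∧E₁ h0) (∧E₂ h0)))))))))

    Pr-rule : ∀ {a b c} → R e a b c → PA ⊢ PrF e [ numeral a ] ⇒ PrF e [ numeral b ] ⇒ PrF e [ numeral c ]
    Pr-rule = rule-provable

-- Codes of formulas

-- Comparing the heads first disposes of all pairs of distinct constructors at once, so injectivity
-- needs only the cases with equal heads.
tagₜ bodyₜ : Term → ℕ
tagₜ (var i)   = 0
tagₜ zero      = 1
tagₜ (s t)     = 2
tagₜ (t +' u)  = 3
tagₜ (t ×' u)  = 4
bodyₜ (var i)  = i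
bodyₜ zero     = 0
bodyₜ (s t)    = codeₜ t
bodyₜ (t +' u) = pair (codeₜ t) (codeₜ u)
bodyₜ (t ×' u) = pair (codeₜ t) (codeₜ u)

codeₜ-split : ∀ t → codeₜ t ≡ pair (tagₜ t) (bodyₜ t)
codeₜ-split (var i)  = refl
codeₜ-split zero     = refl
codeₜ-split (s t)    = refl
codeₜ-split (t +' u) = refl
codeₜ-split (t ×' u) = refl

codeₜ-injective : ∀ t u → codeₜ t ≡ codeₜ u → t ≡ u
codeₜ-injective′ : ∀ t u → tagₜ t ≡ tagₜ u → bodyₜ t ≡ bodyₜ u → t ≡ u
codeₜ-injective t u e =
  let p , q = pair-injective (tagₜ t) (bodyₜ t) (tagₜ u) (bodyₜ u) (trans (sym (codeₜ-split t)) (trans e (codeₜ-split u)))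
  in codeₜ-injective′ t u p q
codeₜ-injective′ (var i)  (var j)    refl e = cong var e
codeₜ-injective′ zero     zero       refl e = refl
codeₜ-injective′ (s t)    (s t')     refl e = cong s (codeₜ-injective t t' e)
codeₜ-injective′ (t +' u) (t' +' u') refl e =
  let p , q = pair-injective (codeₜ t) (codeₜ u) (codeₜ t') (codeₜ u') e
  in cong₂ _+'_ (codeₜ-injective t t' p) (codeₜ-injective u u' q)
codeₜ-injective′ (t ×' u) (t' ×' u') refl e =
  let p , q = pair-injective (codeₜ t) (codeₜ u) (codeₜ t') (codeₜ u') e
  in cong₂ _×'_ (codeₜ-injective t t' p) (codeₜ-injective u u' q)

tag content : Formula → ℕ
tag (t ≐ u)      = 0
tag (t ≤' u)     = 1
tag ⊥'           = 2
tag (φ ⇒ ψ)      = 3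
tag (φ ∧' ψ)     = 4
tag (φ ∨' ψ)     = 5
tag (∀' φ)       = 6
tag (∃' φ)       = 7
content (t ≐ u)  = pair (codeₜ t) (codeₜ u)
content (t ≤' u) = pair (codeₜ t) (codeₜ u)
content ⊥'       = 0
content (φ ⇒ ψ)  = pair (code φ) (code ψ)
content (φ ∧' ψ) = pair (code φ) (code ψ)
content (φ ∨' ψ) = pair (code φ) (code ψ)
content (∀' φ)   = code φ
content (∃' φ)   = code φ

code-split : ∀ φ → code φ ≡ pair (tag φ) (content φ)
code-split (t ≐ u)  = refl
code-split (t ≤' u) = refl
code-split ⊥'       = refl
code-split (φ ⇒ ψ)  = refl
code-split (φ ∧' ψ) = refl
code-split (φ ∨' ψ) = refl
code-split (∀' φ)   = refl
code-split (∃' φ)   = refl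

code-injective : ∀ φ ψ → code φ ≡ code ψ → φ ≡ ψ
code-injective′ : ∀ φ ψ → tag φ ≡ tag ψ → content φ ≡ content ψ → φ ≡ ψ
code-injective φ ψ e =
  let p , q = pair-injective (tag φ) (content φ) (tag ψ) (content ψ) (trans (sym (code-split φ)) (trans e (code-split ψ)))
  in code-injective′ φ ψ p q
code-injective′ (t ≐ u)  (t' ≐ u')  refl e =
  let p , q = pair-injective (codeₜ t) (codeₜ u) (codeₜ t') (codeₜ u') e
  in cong₂ _≐_ (codeₜ-injective t t' p) (codeₜ-injective u u' q)
code-injective′ (t ≤' u) (t' ≤' u') refl e =
  let p , q = pair-injective (codeₜ t) (codeₜ u) (codeₜ t') (codeₜ u') e
  in cong₂ _≤'_ (codeₜ-injective t t' p) (codeₜ-injective u u' q)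
code-injective′ ⊥'       ⊥'         refl e = refl
code-injective′ (φ ⇒ ψ)  (φ' ⇒ ψ')  refl e =
  let p , q = pair-injective (code φ) (code ψ) (code φ') (code ψ') e
  in cong₂ _⇒_ (code-injective φ φ' p) (code-injective ψ ψ' q)
code-injective′ (φ ∧' ψ) (φ' ∧' ψ') refl e =
  let p , q = pair-injective (code φ) (code ψ) (code φ') (code ψ') e
  in cong₂ _∧'_ (code-injective φ φ' p) (code-injective ψ ψ' q)
code-injective′ (φ ∨' ψ) (φ' ∨' ψ') refl e =
  let p , q = pair-injective (code φ) (code ψ) (code φ') (code ψ') e
  in cong₂ _∨'_ (code-injective φ φ' p) (code-injective ψ ψ' q)
code-injective′ (∀' φ)   (∀' φ')    refl e = cong ∀' (code-injective φ φ' e)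
code-injective′ (∃' φ)   (∃' φ')    refl e = cong ∃' (code-injective φ φ' e)

impᶜ conjᶜ iffᶜ : ℕ → ℕ → ℕ
impᶜ  a b = ⟪ 3 , ⟪ a , b ⟫ ⟫
conjᶜ a b = ⟪ 4 , ⟪ a , b ⟫ ⟫
iffᶜ  a b = conjᶜ (impᶜ a b) (impᶜ b a)

numeralᶜ : ℕ → ℕ
numeralᶜ = iterate ⟪ 2 ,_⟫ ⟪ 1 , 0 ⟫

-- Codes of PrF e, where e is the code of its matrix Core₄, and of the
-- sentence ∃' (var 0 ≐ numeral u ∧' PrF e), a form of PrF e [ numeral u ]
-- whose code is computed without substitution.
prᶜ : ℕ → ℕ
prᶜ e = ⟪ 7 , ⟪ 7 , ⟪ 7 , conjᶜ ⟪ 0 , ⟪ ⟪ 0 , 2 ⟫ , numeralᶜ e ⟫ ⟫ e ⟫ ⟫ ⟫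

atᶜ : ℕ → ℕ → ℕ
atᶜ e u = ⟪ 7 , conjᶜ ⟪ 0 , ⟪ ⟪ 0 , 0 ⟫ , numeralᶜ u ⟫ ⟫ (prᶜ e) ⟫

fun-impᶜ : SigFun F → SigFun G → SigFun (λ ρ → impᶜ (F ρ) (G ρ))
fun-impᶜ S S' = fun-⟪⟫ (fun-const 3) (fun-⟪⟫ S S')

fun-conjᶜ : SigFun F → SigFun G → SigFun (λ ρ → conjᶜ (F ρ) (G ρ))
fun-conjᶜ S S' = fun-⟪⟫ (fun-const 4) (fun-⟪⟫ S S')

fun-iffᶜ : SigFun F → SigFun G → SigFun (λ ρ → iffᶜ (F ρ) (G ρ))
fun-iffᶜ S S' = fun-conjᶜ (fun-impᶜ S S') (fun-impᶜ S' S)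

fun-numeralᶜ : SigFun F → SigFun (λ ρ → numeralᶜ (F ρ))
fun-numeralᶜ = Iterate.fun-iterate ⟪ 2 ,_⟫ (fun-⟪⟫ (fun-const 2) (fun-var 0)) ⟪ 1 , 0 ⟫

fun-eq-numeral : ∀ k → SigFun F → SigFun (λ ρ → ⟪ 0 , ⟪ ⟪ 0 , k ⟫ , numeralᶜ (F ρ) ⟫ ⟫)
fun-eq-numeral k S = fun-⟪⟫ (fun-const 0) (fun-⟪⟫ (fun-const ⟪ 0 , k ⟫) (fun-numeralᶜ S))

fun-∃ᶜ : SigFun F → SigFun (λ ρ → ⟪ 7 , F ρ ⟫)
fun-∃ᶜ = fun-⟪⟫ (fun-const 7)

fun-prᶜ : SigFun F → SigFun (λ ρ → prᶜ (F ρ))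
fun-prᶜ S = fun-∃ᶜ (fun-∃ᶜ (fun-∃ᶜ (fun-conjᶜ (fun-eq-numeral 2 S) S)))

fun-atᶜ : SigFun F → SigFun G → SigFun (λ ρ → atᶜ (F ρ) (G ρ))
fun-atᶜ S S' = fun-∃ᶜ (fun-conjᶜ (fun-eq-numeral 0 S') (fun-prᶜ S))

code-∃' : ∀ φ → code (∃' φ) ≡ ⟪ 7 , code φ ⟫
code-∃' φ = sym (⟪⟫≡pair 7 (code φ))

code-∧' : ∀ φ ψ → code (φ ∧' ψ) ≡ conjᶜ (code φ) (code ψ)
code-∧' φ ψ = trans (sym (⟪⟫≡pair 4 _)) (cong ⟪ 4 ,_⟫ (sym (⟪⟫≡pair (code φ) (code ψ))))

code-⇒ : ∀ φ ψ → code (φ ⇒ ψ) ≡ impᶜ (code φ) (code ψ)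
code-⇒ φ ψ = trans (sym (⟪⟫≡pair 3 _)) (cong ⟪ 3 ,_⟫ (sym (⟪⟫≡pair (code φ) (code ψ))))

code-⇔' : ∀ φ ψ → code (φ ⇔' ψ) ≡ iffᶜ (code φ) (code ψ)
code-⇔' φ ψ = trans (code-∧' (φ ⇒ ψ) (ψ ⇒ φ)) (cong₂ conjᶜ (code-⇒ φ ψ) (code-⇒ ψ φ))

codeₜ-numeral : ∀ n → codeₜ (numeral n) ≡ numeralᶜ n
codeₜ-numeral zero    = sym (⟪⟫≡pair 1 0)
codeₜ-numeral (suc n) = trans (sym (⟪⟫≡pair 2 (codeₜ (numeral n)))) (cong ⟪ 2 ,_⟫ (codeₜ-numeral n))

code-≐-numeral : ∀ k n → code (var k ≐ numeral n) ≡ ⟪ 0 , ⟪ ⟪ 0 , k ⟫ , numeralᶜ n ⟫ ⟫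
code-≐-numeral k n = trans (sym (⟪⟫≡pair 0 _)) (cong ⟪ 0 ,_⟫
  (trans (sym (⟪⟫≡pair _ _)) (cong₂ ⟪_,_⟫ (sym (⟪⟫≡pair 0 k)) (codeₜ-numeral n))))

at : Formula → ℕ → Formula
at φ u = ∃' (var 0 ≐ numeral u ∧' φ)

code-at : ∀ φ u → code (at φ u) ≡ ⟪ 7 , conjᶜ ⟪ 0 , ⟪ ⟪ 0 , 0 ⟫ , numeralᶜ u ⟫ ⟫ (code φ) ⟫
code-at φ u = trans (code-∃' (var 0 ≐ numeral u ∧' φ)) (cong ⟪ 7 ,_⟫
  (trans (code-∧' (var 0 ≐ numeral u) φ) (cong (λ a → conjᶜ a (code φ)) (code-≐-numeral 0 u))))

decode-∧ : ∀ χ {a b} → code χ ≡ conjᶜ a b → ∃ λ φ → ∃ λ ψ → χ ≡ φ ∧' ψ × code φ ≡ a × code ψ ≡ b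
decode-∧ χ {a} {b} e =
  let p , q = pair-injective (tag χ) (content χ) 4 ⟪ a , b ⟫ (trans (sym (code-split χ)) (trans e (⟪⟫≡pair 4 ⟪ a , b ⟫)))
  in go χ p (trans q (⟪⟫≡pair a b))
  where
  go : ∀ χ → tag χ ≡ 4 → content χ ≡ pair a b → ∃ λ φ → ∃ λ ψ → χ ≡ φ ∧' ψ × code φ ≡ a × code ψ ≡ b
  go (φ ∧' ψ) refl e = φ , ψ , refl , pair-injective (code φ) (code ψ) a b e

decode-⇒ : ∀ χ {a b} → code χ ≡ impᶜ a b → ∃ λ φ → ∃ λ ψ → χ ≡ (φ ⇒ ψ) × code φ ≡ a × code ψ ≡ b
decode-⇒ χ {a} {b} e =
  let p , q = pair-injective (tag χ) (content χ) 3 ⟪ a , b ⟫ (trans (sym (code-split χ)) (trans e (⟪⟫≡pair 3 ⟪ a , b ⟫)))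
  in go χ p (trans q (⟪⟫≡pair a b))
  where
  go : ∀ χ → tag χ ≡ 3 → content χ ≡ pair a b → ∃ λ φ → ∃ λ ψ → χ ≡ (φ ⇒ ψ) × code φ ≡ a × code ψ ≡ b
  go (φ ⇒ ψ) refl e = φ , ψ , refl , pair-injective (code φ) (code ψ) a b e

-- The number `b` is arbitrary. That it is the code of a formula at all is read off the formula `χ`
-- that contains it.
decode-⇔ : ∀ χ φ {b} → code χ ≡ iffᶜ (code φ) b → ∃ λ ψ → χ ≡ (φ ⇔' ψ) × code ψ ≡ b
decode-⇔ χ φ e with decode-∧ χ e
... | χ₁ , χ₂ , refl , e₁ , e₂ with decode-⇒ χ₁ e₁ | decode-⇒ χ₂ e₂
... | φ₁ , ψ₁ , refl , a₁ , b₁ | ψ₂ , φ₂ , refl , b₂ , a₂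
  with code-injective φ₁ φ a₁ | code-injective φ₂ φ a₂ | code-injective ψ₂ ψ₁ (trans b₂ (sym b₁))
... | refl | refl | refl = ψ₁ , refl , b₁

-- The closure of the theorems and its Σ₁ definition

Theorem : Theory → ℕ → Set
Theorem T n = ∃ λ φ → code φ ≡ n × (T ⊢ φ)

theorem-elim : ∀ {T} φ {n} → n ≡ code φ → Theorem T n → T ⊢ φ
theorem-elim {T} φ e (ψ , e' , d) = coe (code-injective ψ φ (trans e' e)) d

-- Open on purpose: it is not equivalent to a sentence.
ψ₀ : Formula
ψ₀ = var 0 ≐ zero

module Closed (S T : Theory) (S-ce : CETheory S) (T-ce : CETheory T) where

  -- One alternative for each of C, D3 and E, in the uniform shape with two premises that `Closure`
  -- and `Representation` expect.
  Rule : ℕ → ℕ → ℕ → ℕ → Set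
  Rule e u v w = w ≡ conjᶜ u v ⊎ w ≡ atᶜ e u ⊎ Theorem T (iffᶜ u w)

  trigger : ℕ → ℕ
  trigger e = impᶜ (atᶜ e (code ⊥')) (atᶜ e (code ψ₀))

  data Y (e : ℕ) : ℕ → Set where
    thm  : ∀ {x} → Theorem T x → Y e x
    bot  : Theorem S (trigger e) → Y e (code ⊥')
    rule : ∀ {u v w} → Y e u → Y e v → Rule e u v w → Y e w

  sig-T : Sig (λ ρ → Theorem T (ρ 0))
  sig-T = sig-CE T-ce

  sig-S : Sig (λ ρ → Theorem S (ρ 0))
  sig-S = sig-CE S-ce

  sig-Rule : Sig (λ ρ → Rule (ρ 3) (ρ 0) (ρ 1) (ρ 2))
  sig-Rule =
    sig-⊎ (sig-rename (2 ◂ id) (graph (fun-conjᶜ (fun-var 0) (fun-var 1))))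
    (sig-⊎ (sig-rename (2 ◂ id) (graph (fun-atᶜ (fun-var 3) (fun-var 0))))
    (sig-apply (fun-iffᶜ (fun-var 0) (fun-var 2)) sig-T))

  sig-P : Sig (λ ρ → Theorem S (atᶜ (ρ 1) (ρ 0)))
  sig-P = sig-apply (fun-atᶜ (fun-var 1) (fun-var 0)) sig-S

  sig-trigger : Sig (λ ρ → Theorem S (trigger (ρ 0)))
  sig-trigger = sig-apply (fun-impᶜ
    (fun-atᶜ (fun-var 0) (fun-const (code ⊥'))) (fun-atᶜ (fun-var 0) (fun-const (code ψ₀)))) sig-S

  private
    Base : Env → Set
    Base ρ = Theorem T (ρ 1) ⊎ (ρ 1 ≡ code ⊥' × Theorem S (trigger (ρ 2)))

    Step : Env → Set
    Step ρ = Rule (ρ 6) (ρ 3) (ρ 5) (ρ 1)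

    sig-Base : Sig Base
    sig-Base = sig-⊎ (sig-rename (1 ◂ id) sig-T)
      (sig-× (sig-rename (1 ◂ id) (graph (fun-const (code ⊥')))) (sig-rename (2 ◂ id) sig-trigger))

    sig-Step : Sig Step
    sig-Step = sig-rename (3 ◂ 5 ◂ 1 ◂ 6 ◂ id) sig-Rule

    open Closure sig-Base sig-Step

    D⇒Y : ∀ {ρ i x} → D ρ i x → Y (ρ 0) x
    D⇒Y (base (inj₁ t)) = thm t
    D⇒Y (base (inj₂ (refl , t))) = bot t
    D⇒Y (step _ _ d d' r) = rule (D⇒Y d) (D⇒Y d') r

    Y⇒D : ∀ {ρ x} → Y (ρ 0) x → ∃ λ i → D ρ i x
    Y⇒D (thm t) = 0 , base (inj₁ t)
    Y⇒D (bot t) = 0 , base (inj₂ (refl , t))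
    Y⇒D (rule y y' r) = let i , d = Y⇒D y ; j , d' = Y⇒D y' in
      suc (i ⊔ j) , step (s≤s (m≤m⊔n i j)) (s≤s (m≤n⊔m i j)) d d' r

  sig-Y : Sig (λ ρ → Y (ρ 1) (ρ 0))
  sig-Y = sig-iff (λ (_ , d) → D⇒Y d) Y⇒D (sig-∃ sig-D)

  module _ {e : ℕ} (Q : Formula → Set)
    (Q-theorem : ∀ {φ} → T ⊢ φ → Q φ)
    (Q-⊥ : Theorem S (trigger e) → Q ⊥')
    (Q-∧ : ∀ {φ ψ} → Q φ → Q ψ → Q (φ ∧' ψ))
    (Q-at : ∀ u → Y e u → ∃ λ θ → code θ ≡ atᶜ e u × Q θ)
    (Q-⇔ : ∀ {φ ψ} → T ⊢ φ ⇔' ψ → Q φ → Q ψ)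
    where

    -- Applied twice: to `Constant T`, while it is still open whether `⊥'` lies in `Y`, and
    -- afterwards to provability in `T`. For the second use `Q-at` receives the membership of u,
    -- from which PA proves Pr(u).
    Y-invariant : ∀ {x} → Y e x → ∃ λ φ → code φ ≡ x × Q φ
    Y-invariant (thm (φ , p , d)) = φ , p , Q-theorem d
    Y-invariant (bot t) = ⊥' , refl , Q-⊥ t
    Y-invariant (rule y y' (inj₁ p)) with Y-invariant y | Y-invariant y'
    ... | φ , p₁ , c | ψ , p₂ , d = φ ∧' ψ , trans (code-∧' φ ψ) (trans (cong₂ conjᶜ p₁ p₂) (sym p)) , Q-∧ c d
    Y-invariant (rule {u = u} y y' (inj₂ (inj₁ p))) = let θ , q , c = Q-at u y in θ , trans q (sym p) , c
    Y-invariant (rule {w = w} y y' (inj₂ (inj₂ (χ , p , d)))) with Y-invariant y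
    ... | φ , p₁ , c with decode-⇔ χ φ {w} (trans p (cong (λ a → iffᶜ a w) (sym p₁)))
    ... | ψ , refl , p₂ = ψ , p₂ , Q-⇔ d c

-- The provability predicate

subst-own : ∀ φ → subst (var 0 • (var ∘ suc)) φ ≡ φ
subst-own φ = trans (subst-cong (λ { zero → refl ; (suc i) → refl }) φ) (subst-var φ)

∀-intro-closed : ∀ {T Γ φ} → T ⊢ φ → T ∣ Γ ⊢ ∀' φ
∀-intro-closed d = closed (∀I d)

∃-map : ∀ {T φ ψ} → T ⊢ φ ⇒ ψ → T ⊢ ∃' φ ⇒ ∃' ψ
∃-map {ψ = ψ} d = ⇒I (∃E h0 (∃I' {σ = var ∘ suc} {φ = ψ} (var 0) (coe (sym (subst-own ψ)) (⇒E (closed d) h0))))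

∀-elim-own : ∀ {T Γ φ} → T ∣ Γ ⊢ shift (∀' φ) → T ∣ Γ ⊢ φ
∀-elim-own {φ = φ} d = coe (subst-own φ) (∀E' {σ = var ∘ suc} {φ = φ} (var 0) d)

∀-map : ∀ {T φ ψ} → T ⊢ φ ⇒ ψ → T ⊢ ∀' φ ⇒ ∀' ψ
∀-map d = ⇒I (∀I (⇒E (closed d) (∀-elim-own h0)))

compose : ∀ {T φ ψ χ} → T ⊢ φ ⇒ ψ → T ⊢ ψ ⇒ χ → T ⊢ φ ⇒ χ
compose d e = ⇒I (⇒E (closed e) (⇒E (closed d) h0))

-- According to `T`, `φ` holds for all values of variable 0 or for none; other variables remain as
-- parameters. Unlike being a sentence, this is preserved by `T`-equivalence.
Constant : Theory → Formula → Set
Constant T φ = T ⊢ ∃' φ ⇒ ∀' φ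

constant-theorem : ∀ {T φ} → T ⊢ φ → Constant T φ
constant-theorem d = ⇒I (∀-intro-closed d)

constant-⊥ : ∀ {T} → Constant T ⊥'
constant-⊥ = ⇒I (∃E h0 (efq h0))

constant-∧ : ∀ {T φ ψ} → Constant T φ → Constant T ψ → Constant T (φ ∧' ψ)
constant-∧ c d = ⇒I (⇒E (⇒E (closed both) (⇒E (closed (compose (∃-map (⇒I (∧E₁ h0))) c)) h0))
  (⇒E (closed (compose (∃-map (⇒I (∧E₂ h0))) d)) h0))
  where
  both : ∀ {T φ ψ} → T ⊢ ∀' φ ⇒ ∀' ψ ⇒ ∀' (φ ∧' ψ)
  both = ⇒I (⇒I (∀I (∧I (∀-elim-own h1) (∀-elim-own h0))))

constant-⇔ : ∀ {T φ ψ} → T ⊢ φ ⇔' ψ → Constant T φ → Constant T ψ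
constant-⇔ d c = compose (∃-map (∧E₂ d)) (compose c (∀-map (∧E₁ d)))

constant-sentence : ∀ {T} φ → Below 0 φ → Constant T φ
constant-sentence φ b = ⇒I (∃E h0 (coe (sym (Below-closed (∀' φ) (Below-mono z≤n φ b) _))
  (∀I (coe (Below-closed φ b _) h0))))

ψ₀-not-constant : ∀ {T} → Consistent T → PA ⊑ T → ¬ Constant T ψ₀
ψ₀-not-constant T-consistent PA⊑T c = T-consistent (⇒E (PA⊑T _ (⇒I (s-nonzero h0)))
  (∀E (s zero) (⇒E c (∃I zero (refl zero)))))

module Main (S T : Theory)
  (S-consistent : Consistent S) (S-ce : CETheory S) (PA⊑S : PA ⊑ S)
  (T-consistent : Consistent T) (T-ce : CETheory T) (PA⊑T : PA ⊑ T)
  where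

  open Closed S T S-ce T-ce
  open Representation {Y} sig-Y {Rule} sig-Rule {λ e u → Theorem S (atᶜ e u)} sig-P

  -- This closes the self-reference without a diagonal lemma. `Core₄` speaks of its own code only
  -- through variable 2, and `PrF` fixes that variable by an equation instead of a substitution, so
  -- the code of `Pr` is a pairing expression in `n`.
  n : ℕ
  n = code Core₄

  Pr : Formula
  Pr = PrF n

  code-Pr : code Pr ≡ prᶜ n
  code-Pr = trans (code-∃' (∃' (∃' matrix'))) (cong ⟪ 7 ,_⟫ (trans (code-∃' (∃' matrix')) (cong ⟪ 7 ,_⟫
    (trans (code-∃' matrix') (cong ⟪ 7 ,_⟫ (trans (code-∧' (var 2 ≐ numeral n) Core₄)
      (cong (λ a → conjᶜ a n) (code-≐-numeral 2 n))))))))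
    where
    matrix' : Formula
    matrix' = var 2 ≐ numeral n ∧' Core₄

  Pr-at : ℕ → Formula
  Pr-at = at Pr

  code-Pr-at : ∀ u → code (Pr-at u) ≡ atᶜ n u
  code-Pr-at u = trans (code-at Pr u) (cong (λ a → ⟪ 7 , conjᶜ ⟪ 0 , ⟪ ⟪ 0 , 0 ⟫ , numeralᶜ u ⟫ ⟫ a ⟫) code-Pr)

  instance-Below : ∀ u → Below 0 (Pr [ numeral u ])
  instance-Below u = subst-Below (λ { zero _ → numeral-Below 0 u ; (suc i) (s≤s ()) }) Pr (PrF-Below n)

  Pr-at-Below : ∀ u → Below 0 (Pr-at u)
  Pr-at-Below u = (s≤s z≤n , numeral-Below 1 u) , PrF-Below n

  Pr-at⇒ : ∀ {U} u → U ⊢ Pr-at u ⇒ Pr [ numeral u ]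
  Pr-at⇒ u = ⇒I (∃E h0 (coe (sym (Below-closed (Pr [ numeral u ]) (instance-Below u) _))
    (repl' {σ = var} Pr (∧E₁ h0)
      (coe (sym (trans (Below-cong Pr (PrF-Below n) (λ { zero _ → refl ; (suc i) (s≤s ()) })) (subst-var Pr))) (∧E₂ h0)))))

  ⇒Pr-at : ∀ {U} u → U ⊢ Pr [ numeral u ] ⇒ Pr-at u
  ⇒Pr-at u = ⇒I (∃I (numeral u) (∧I (coe (cong (numeral u ≐_) (sym (numeral-closed _ u))) (refl (numeral u))) h0))

  P-sound : ∀ u → Theorem S (atᶜ n u) → S ⊢ Pr [ numeral u ]
  P-sound u t = ⇒E (Pr-at⇒ u) (theorem-elim (Pr-at u) (sym (code-Pr-at u)) t)

  P-complete : ∀ u → S ⊢ Pr [ numeral u ] → Theorem S (atᶜ n u)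
  P-complete u d = Pr-at u , code-Pr-at u , ⇒E (⇒Pr-at u) d

  open At n rule S-consistent PA⊑S P-sound P-complete

  -- It holds whether or not the trigger fires, as `⊥'` is constant too. This matters, since the
  -- proof that the trigger does not fire rests on it.
  Y-constant : ∀ {x} → Y n x → ∃ λ φ → code φ ≡ x × Constant T φ
  Y-constant = Y-invariant (Constant T) constant-theorem (λ _ → constant-⊥) constant-∧
    (λ u _ → Pr-at u , code-Pr-at u , constant-sentence (Pr-at u) (Pr-at-Below u)) constant-⇔

  Y-sentential : ∀ φ → Y n (code φ) → Constant T φ
  Y-sentential φ y = let ψ , e , c = Y-constant y in ≡.subst (Constant T) (code-injective ψ φ e) c

  not-monotone : ¬ (S ⊢ Pr [ ⌜ ⊥' ⌝ ] ⇒ Pr [ ⌜ ψ₀ ⌝ ])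
  not-monotone d = ψ₀-not-constant T-consistent PA⊑T (Y-sentential ψ₀ (represents⁻ (⇒E d (PA⊑S _ (represents⁺ (bot fired))))))
    where
    fired : Theorem S (trigger n)
    fired = (Pr-at (code ⊥') ⇒ Pr-at (code ψ₀)) ,
      trans (code-⇒ (Pr-at (code ⊥')) (Pr-at (code ψ₀))) (cong₂ impᶜ (code-Pr-at (code ⊥')) (code-Pr-at (code ψ₀))) ,
      compose (Pr-at⇒ (code ⊥')) (compose d (⇒Pr-at (code ψ₀)))

  not-fired : ¬ Theorem S (trigger n)
  not-fired t = not-monotone (compose (⇒Pr-at (code ⊥')) (compose
    (theorem-elim (Pr-at (code ⊥') ⇒ Pr-at (code ψ₀))
      (sym (trans (code-⇒ (Pr-at (code ⊥')) (Pr-at (code ψ₀))) (cong₂ impᶜ (code-Pr-at (code ⊥')) (code-Pr-at (code ψ₀))))) t)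
    (Pr-at⇒ (code ψ₀))))

  -- With the trigger known to be silent, `⊥'` is no generator and every rule preserves provability
  -- in `T`; for the rule producing Pr(u), PA already proves Pr(u) when u is in `Y`.
  Y-sound : ∀ {x} → Y n x → Theorem T x
  Y-sound = Y-invariant (T ⊢_) id (λ t → ⊥-elim (not-fired t)) ∧I
    (λ u y → Pr-at u , code-Pr-at u , ⇒E (⇒Pr-at u) (PA⊑T _ (represents⁺ y))) (λ d c → ⇒E (∧E₁ d) c)

  pr-Σ₁ : Σ₁ Pr
  pr-Σ₁ = PrF-Σ₁ n

  pr-prov : ProvabilityPredicate S T Pr
  pr-prov = record
    { unary = PrF-Below n
    ; prov  = λ φ → mk⇔ (λ d → PA⊑S _ (represents⁺ (thm (φ , refl , d))))
                        (λ d → theorem-elim φ refl (Y-sound (represents⁻ d)))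
    }

  pr-⇔ : ∀ φ ψ → T ⊢ φ ⇔' ψ → PA ⊢ Pr [ ⌜ φ ⌝ ] ⇒ Pr [ ⌜ ψ ⌝ ]
  pr-⇔ φ ψ d = ⇒I (⇒E (⇒E (closed (Pr-rule {code φ} {code φ} {code ψ}
    (inj₂ (inj₂ ((φ ⇔' ψ) , code-⇔' φ ψ , d))))) h0) h0)

  ⇔'-sym : ∀ {U φ ψ} → U ⊢ φ ⇔' ψ → U ⊢ ψ ⇔' φ
  ⇔'-sym d = ∧I (∧E₂ d) (∧E₁ d)

  pr-E : E S T Pr
  pr-E φ ψ d = ∧I (PA⊑S _ (pr-⇔ φ ψ d)) (PA⊑S _ (pr-⇔ ψ φ (⇔'-sym d)))

  pr-C : C S Pr
  pr-C φ ψ = PA⊑S _ (⇒I (⇒E (⇒E (closed (Pr-rule {code φ} {code ψ} {code (φ ∧' ψ)} (inj₁ (code-∧' φ ψ)))) (∧E₁ h0)) (∧E₂ h0)))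

  -- The closure rule reaches only the substitution-free sentence `Pr-at`; closure under
  -- `T`-equivalence then leads to the instance that D3 asks for.
  pr-D3 : D3 S Pr
  pr-D3 φ = PA⊑S _ (compose
    (⇒I (⇒E (⇒E (closed (Pr-rule {code φ} {code φ} {code (Pr-at (code φ))} (inj₂ (inj₁ (code-Pr-at (code φ)))))) h0) h0))
    (pr-⇔ (Pr-at (code φ)) (Pr [ ⌜ φ ⌝ ]) (∧I (Pr-at⇒ (code φ)) (⇒Pr-at (code φ)))))

  pr-¬M : ¬ M S T Pr
  pr-¬M m = not-monotone (m ⊥' ψ₀ (⇒I (efq h0)))

theorem4p2 : (S T : Theory) →
    Consistent S → CETheory S → PA ⊑ S →
    Consistent T → CETheory T → PA ⊑ T →
    S ⊑ T →
    ∃ λ (Pr : Formula) →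
    Σ₁ Pr × ProvabilityPredicate S T Pr ×
    E S T Pr × C S Pr × D3 S Pr × ¬ M S T Pr
theorem4p2 S T S-consistent S-ce PA⊑S T-consistent T-ce PA⊑T _ =
  Pr , pr-Σ₁ , pr-prov , pr-E , pr-C , pr-D3 , pr-¬M
  where open Main S T S-consistent S-ce PA⊑S T-consistent T-ce PA⊑T
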